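{- Let $p$ be a prime and let $\mathcal{S}$ be a non-empty set without tangents in $\mathrm{PG}(2,p)$ with $|\mathcal{S}|\le 2p$. If there is a line containing $x$ points of $\mathcal{S}$ with $x\ge |\mathcal{S}|/2-(p-1)/4$, then $\mathcal{S}$ is trivial, i.e. $\mathcal{S}$ consists of all points on two distinct lines $L_1,L_2$ other than the point $L_1\cap L_2$.
   Context: A set of points $\mathcal{S}$ in $\mathrm{PG}(2,q)$ is a set without tangents if no line meets $\mathcal{S}$ in exactly one point. -}

module Defs where

open import Data.Nat using (ℕ; suc; _+_; _*_)
open import Data.Nat.Divisibility using (_∣_; _∣?_)
open import Data.Fin using (Fin; toℕ)
open import Data.Bool using (Bool; true; false; T; _∧_)
open import Data.List using (List; []; _∷_; _++_; map; concatMap; allFin; length; filter; filterᵇ)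
open import Data.Product using (Σ; _×_; _,_)
open import Data.Sum using (_⊎_)
open import Function.Bundles using (_⇔_)
open import Relation.Nullary using (Dec; does; ¬_)
open import Relation.Binary.PropositionalEquality using (_≡_)

-- Points (and, dually, lines) of PG(2,p) over the prime field ℤ/pℤ, given by their
-- canonical homogeneous coordinates (first nonzero coordinate equal to 1):
--   P1 a b = (1,a,b),  P2 c = (0,1,c),  P3 = (0,0,1);   a, b, c ∈ {0,…,p-1}.
data PG2 (p : ℕ) : Set where
  P1 : Fin p → Fin p → PG2 p
  P2 : Fin p → PG2 p
  P3 : PG2 p

Point : ℕ → Set
Point = PG2

Line : ℕ → Set
Line = PG2

coords : ∀ {p} → PG2 p → ℕ × ℕ × ℕ
coords (P1 a b) = 1 , toℕ a , toℕ b
coords (P2 c)   = 0 , 1 , toℕ c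
coords P3       = 0 , 0 , 1

dot : ℕ × ℕ × ℕ → ℕ × ℕ × ℕ → ℕ
dot (x , y , z) (u , v , w) = x * u + y * v + z * w

Incident : ∀ {p} → Point p → Line p → Set
Incident {p} P L = p ∣ dot (coords P) (coords L)

incident? : ∀ {p} (P : Point p) (L : Line p) → Dec (Incident P L)
incident? {p} P L = p ∣? dot (coords P) (coords L)

allPoints : (p : ℕ) → List (Point p)
allPoints p = concatMap (λ a → map (P1 a) (allFin p)) (allFin p)
              ++ map P2 (allFin p) ++ (P3 ∷ [])

PointSet : ℕ → Set
PointSet p = Point p → Bool

card : ∀ {p} → PointSet p → ℕ
card {p} S = length (filterᵇ S (allPoints p))

cardOnLine : ∀ {p} → PointSet p → Line p → ℕ
cardOnLine {p} S L = length (filter (λ P → incident? P L) (filterᵇ S (allPoints p)))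

NoTangents : ∀ {p} → PointSet p → Set
NoTangents {p} S = (L : Line p) → ¬ (cardOnLine S L ≡ 1)

Trivial : ∀ {p} → PointSet p → Set
Trivial {p} S = Σ (Line p) λ L1 → Σ (Line p) λ L2 → ¬ (L1 ≡ L2) ×
  ((P : Point p) → (S P ≡ true) ⇔ ((Incident P L1 ⊎ Incident P L2) × ¬ (Incident P L1 × Incident P L2)))

{-# OPTIONS --safe #-}
-- Let n be the number of points of S off the given line L and x the number on it.  If at most one point
-- of L is outside S, counting shows that the points off L fill a line through that point.  Otherwise
-- take two points of L outside S as the directions 0 and ∞ of an affine plane with L at infinity, and
-- let R(X, y) = ∏ (X - b + y a) over the points (a, b) of S off L.  In each of the x directions y that
-- belong to S all affine lines are met, so X^p - X divides R(X, y); since the coefficient of X^(n-j) has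
-- degree at most j in y, the coefficients of X^i with i < p and i > max(n - x, n - p + 1) vanish
-- identically.  Hence R(X, 0) = X^p f + g with f, g of degree less than p/2.  As the direction 0 is not in
-- S, all roots of R(X, 0) are multiple.  The polynomial X f + g vanishes at every root of R(X, 0), and
-- f g' - f' g at every root with its multiplicity lowered by one; comparing degrees gives f g' = f' g,
-- whence g = c f.  So all but at most n - p of the points off L lie on one line of direction 0, and the
-- lines of direction ∞, which are not tangents either, require more points than S has.
module Submission where

open import Level using (Level; 0ℓ)
open import Algebra.Bundles using (CommutativeRing)

-- The constants come from one number `h`, half of p - 1 rounded down. With |S| = n + x the length
-- hypothesis reads n - x ≤ h, and |S| ≤ 2p then gives 2(n - p) ≤ h; so `h` dominates both
-- lacunarity thresholds, n - x and n - p + 1 (the case n = p being settled by x < p). Its other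
-- virtue is 2h < p: R(X, 0) has at most `h` distinct roots, since X f + g has degree at most `h`,
-- and lowering each multiplicity by one leaves at least n - h > (n - p) + h roots, more than the
-- degree of f g' - f' g allows. Multiple roots matter a second time: X f + g could be zero only if
-- every field element were a root, and then a multiple one, which would require n ≥ 2p. Finally g =
-- c f follows from f g' = f' g only because all degrees stay below p; in characteristic p a
-- derivation does not see p-th powers. Then R(X, 0) = (X^p + c) f, and by Fermat's theorem -c is
-- the only root of X^p + c in the field: this root is the one line of direction 0.

module IntegerCoefficientSolver {c ℓ : Level} (R : CommutativeRing c ℓ) where

  open import Data.Nat as ℕ using (ℕ; zero; suc)
  open import Data.Integer as ℤ using (ℤ; +_; -[1+_]; _⊖_)
  import Data.Integer.Properties as ℤₚ
  import Data.Nat.Properties as ℕₚ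
  open import Data.Maybe using (Maybe; just; nothing)
  open import Relation.Nullary using (yes; no)
  open import Relation.Binary.PropositionalEquality as ≡ using (_≡_)
  open import Algebra.Solver.Ring.AlmostCommutativeRing using
      (fromCommutativeRing; _-Raw-AlmostCommutative⟶_; Induced-equivalence)
  open import Relation.Binary.Definitions using (WeaklyDecidable)

  open CommutativeRing R
  open import Algebra.Properties.Semiring.Mult.TCOptimised semiring using (_×_; ×-homo-+; ×1-homo-*; 1+×)
  open import Algebra.Properties.Ring ring using (-‿distribˡ-*; -‿distribʳ-*)
  open import Algebra.Properties.AbelianGroup +-abelianGroup using (⁻¹-∙-comm; ε⁻¹≈ε; ⁻¹-involutive)
  open import Relation.Binary.Reasoning.Setoid setoid

  private
    -- The canonical map from the integers. With integer coefficients the solver cancels `x` against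
    -- `- x` by computing 1 - 1, and never has to compare elements of the ring itself.
    ⟦_⟧ : ℤ → Carrier
    ⟦ + n ⟧      = n × 1#
    ⟦ -[1+ n ] ⟧ = - (suc n × 1#)

    -‿homo : ∀ i → ⟦ ℤ.- i ⟧ ≈ - ⟦ i ⟧
    -‿homo (+ zero)   = sym ε⁻¹≈ε
    -‿homo (+ suc n)  = refl
    -‿homo -[1+ n ]   = sym (⁻¹-involutive _)

    ⊖-homo : ∀ m n → ⟦ m ⊖ n ⟧ ≈ m × 1# + - (n × 1#)
    ⊖-homo m zero = sym (trans (+-congˡ ε⁻¹≈ε) (+-identityʳ _))
    ⊖-homo zero (suc n) = sym (+-identityˡ _)
    ⊖-homo (suc m) (suc n) = begin
      ⟦ suc m ⊖ suc n ⟧                        ≡⟨ ≡.cong ⟦_⟧ (ℤₚ.[1+m]⊖[1+n]≡m⊖n m n) ⟩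
      ⟦ m ⊖ n ⟧                                ≈⟨ ⊖-homo m n ⟩
      a + - b                                  ≈⟨ +-congʳ (sym (+-identityˡ a)) ⟩
      0# + a + - b                             ≈⟨ +-congʳ (+-congʳ (sym (-‿inverseʳ 1#))) ⟩
      1# + - 1# + a + - b
        ≈⟨ +-congʳ (trans (+-assoc _ _ _) (trans (+-congˡ (+-comm _ _)) (sym (+-assoc _ _ _)))) ⟩
      1# + a + - 1# + - b                      ≈⟨ +-assoc _ _ _ ⟩
      1# + a + (- 1# + - b)                    ≈⟨ +-congˡ (⁻¹-∙-comm _ _) ⟩
      1# + a + - (1# + b)                      ≈⟨ +-cong (sym (1+× m 1#)) (-‿cong (sym (1+× n 1#))) ⟩
      suc m × 1# + - (suc n × 1#)              ∎
      where a = m × 1# ; b = n × 1#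

    +-homo : ∀ i j → ⟦ i ℤ.+ j ⟧ ≈ ⟦ i ⟧ + ⟦ j ⟧
    +-homo (+ m) (+ n)         = ×-homo-+ 1# m n
    +-homo (+ m) -[1+ n ]      = ⊖-homo m (suc n)
    +-homo -[1+ m ] (+ n)      = trans (⊖-homo n (suc m)) (+-comm _ _)
    +-homo -[1+ m ] -[1+ n ]   = begin
      - (suc (suc (m ℕ.+ n)) × 1#)          ≡⟨ ≡.cong (λ k → - (suc k × 1#)) (≡.sym (ℕₚ.+-suc m n)) ⟩
      - ((suc m ℕ.+ suc n) × 1#)            ≈⟨ -‿cong (×-homo-+ 1# (suc m) (suc n)) ⟩
      - (suc m × 1# + suc n × 1#)           ≈⟨ sym (⁻¹-∙-comm _ _) ⟩
      - (suc m × 1#) + - (suc n × 1#)       ∎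

    *-homo : ∀ i j → ⟦ i ℤ.* j ⟧ ≈ ⟦ i ⟧ * ⟦ j ⟧
    *-homo (+ m) (+ n) = trans (reflexive (≡.cong ⟦_⟧ (≡.sym (ℤₚ.pos-* m n)))) (×1-homo-* m n)
    *-homo (+ m) -[1+ n ] = begin
      ⟦ + m ℤ.* -[1+ n ] ⟧          ≡⟨ ≡.cong ⟦_⟧ (≡.sym (ℤₚ.neg-distribʳ-* (+ m) (+ suc n))) ⟩
      ⟦ ℤ.- (+ m ℤ.* + suc n) ⟧     ≈⟨ -‿homo (+ m ℤ.* + suc n) ⟩
      - ⟦ + m ℤ.* + suc n ⟧         ≈⟨ -‿cong (*-homo (+ m) (+ suc n)) ⟩
      - (m × 1# * suc n × 1#)       ≈⟨ -‿distribʳ-* _ _ ⟩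
      m × 1# * - (suc n × 1#)       ∎
    *-homo -[1+ m ] (+ n) = begin
      ⟦ -[1+ m ] ℤ.* + n ⟧          ≡⟨ ≡.cong ⟦_⟧ (≡.sym (ℤₚ.neg-distribˡ-* (+ suc m) (+ n))) ⟩
      ⟦ ℤ.- (+ suc m ℤ.* + n) ⟧     ≈⟨ -‿homo (+ suc m ℤ.* + n) ⟩
      - ⟦ + suc m ℤ.* + n ⟧         ≈⟨ -‿cong (*-homo (+ suc m) (+ n)) ⟩
      - (suc m × 1# * n × 1#)       ≈⟨ -‿distribˡ-* _ _ ⟩
      - (suc m × 1#) * n × 1#       ∎
    *-homo -[1+ m ] -[1+ n ] = begin
      ⟦ + suc m ℤ.* + suc n ⟧                  ≈⟨ *-homo (+ suc m) (+ suc n) ⟩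
      suc m × 1# * suc n × 1#                  ≈⟨ sym (⁻¹-involutive _) ⟩
      - - (suc m × 1# * suc n × 1#)            ≈⟨ -‿cong (-‿distribˡ-* _ _) ⟩
      - (- (suc m × 1#) * suc n × 1#)          ≈⟨ -‿distribʳ-* _ _ ⟩
      - (suc m × 1#) * - (suc n × 1#)          ∎

    morphism : ℤ.+-*-rawRing -Raw-AlmostCommutative⟶ fromCommutativeRing R
    morphism = record
      { ⟦_⟧ = ⟦_⟧ ; +-homo = +-homo ; *-homo = *-homo ; -‿homo = -‿homo ; 0-homo = refl ; 1-homo = refl }

    coeff≟ : WeaklyDecidable (Induced-equivalence morphism)
    coeff≟ i j with i ℤ.≟ j
    ... | yes i≡j = just (reflexive (≡.cong ⟦_⟧ i≡j))
    ... | no  _   = nothing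

  open import Algebra.Solver.Ring ℤ.+-*-rawRing (fromCommutativeRing R) morphism coeff≟ public using
      (solve; _:=_; _:+_; _:*_; :-_)

open import Defs
open import Data.Nat as ℕ using (ℕ; zero; suc; _∸_; _≤_; _<_; z≤n; s≤s)
import Data.Nat.Properties as ℕₚ
open import Data.Nat.Primality using (Prime)
open import Data.Fin as Fin using (Fin; toℕ; fromℕ)
import Data.Fin.Properties as Finₚ
open import Data.Bool using (true)
open import Data.List using (List; []; _∷_; _++_; length; map; filter; filterᵇ; foldr; allFin; concatMap;
    cartesianProductWith)
open import Data.List.Properties using (length-++; length-map; length-tabulate; filter-notAll; map-cong)
open import Data.List.Membership.Propositional using (_∈_)
open import Data.List.Membership.Propositional.Properties
  using (∈-∃++; ∈-++⁺ˡ; ∈-++⁺ʳ; ∈-++⁻; ∈-map⁺; ∈-map⁻; ∈-filter⁺; ∈-filter⁻; ∈-allFin; ∈-concatMap⁺;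
      ∈-cartesianProductWith⁻)
open import Data.List.Relation.Unary.All as All using (All; []; _∷_)
open import Data.List.Relation.Unary.Any as Any using (here; there)
open import Data.List.Relation.Unary.AllPairs using ([]; _∷_)
open import Data.List.Relation.Unary.Unique.Propositional using (Unique)
open import Data.List.Relation.Unary.Unique.Propositional.Properties as Uniqueₚ using (Unique[x∷xs]⇒x∉xs)
open import Data.List.Relation.Binary.Permutation.Propositional as Perm using (_↭_; ↭-refl; ↭-trans; ↭-prep)
open import Data.List.Relation.Binary.Permutation.Propositional.Properties using (shift; ∈-resp-↭; ↭-length)
open import Data.Product using (Σ; ∃; _×_; _,_; proj₁; proj₂)
open import Data.Sum as Sum using (_⊎_; inj₁; inj₂)
open import Data.Empty using (⊥; ⊥-elim)
open import Function using (_∘_; id; Equivalence; mk⇔)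
open import Relation.Nullary using (¬_; Dec; yes; no; contradiction)
open import Relation.Nullary.Decidable using (map′; _×-dec_; ¬?; decidable-stable)
open import Relation.Unary using (Pred; Decidable)
open import Relation.Unary.Properties using (∁?)
open import Relation.Binary.Definitions using (DecidableEquality)
open import Relation.Binary.Structures using (IsEquivalence)
open import Relation.Binary.PropositionalEquality
  using (_≡_; _≢_; _≗_; refl; sym; trans; cong; cong₂; subst; subst₂; isEquivalence; module ≡-Reasoning)

-- Counting with duplicate-free lists

module _ {A : Set} where

  -- The surplus `zs` keeps its multiplicities. For a list of roots that contains every field
  -- element it lists the roots of the cofactor of X^p - X.
  unique-⊆⇒↭ : ∀ {xs ys : List A} → Unique xs → (∀ {x} → x ∈ xs → x ∈ ys) → ∃ λ zs → ys ↭ xs ++ zs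
  unique-⊆⇒↭ {[]} {ys} _ _ = ys , ↭-refl
  unique-⊆⇒↭ {x ∷ xs} {ys} uniq@(_ ∷ uniq′) sub with ∈-∃++ (sub (here refl))
  ... | us , vs , refl = proj₁ rec , ↭-trans (shift x us vs) (↭-prep x (proj₂ rec))
    where
    sub′ : ∀ {y} → y ∈ xs → y ∈ us ++ vs
    sub′ {y} y∈xs with ∈-resp-↭ (shift x us vs) (sub (there y∈xs))
    ... | here refl = contradiction y∈xs (Unique[x∷xs]⇒x∉xs uniq)
    ... | there y∈ = y∈
    rec = unique-⊆⇒↭ uniq′ sub′

  unique-⊆⇒length≤ : ∀ {xs ys : List A} → Unique xs → (∀ {x} → x ∈ xs → x ∈ ys) → length xs ≤ length ys
  unique-⊆⇒length≤ {xs} uniq sub with unique-⊆⇒↭ uniq sub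
  ... | zs , ys↭ = subst (length xs ≤_) (sym (trans (↭-length ys↭) (length-++ xs))) (ℕₚ.m≤m+n _ _)

  length-filter-∁ : ∀ {P : Pred A 0ℓ} (P? : Decidable P) xs →
      length (filter P? xs) ℕ.+ length (filter (∁? P?) xs) ≡ length xs
  length-filter-∁ P? [] = refl
  length-filter-∁ P? (x ∷ xs) with P? x
  ... | yes _ = cong suc (length-filter-∁ P? xs)
  ... | no  _ = trans (ℕₚ.+-suc _ _) (cong suc (length-filter-∁ P? xs))

  -- The form in which the absence of tangents is used: a line through a point of the set carries a
  -- second one.
  unique-another : DecidableEquality A → ∀ {xs : List A} {x} → Unique xs → x ∈ xs → length xs ≢ 1 → ∃ λ y →
      y ∈ xs × y ≢ x
  unique-another _ {_ ∷ []} _ _ l = contradiction refl l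
  unique-another _≟_ {u ∷ v ∷ _} {x} ((u≢v All.∷ _) ∷ _) _ _ with u ≟ x
  ... | yes refl = v , there (here refl) , λ v≡u → u≢v (sym v≡u)
  ... | no u≢x = u , here refl , u≢x

module _ {A B : Set} (f : A → B) where

  unique-map⇒injective : ∀ {xs} → Unique (map f xs) → ∀ {x y} → x ∈ xs → y ∈ xs → f x ≡ f y → x ≡ y
  unique-map⇒injective _ (here refl) (here refl) _ = refl
  unique-map⇒injective uniq (here refl) (there y∈) eq =
      contradiction (subst (_∈ map f _) (sym eq) (∈-map⁺ f y∈)) (Unique[x∷xs]⇒x∉xs uniq)
  unique-map⇒injective uniq (there x∈) (here refl) eq =
      contradiction (subst (_∈ map f _) eq (∈-map⁺ f x∈)) (Unique[x∷xs]⇒x∉xs uniq)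
  unique-map⇒injective (_ ∷ uniq) (there x∈) (there y∈) eq = unique-map⇒injective uniq x∈ y∈ eq

  injective⇒unique-map : ∀ {xs} → Unique xs → (∀ {x y} → x ∈ xs → y ∈ xs → f x ≡ f y → x ≡ y) → Unique (map f xs)
  injective⇒unique-map {[]} _ _ = []
  injective⇒unique-map {x ∷ xs} uniq@(_ ∷ uniq′) inj =
    All.tabulate (λ y∈ fx≡y → let (z , z∈ , y≡fz) = ∈-map⁻ f y∈ in
      Unique[x∷xs]⇒x∉xs uniq (subst (_∈ xs) (sym (inj (here refl) (there z∈) (trans fx≡y y≡fz))) z∈))
    ∷ injective⇒unique-map uniq′ (λ x∈ y∈ → inj (there x∈) (there y∈))

-- The prime field, Fermat's theorem and inverses

module PrimeField (p : ℕ) (p-prime : Prime p) where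

  open import Data.Nat.DivMod using (_%_; _mod_; m%n<n; m<n⇒m%n≡m; %-distribˡ-+; %-distribˡ-*)
  open import Data.Nat.Divisibility using (_∣_; ∣⇒≤; m∣m*n; divides; m%n≡0⇒n∣m; n∣m⇒m%n≡0)
  open import Data.Nat.Primality using (prime⇒nonZero; prime⇒nonTrivial; euclidsLemma)
  open import Data.Nat.Combinatorics using (_C_; nCn≡1; nC1≡n; nCk+nC[k+1]≡[n+1]C[k+1])
  open import Algebra.Structures {A = Fin p} _≡_ using (IsCommutativeRing)

  instance
    p≢0 : ℕ.NonZero p
    p≢0 = prime⇒nonZero p-prime

  1<p : 1 < p
  1<p = ℕ.nonTrivial⇒n>1 p {{prime⇒nonTrivial p-prime}}

  F : Set
  F = Fin p

  infixl 6 _+_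
  infixl 7 _*_
  infix  8 -_

  -- Sealed, so that field expressions are compared as they stand and do not unfold into remainders
  -- modulo `p`.
  abstract
    ι : ℕ → F
    ι n = n mod p

    _+_ _*_ : F → F → F
    a + b = ι (toℕ a ℕ.+ toℕ b)
    a * b = ι (toℕ a ℕ.* toℕ b)

    -_ : F → F
    - a = ι (p ∸ toℕ a)

    toℕ-ι : ∀ n → toℕ (ι n) ≡ n % p
    toℕ-ι n = Finₚ.toℕ-fromℕ< (m%n<n n p)

    private
      ι-cong : ∀ {m n} → m % p ≡ n % p → ι m ≡ ι n
      ι-cong {m} {n} eq = Finₚ.toℕ-injective (trans (toℕ-ι m) (trans eq (sym (toℕ-ι n))))

    ι-toℕ : ∀ a → ι (toℕ a) ≡ a
    ι-toℕ a = Finₚ.toℕ-injective (trans (toℕ-ι (toℕ a)) (m<n⇒m%n≡m (Finₚ.toℕ<n a)))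

    ι-+ : ∀ m n → ι (m ℕ.+ n) ≡ ι m + ι n
    ι-+ m n = ι-cong (trans (%-distribˡ-+ m n p) (sym (cong₂ (λ i j → (i ℕ.+ j) % p) (toℕ-ι m) (toℕ-ι n))))

    ι-* : ∀ m n → ι (m ℕ.* n) ≡ ι m * ι n
    ι-* m n = ι-cong (trans (%-distribˡ-* m n p) (sym (cong₂ (λ i j → (i ℕ.* j) % p) (toℕ-ι m) (toℕ-ι n))))

    ι≡0⇒p∣ : ∀ n → ι n ≡ ι 0 → p ∣ n
    ι≡0⇒p∣ n eq = m%n≡0⇒n∣m n p (trans (sym (toℕ-ι n))
        (trans (cong toℕ eq) (trans (toℕ-ι 0) (m<n⇒m%n≡m (ℕₚ.<-trans (s≤s z≤n) 1<p)))))

    p∣⇒ι≡0 : ∀ n → p ∣ n → ι n ≡ ι 0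
    p∣⇒ι≡0 n p∣n = ι-cong (trans (n∣m⇒m%n≡0 n p p∣n) (sym (m<n⇒m%n≡m (ℕₚ.<-trans (s≤s z≤n) 1<p))))

    -‿inverseʳ : ∀ a → a + - a ≡ ι 0
    -‿inverseʳ a = begin
      a + - a                           ≡⟨ cong (_+ - a) (sym (ι-toℕ a)) ⟩
      ι (toℕ a) + ι (p ∸ toℕ a)         ≡⟨ sym (ι-+ (toℕ a) (p ∸ toℕ a)) ⟩
      ι (toℕ a ℕ.+ (p ∸ toℕ a))         ≡⟨ cong ι (ℕₚ.m+[n∸m]≡n (ℕₚ.<⇒≤ (Finₚ.toℕ<n a))) ⟩
      ι p                               ≡⟨ p∣⇒ι≡0 p (divides 1 (sym (ℕₚ.*-identityˡ p))) ⟩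
      ι 0                               ∎
      where open ≡-Reasoning

  0# 1# : F
  0# = ι 0
  1# = ι 1

  private
    -- A view of field elements as images of naturals: matching on it transports the ring laws from
    -- ℕ along the homomorphism `ι`.
    data Residue : F → Set where
      residue : ∀ m → Residue (ι m)

    residueOf : ∀ a → Residue a
    residueOf a = subst Residue (ι-toℕ a) (residue (toℕ a))

    +-assoc′ : ∀ a b c → (a + b) + c ≡ a + (b + c)
    +-assoc′ a b c with residueOf a | residueOf b | residueOf c
    ... | residue i | residue j | residue k = begin
      (ι i + ι j) + ι k        ≡⟨ cong (_+ ι k) (ι-+ i j) ⟨
      ι (i ℕ.+ j) + ι k        ≡⟨ ι-+ (i ℕ.+ j) k ⟨
      ι (i ℕ.+ j ℕ.+ k)        ≡⟨ cong ι (ℕₚ.+-assoc i j k) ⟩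
      ι (i ℕ.+ (j ℕ.+ k))      ≡⟨ ι-+ i (j ℕ.+ k) ⟩
      ι i + ι (j ℕ.+ k)        ≡⟨ cong (ι i +_) (ι-+ j k) ⟩
      ι i + (ι j + ι k)        ∎
      where open ≡-Reasoning

    *-assoc′ : ∀ a b c → (a * b) * c ≡ a * (b * c)
    *-assoc′ a b c with residueOf a | residueOf b | residueOf c
    ... | residue i | residue j | residue k = begin
      (ι i * ι j) * ι k        ≡⟨ cong (_* ι k) (ι-* i j) ⟨
      ι (i ℕ.* j) * ι k        ≡⟨ ι-* (i ℕ.* j) k ⟨
      ι (i ℕ.* j ℕ.* k)        ≡⟨ cong ι (ℕₚ.*-assoc i j k) ⟩
      ι (i ℕ.* (j ℕ.* k))      ≡⟨ ι-* i (j ℕ.* k) ⟩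
      ι i * ι (j ℕ.* k)        ≡⟨ cong (ι i *_) (ι-* j k) ⟩
      ι i * (ι j * ι k)        ∎
      where open ≡-Reasoning

    +-comm′ : ∀ a b → a + b ≡ b + a
    +-comm′ a b with residueOf a | residueOf b
    ... | residue i | residue j = trans (sym (ι-+ i j)) (trans (cong ι (ℕₚ.+-comm i j)) (ι-+ j i))

    *-comm′ : ∀ a b → a * b ≡ b * a
    *-comm′ a b with residueOf a | residueOf b
    ... | residue i | residue j = trans (sym (ι-* i j)) (trans (cong ι (ℕₚ.*-comm i j)) (ι-* j i))

    distribˡ′ : ∀ a b c → a * (b + c) ≡ a * b + a * c
    distribˡ′ a b c with residueOf a | residueOf b | residueOf c
    ... | residue i | residue j | residue k = begin
      ι i * (ι j + ι k)              ≡⟨ cong (ι i *_) (ι-+ j k) ⟨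
      ι i * ι (j ℕ.+ k)              ≡⟨ ι-* i (j ℕ.+ k) ⟨
      ι (i ℕ.* (j ℕ.+ k))            ≡⟨ cong ι (ℕₚ.*-distribˡ-+ i j k) ⟩
      ι (i ℕ.* j ℕ.+ i ℕ.* k)        ≡⟨ ι-+ (i ℕ.* j) (i ℕ.* k) ⟩
      ι (i ℕ.* j) + ι (i ℕ.* k)      ≡⟨ cong₂ _+_ (ι-* i j) (ι-* i k) ⟩
      ι i * ι j + ι i * ι k          ∎
      where open ≡-Reasoning

    +-identityˡ′ : ∀ a → 0# + a ≡ a
    +-identityˡ′ a with residueOf a
    ... | residue m = sym (ι-+ 0 m)

    *-identityˡ′ : ∀ a → 1# * a ≡ a
    *-identityˡ′ a with residueOf a
    ... | residue m = trans (sym (ι-* 1 m)) (cong ι (ℕₚ.*-identityˡ m))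

  isCommutativeRing : IsCommutativeRing _+_ _*_ -_ 0# 1#
  isCommutativeRing = record
    { isRing = record
      { +-isAbelianGroup = record
        { isGroup = record
          { isMonoid = record
            { isSemigroup = record
              { isMagma = record { isEquivalence = isEquivalence ; ∙-cong = cong₂ _+_ }
              ; assoc = +-assoc′ }
            ; identity = +-identityˡ′ , λ a → trans (+-comm′ a 0#) (+-identityˡ′ a) }
          ; inverse = (λ a → trans (+-comm′ (- a) a) (-‿inverseʳ a)) , -‿inverseʳ
          ; ⁻¹-cong = cong -_ }
        ; comm = +-comm′ }
      ; *-cong = cong₂ _*_
      ; *-assoc = *-assoc′
      ; *-identity = *-identityˡ′ , λ a → trans (*-comm′ a 1#) (*-identityˡ′ a)
      ; distrib = distribˡ′ , λ a b c →
          trans (*-comm′ (b + c) a) (trans (distribˡ′ a b c) (cong₂ _+_ (*-comm′ a b) (*-comm′ a c))) }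
    ; *-comm = *-comm′ }

  F-commutativeRing : CommutativeRing 0ℓ 0ℓ
  F-commutativeRing = record { isCommutativeRing = isCommutativeRing }

  module F-Solver = IntegerCoefficientSolver F-commutativeRing
  open F-Solver

  open CommutativeRing F-commutativeRing public
    using (+-identityˡ; +-identityʳ; +-assoc; +-comm; *-assoc; *-comm; *-identityˡ; *-identityʳ; distribˡ;
        distribʳ; zeroˡ; zeroʳ; -‿inverseˡ)

  open import Algebra.Properties.Semiring.Exp (CommutativeRing.semiring F-commutativeRing) public using (_^_)
  open import Algebra.Properties.Semiring.Mult (CommutativeRing.semiring F-commutativeRing) using () renaming
      (_×_ to _×ᶠ_)
  open import Algebra.Properties.Semiring.Sum (CommutativeRing.semiring F-commutativeRing) using
      (sum; sum-cong-≗; sum-replicate-zero; sum-init-last)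
  import Algebra.Properties.CommutativeSemiring.Binomial (CommutativeRing.commutativeSemiring F-commutativeRing)
      as Binomial

  ι-suc : ∀ n → ι (suc n) ≡ 1# + ι n
  ι-suc n = ι-+ 1 n

  1≢0 : 1# ≢ 0#
  1≢0 eq = ℕₚ.<⇒≱ 1<p (∣⇒≤ (ι≡0⇒p∣ 1 eq))

  ι-injective : ∀ {m n} → m < p → n < p → ι m ≡ ι n → m ≡ n
  ι-injective {m} {n} m<p n<p eq = begin
    m               ≡⟨ m<n⇒m%n≡m m<p ⟨
    m % p           ≡⟨ toℕ-ι m ⟨
    toℕ (ι m)       ≡⟨ cong toℕ eq ⟩
    toℕ (ι n)       ≡⟨ toℕ-ι n ⟩
    n % p           ≡⟨ m<n⇒m%n≡m n<p ⟩
    n               ∎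
    where open ≡-Reasoning

  integral : ∀ a b → a * b ≡ 0# → a ≡ 0# ⊎ b ≡ 0#
  integral a b ab≡0 with residueOf a | residueOf b
  ... | residue i | residue j =
    Sum.map (p∣⇒ι≡0 i) (p∣⇒ι≡0 j) (euclidsLemma i j p-prime (ι≡0⇒p∣ (i ℕ.* j) (trans (ι-* i j) ab≡0)))

  *-≢0 : ∀ {a b} → a ≢ 0# → b ≢ 0# → a * b ≢ 0#
  *-≢0 a≢0 b≢0 ab≡0 = Sum.[ a≢0 , b≢0 ]′ (integral _ _ ab≡0)

  x+-y≡0⇒x≡y : ∀ x y → x + - y ≡ 0# → x ≡ y
  x+-y≡0⇒x≡y x y eq = begin
    x                ≡⟨ solve 2 (λ x y → x := (x :+ :- y) :+ y) refl x y ⟩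
    (x + - y) + y    ≡⟨ cong (_+ y) eq ⟩
    0# + y           ≡⟨ +-identityˡ y ⟩
    y                ∎
    where open ≡-Reasoning

  *-cancelˡ : ∀ {a x y} → a ≢ 0# → a * x ≡ a * y → x ≡ y
  *-cancelˡ {a} {x} {y} a≢0 eq with integral a (x + - y)
    (trans (solve 3 (λ a x y → a :* (x :+ :- y) := a :* x :+ :- (a :* y)) refl a x y)
        (trans (cong (_+ - (a * y)) eq) (-‿inverseʳ _)))
  ... | inj₁ a≡0 = contradiction a≡0 a≢0
  ... | inj₂ x-y≡0 = x+-y≡0⇒x≡y x y x-y≡0

  -- The denominator-free form of C(n+1, k+1) = (n+1)/(k+1) · C(n, k), to which Euclid's lemma
  -- applies when n + 1 is prime.
  absorption : ∀ n k → suc k ℕ.* (suc n C suc k) ≡ suc n ℕ.* (n C k)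
  absorption zero zero = refl
  absorption zero (suc k) = ℕₚ.*-zeroʳ (suc (suc k))
  absorption (suc n) zero = trans (ℕₚ.*-identityˡ _) (trans (nC1≡n (suc (suc n))) (sym (ℕₚ.*-identityʳ _)))
  absorption (suc n) (suc k) = begin
    suc (suc k) ℕ.* (suc (suc n) C suc (suc k))
      ≡⟨ cong (suc (suc k) ℕ.*_) (nCk+nC[k+1]≡[n+1]C[k+1] (suc n) (suc k)) ⟨
    suc (suc k) ℕ.* (A ℕ.+ B)
      ≡⟨ ℕₚ.*-distribˡ-+ (suc (suc k)) A B ⟩
    A ℕ.+ suc k ℕ.* A ℕ.+ suc (suc k) ℕ.* B
      ≡⟨ cong₂ (λ x y → A ℕ.+ x ℕ.+ y) (absorption n k) (absorption n (suc k)) ⟩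
    A ℕ.+ suc n ℕ.* (n C k) ℕ.+ suc n ℕ.* (n C suc k)
      ≡⟨ ℕₚ.+-assoc A _ _ ⟩
    A ℕ.+ (suc n ℕ.* (n C k) ℕ.+ suc n ℕ.* (n C suc k))
      ≡⟨ cong (A ℕ.+_) (ℕₚ.*-distribˡ-+ (suc n) (n C k) (n C suc k)) ⟨
    A ℕ.+ suc n ℕ.* (n C k ℕ.+ n C suc k)
      ≡⟨ cong (λ x → A ℕ.+ suc n ℕ.* x) (nCk+nC[k+1]≡[n+1]C[k+1] n k) ⟩
    suc (suc n) ℕ.* A ∎
    where
    open ≡-Reasoning
    A = suc n C suc k
    B = suc n C suc (suc k)

  prime∣binomial : ∀ {n k} → p ≡ suc n → k < n → p ∣ (p C suc k)
  prime∣binomial {n} {k} refl k<n with euclidsLemma (suc k) (p C suc k) p-prime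
      (subst (p ∣_) (sym (absorption n k)) (m∣m*n (n C k)))
  ... | inj₁ p∣1+k = contradiction (∣⇒≤ p∣1+k) (ℕₚ.<⇒≱ (s≤s k<n))
  ... | inj₂ p∣C = p∣C

  ×≡ι* : ∀ n x → n ×ᶠ x ≡ ι n * x
  ×≡ι* zero x = sym (zeroˡ x)
  ×≡ι* (suc n) x = begin
    x + n ×ᶠ x              ≡⟨ cong₂ _+_ (sym (*-identityˡ x)) (×≡ι* n x) ⟩
    1# * x + ι n * x       ≡⟨ distribʳ x 1# (ι n) ⟨
    (1# + ι n) * x         ≡⟨ cong (_* x) (ι-suc n) ⟨
    ι (suc n) * x          ∎
    where open ≡-Reasoning

  1^ : ∀ n → 1# ^ n ≡ 1#
  1^ zero = refl
  1^ (suc n) = trans (*-identityˡ _) (1^ n)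

  freshman : ∀ x → (x + 1#) ^ p ≡ x ^ p + 1#
  freshman x = go p refl
    where
    open ≡-Reasoning
    -- `p` is a module parameter and cannot be matched on; the variable `m` becomes `suc n`, which
    -- exposes the first and last binomial terms.
    go : ∀ m → p ≡ m → (x + 1#) ^ m ≡ x ^ m + 1#
    go zero p≡0 = contradiction (subst (1 <_) p≡0 1<p) λ ()
    go (suc n) p≡1+n = begin
      (x + 1#) ^ suc n                                   ≡⟨ Binomial.theorem (suc n) x 1# ⟩
      t Fin.zero + sum (λ i → t (Fin.suc i))
        ≡⟨ cong (t Fin.zero +_) (sum-init-last (λ i → t (Fin.suc i))) ⟩
      t Fin.zero + (sum (λ i → t (Fin.suc (Fin.inject₁ i))) + t (Fin.suc (fromℕ n)))
        ≡⟨ cong₂ (λ u v → u + (v + t (Fin.suc (fromℕ n)))) first (trans (sum-cong-≗ middle) (sum-replicate-zero n)) ⟩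
      1# + (0# + t (Fin.suc (fromℕ n)))                  ≡⟨ cong (1# +_) (+-identityˡ _) ⟩
      1# + t (Fin.suc (fromℕ n))                         ≡⟨ cong (1# +_) last ⟩
      1# + x ^ suc n                                     ≡⟨ +-comm _ _ ⟩
      x ^ suc n + 1#                                     ∎
      where
      t : Fin (suc (suc n)) → F
      t = Binomial.binomialTerm x 1# (suc n)

      term : ∀ i → t i ≡ ι (suc n C toℕ i) * x ^ toℕ i
      term i = trans (×≡ι* (suc n C toℕ i) _)
          (cong (ι (suc n C toℕ i) *_) (trans (cong (x ^ toℕ i *_) (1^ (suc n ∸ toℕ i))) (*-identityʳ _)))

      first : t Fin.zero ≡ 1#
      first = trans (term Fin.zero) (*-identityˡ 1#)

      middle : ∀ i → t (Fin.suc (Fin.inject₁ i)) ≡ 0#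
      middle i = begin
        t (Fin.suc (Fin.inject₁ i))                        ≡⟨ term (Fin.suc (Fin.inject₁ i)) ⟩
        ι (suc n C suc k) * x ^ suc k                      ≡⟨ cong (λ m → ι (m C suc k) * x ^ suc k) p≡1+n ⟨
        ι (p C suc k) * x ^ suc k
          ≡⟨ cong (_* x ^ suc k) (p∣⇒ι≡0 (p C suc k) (prime∣binomial p≡1+n k<n)) ⟩
        0# * x ^ suc k                                     ≡⟨ zeroˡ _ ⟩
        0#                                                 ∎
        where
        k = toℕ (Fin.inject₁ i)
        k<n : k < n
        k<n = subst (_< n) (sym (Finₚ.toℕ-inject₁ i)) (Finₚ.toℕ<n i)

      last : t (Fin.suc (fromℕ n)) ≡ x ^ suc n
      last = begin
        t (Fin.suc (fromℕ n))                                ≡⟨ term (Fin.suc (fromℕ n)) ⟩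
        ι (suc n C suc (toℕ (fromℕ n))) * x ^ suc (toℕ (fromℕ n))
          ≡⟨ cong (λ m → ι (suc n C suc m) * x ^ suc m) (Finₚ.toℕ-fromℕ n) ⟩
        ι (suc n C suc n) * x ^ suc n                        ≡⟨ cong (λ m → ι m * x ^ suc n) (nCn≡1 (suc n)) ⟩
        1# * x ^ suc n                                       ≡⟨ *-identityˡ _ ⟩
        x ^ suc n                                            ∎

  -- Induction on a natural representative of `x`, with `freshman` as the induction step.
  fermat : ∀ x → x ^ p ≡ x
  fermat x with residueOf x
  ... | residue m = go m
    where
    go : ∀ m → ι m ^ p ≡ ι m
    go zero = 0^ p 1<p
      where
      0^ : ∀ n → 1 < n → ι 0 ^ n ≡ ι 0
      0^ (suc n) _ = zeroˡ _
    go (suc m) = begin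
      ι (suc m) ^ p        ≡⟨ cong (_^ p) eq ⟩
      (ι m + 1#) ^ p       ≡⟨ freshman (ι m) ⟩
      ι m ^ p + 1#         ≡⟨ cong (_+ 1#) (go m) ⟩
      ι m + 1#             ≡⟨ eq ⟨
      ι (suc m)            ∎
      where
      open ≡-Reasoning
      eq : ι (suc m) ≡ ι m + 1#
      eq = trans (ι-suc m) (+-comm 1# (ι m))

  -- An inverse away from 0 by Fermat's theorem; the value at 0 carries no meaning.
  _⁻¹ : F → F
  x ⁻¹ = x ^ (p ∸ 2)

  *-inverseʳ : ∀ {x} → x ≢ 0# → x * x ⁻¹ ≡ 1#
  *-inverseʳ {x} x≢0 = *-cancelˡ x≢0 (begin
    x * (x * x ^ (p ∸ 2))       ≡⟨⟩
    x ^ (2 ℕ.+ (p ∸ 2))         ≡⟨ cong (x ^_) (ℕₚ.m+[n∸m]≡n 1<p) ⟩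
    x ^ p                       ≡⟨ fermat x ⟩
    x                           ≡⟨ *-identityʳ x ⟨
    x * 1#                      ∎)
    where open ≡-Reasoning

-- Polynomials as bounded coefficient sequences, and their linear factors

module Polynomials (p : ℕ) (p-prime : Prime p) where

  open import Algebra.Structures using (IsAbelianGroup)
  open PrimeField p p-prime
  open F-Solver using () renaming (solve to solveF; _:=_ to _:=F_; _:+_ to _:+F_; _:*_ to _:*F_)

  Series : Set
  Series = ℕ → F

  Below : ℕ → Series → Set
  Below N f = ∀ i → N ≤ i → f i ≡ 0#

  tail : Series → Series
  tail f i = f (suc i)

  -- The Cauchy product, computed from `f = f 0 + X · tail f`. This recursion is structural in the
  -- index, so the ring laws follow by induction without manipulating finite sums.
  conv : Series → Series → Series
  conv f g zero    = f 0 * g 0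
  conv f g (suc n) = f 0 * g (suc n) + conv (tail f) g n

  conv-cong : ∀ {f f′ g g′} → f ≗ f′ → g ≗ g′ → conv f g ≗ conv f′ g′
  conv-cong p q zero = cong₂ _*_ (p 0) (q 0)
  conv-cong p q (suc n) = cong₂ _+_ (cong₂ _*_ (p 0) (q (suc n))) (conv-cong (p ∘ suc) q n)

  conv-distribʳ : ∀ f g h → conv (λ i → f i + g i) h ≗ (λ i → conv f h i + conv g h i)
  conv-distribʳ f g h zero = distribʳ (h 0) (f 0) (g 0)
  conv-distribʳ f g h (suc n) = trans (cong ((f 0 + g 0) * h (suc n) +_) (conv-distribʳ (tail f) (tail g) h n))
    (solveF 5 (λ a b c x y → (a :+F b) :*F c :+F (x :+F y) :=F (a :*F c :+F x) :+F (b :*F c :+F y)) refl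
      (f 0) (g 0) (h (suc n)) (conv (tail f) h n) (conv (tail g) h n))

  conv-scale : ∀ c f g → conv (λ i → c * f i) g ≗ (λ i → c * conv f g i)
  conv-scale c f g zero = *-assoc c (f 0) (g 0)
  conv-scale c f g (suc n) = trans (cong (c * f 0 * g (suc n) +_) (conv-scale c (tail f) g n))
    (solveF 4 (λ c a b x → c :*F a :*F b :+F c :*F x :=F c :*F (a :*F b :+F x)) refl c (f 0) (g (suc n))
        (conv (tail f) g n))

  conv-suc : ∀ f g n → conv f g (suc n) ≡ conv f (tail g) n + f (suc n) * g 0
  conv-suc f g zero = refl
  conv-suc f g (suc n) = trans (cong (f 0 * g (suc (suc n)) +_) (conv-suc (tail f) g n)) (sym (+-assoc _ _ _))

  conv-comm : ∀ f g → conv f g ≗ conv g f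
  conv-comm f g zero = *-comm (f 0) (g 0)
  conv-comm f g (suc n) = begin
    f 0 * g (suc n) + conv (tail f) g n       ≡⟨ cong (f 0 * g (suc n) +_) (conv-comm (tail f) g n) ⟩
    f 0 * g (suc n) + conv g (tail f) n
      ≡⟨ solveF 3 (λ a b x → a :*F b :+F x :=F x :+F b :*F a) refl (f 0) (g (suc n)) (conv g (tail f) n) ⟩
    conv g (tail f) n + g (suc n) * f 0       ≡⟨ conv-suc g f n ⟨
    conv g f (suc n)                          ∎
    where open ≡-Reasoning

  conv-assoc : ∀ f g h → conv (conv f g) h ≗ conv f (conv g h)
  conv-assoc f g h zero = *-assoc (f 0) (g 0) (h 0)
  conv-assoc f g h (suc n) = begin
    f 0 * g 0 * h (suc n) + conv (λ i → f 0 * g (suc i) + conv (tail f) g i) h n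
      ≡⟨ cong (f 0 * g 0 * h (suc n) +_) (conv-distribʳ (λ i → f 0 * g (suc i)) (conv (tail f) g) h n) ⟩
    f 0 * g 0 * h (suc n) + (conv (λ i → f 0 * g (suc i)) h n + conv (conv (tail f) g) h n)
      ≡⟨ cong₂ (λ x y → f 0 * g 0 * h (suc n) + (x + y)) (conv-scale (f 0) (tail g) h n) (conv-assoc (tail f) g h n) ⟩
    f 0 * g 0 * h (suc n) + (f 0 * conv (tail g) h n + conv (tail f) (conv g h) n)
      ≡⟨ solveF 5 (λ a b c x y → a :*F b :*F c :+F (a :*F x :+F y) :=F a :*F (b :*F c :+F x) :+F y) refl
           (f 0) (g 0) (h (suc n)) (conv (tail g) h n) (conv (tail f) (conv g h) n) ⟩
    f 0 * (g 0 * h (suc n) + conv (tail g) h n) + conv (tail f) (conv g h) n ∎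
    where open ≡-Reasoning

  conv-zeroˡ : ∀ f g → (∀ i → f i ≡ 0#) → ∀ n → conv f g n ≡ 0#
  conv-zeroˡ f g f≡0 zero = trans (cong (_* g 0) (f≡0 0)) (zeroˡ _)
  conv-zeroˡ f g f≡0 (suc n) = trans (cong₂ _+_ (trans (cong (_* g (suc n)) (f≡0 0)) (zeroˡ _))
      (conv-zeroˡ (tail f) g (f≡0 ∘ suc) n)) (+-identityʳ 0#)

  conv-constˡ : ∀ f g → (∀ i → f (suc i) ≡ 0#) → ∀ n → conv f g n ≡ f 0 * g n
  conv-constˡ f g f≡0 zero = refl
  conv-constˡ f g f≡0 (suc n) = trans (cong (f 0 * g (suc n) +_) (conv-zeroˡ (tail f) g f≡0 n)) (+-identityʳ _)

  -- One bound is weak and the other strict: degree at most `a` times degree less than `b` has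
  -- degree less than `a + b`.
  conv-below : ∀ {a b} f g → Below (suc a) f → Below b g → Below (a ℕ.+ b) (conv f g)
  conv-below {zero} f g fb gb i b≤i =
      trans (conv-constˡ f g (λ i → fb (suc i) (s≤s z≤n)) i) (trans (cong (f 0 *_) (gb i b≤i)) (zeroʳ _))
  conv-below {suc a} {b} f g fb gb (suc i) (s≤s a+b≤i) =
    trans (cong₂ _+_ (trans (cong (f 0 *_) (gb (suc i) (ℕₚ.≤-trans (ℕₚ.m≤n+m b a) (ℕₚ.m≤n⇒m≤1+n a+b≤i)))) (zeroʳ _))
                     (conv-below (tail f) g (λ i → fb (suc i) ∘ s≤s) gb i a+b≤i)) (+-identityʳ 0#)

  conv-top : ∀ a b f g → Below (suc a) f → Below (suc b) g → conv f g (a ℕ.+ b) ≡ f a * g b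
  conv-top zero b f g fb gb = conv-constˡ f g (λ i → fb (suc i) (s≤s z≤n)) b
  conv-top (suc a) b f g fb gb =
    trans (cong₂ _+_ (trans (cong (f 0 *_) (gb (suc (a ℕ.+ b)) (s≤s (ℕₚ.m≤n+m b a)))) (zeroʳ _))
                     (conv-top a b (tail f) g (λ i → fb (suc i) ∘ s≤s) gb)) (+-identityˡ _)

  -- The derivation X d/dX, which unlike d/dX shifts no indices.
  euler : Series → Series
  euler f i = ι i * f i

  euler-conv : ∀ f g n → euler (conv f g) n ≡ conv (euler f) g n + conv f (euler g) n
  euler-conv f g zero = trans (zeroˡ _)
      (sym (trans (cong₂ _+_ (trans (cong (_* g 0) (zeroˡ _)) (zeroˡ _))
      (trans (cong (f 0 *_) (zeroˡ _)) (zeroʳ _))) (+-identityˡ 0#)))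
  euler-conv f g (suc n) = begin
    ι (suc n) * (f 0 * g (suc n) + T)
      ≡⟨ cong (λ z → z * (f 0 * g (suc n) + T)) (ι-suc n) ⟩
    (1# + ι n) * (f 0 * g (suc n) + T)
      ≡⟨ solveF 5 (λ o i a b t → (o :+F i) :*F (a :*F b :+F t) :=F (o :*F t :+F i :*F t) :+F a :*F
          ((o :+F i) :*F b)) refl
           1# (ι n) (f 0) (g (suc n)) T ⟩
    (1# * T + ι n * T) + f 0 * ((1# + ι n) * g (suc n))
      ≡⟨ cong (λ z → (z + ι n * T) + f 0 * ((1# + ι n) * g (suc n))) (*-identityˡ T) ⟩
    (T + ι n * T) + f 0 * ((1# + ι n) * g (suc n))
      ≡⟨ cong₂ (λ z w → (T + z) + f 0 * (w * g (suc n))) (euler-conv (tail f) g n) (sym (ι-suc n)) ⟩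
    (T + (A + B)) + f 0 * (ι (suc n) * g (suc n))
      ≡⟨ solveF 4 (λ t a b x → (t :+F (a :+F b)) :+F x :=F (t :+F a) :+F (x :+F b)) refl T A B
          (f 0 * (ι (suc n) * g (suc n))) ⟩
    (T + A) + (f 0 * euler g (suc n) + B)
      ≡⟨ cong (_+ (f 0 * euler g (suc n) + B))
          (sym (trans (cong₂ _+_ (trans (cong (_* g (suc n)) (zeroˡ _)) (zeroˡ _)) lemma) (+-identityˡ _))) ⟩
    (ι 0 * f 0 * g (suc n) + conv (tail (euler f)) g n) + (f 0 * euler g (suc n) + B) ∎
    where
    open ≡-Reasoning
    T = conv (tail f) g n
    A = conv (euler (tail f)) g n
    B = conv (tail f) (euler g) n
    lemma : conv (tail (euler f)) g n ≡ T + A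
    lemma = trans (conv-cong (λ i →
        trans (cong (_* f (suc i)) (ι-suc i))
        (trans (distribʳ _ _ _) (cong (_+ ι i * f (suc i)) (*-identityˡ _)))) (λ _ → refl) n)
                  (conv-distribʳ (tail f) (euler (tail f)) g n)

  -- The bound only certifies finiteness and may exceed the degree, so `_≈_` ignores it; statements
  -- about degrees are made with `Below`.
  record Poly : Set where
    no-eta-equality
    constructor poly
    field
      coeff  : Series
      bound  : ℕ
      vanish : Below bound coeff
  open Poly public

  infix 4 _≈_
  record _≈_ (f g : Poly) : Set where
    constructor pointwise
    field at : ∀ i → coeff f i ≡ coeff g i
  open _≈_ public

  Below-≤ : ∀ {f m n} → m ≤ n → Below m f → Below n f
  Below-≤ m≤n fb i n≤i = fb i (ℕₚ.≤-trans m≤n n≤i)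

  Below-≗ : ∀ {f g n} → f ≗ g → Below n f → Below n g
  Below-≗ f≗g fb i n≤i = trans (sym (f≗g i)) (fb i n≤i)

  ≈-isEquivalence : IsEquivalence _≈_
  ≈-isEquivalence = record
    { refl  = pointwise λ _ → refl
    ; sym   = λ e → pointwise λ i → sym (at e i)
    ; trans = λ d e → pointwise λ i → trans (at d i) (at e i) }

  -0≡0 : - 0# ≡ 0#
  -0≡0 = trans (sym (+-identityˡ _)) (-‿inverseʳ 0#)

  infixl 6 _⊕_
  infixl 7 _⊗_
  infix 8 ⊖_

  abstract
    _⊕_ _⊗_ : Poly → Poly → Poly
    f ⊕ g = poly (λ i → coeff f i + coeff g i) (bound f ℕ.+ bound g)
      (λ i ≤i → trans (cong₂ _+_ (vanish f i (ℕₚ.≤-trans (ℕₚ.m≤m+n _ _) ≤i))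
          (vanish g i (ℕₚ.≤-trans (ℕₚ.m≤n+m _ (bound f)) ≤i))) (+-identityˡ 0#))
    f ⊗ g = poly (conv (coeff f) (coeff g)) (bound f ℕ.+ bound g)
      (conv-below (coeff f) (coeff g) (Below-≤ (ℕₚ.n≤1+n _) (vanish f)) (vanish g))

    ⊖_ : Poly → Poly
    ⊖ f = poly (λ i → - coeff f i) (bound f) (λ i ≤i → trans (cong -_ (vanish f i ≤i)) -0≡0)

    C : F → Poly
    C c = poly (λ { zero → c ; (suc _) → 0# }) 1 (λ { (suc i) _ → refl })

    𝟘 X : Poly
    𝟘 = poly (λ _ → 0#) 0 (λ _ _ → refl)
    X = poly (λ { 1 → 1# ; _ → 0# }) 2 (λ { 1 (s≤s ()) ; (suc (suc i)) _ → refl })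

    θ : Poly → Poly
    θ f = poly (euler (coeff f)) (bound f) (λ i ≤i → trans (cong (ι i *_) (vanish f i ≤i)) (zeroʳ _))

    coeff-⊕ : ∀ f g i → coeff (f ⊕ g) i ≡ coeff f i + coeff g i
    coeff-⊕ f g i = refl

    coeff-⊗ : ∀ f g i → coeff (f ⊗ g) i ≡ conv (coeff f) (coeff g) i
    coeff-⊗ f g i = refl

    coeff-⊖ : ∀ f i → coeff (⊖ f) i ≡ - coeff f i
    coeff-⊖ f i = refl

    coeff-C-zero : ∀ c → coeff (C c) 0 ≡ c
    coeff-C-zero c = refl

    coeff-C-suc : ∀ c i → coeff (C c) (suc i) ≡ 0#
    coeff-C-suc c i = refl

    coeff-𝟘 : ∀ i → coeff 𝟘 i ≡ 0#
    coeff-𝟘 i = refl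

    coeff-X-high : ∀ i → coeff X (suc (suc i)) ≡ 0#
    coeff-X-high i = refl

    coeff-θ : ∀ f i → coeff (θ f) i ≡ ι i * coeff f i
    coeff-θ f i = refl

    C-⊗ : ∀ c f i → coeff (C c ⊗ f) i ≡ c * coeff f i
    C-⊗ c f = conv-constˡ _ _ (λ _ → refl)

    X-⊗-suc : ∀ f i → coeff (X ⊗ f) (suc i) ≡ coeff f i
    X-⊗-suc f i = trans (cong₂ _+_ (zeroˡ _)
        (trans (conv-constˡ (tail (coeff X)) (coeff f) (λ _ → refl) i) (*-identityˡ _))) (+-identityˡ _)

    X-⊗-zero : ∀ f → coeff (X ⊗ f) 0 ≡ 0#
    X-⊗-zero f = zeroˡ _

    θ-⊗ : ∀ f g → θ (f ⊗ g) ≈ θ f ⊗ g ⊕ f ⊗ θ g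
    θ-⊗ f g = pointwise (euler-conv (coeff f) (coeff g))

    θ-⊕ : ∀ f g → θ (f ⊕ g) ≈ θ f ⊕ θ g
    θ-⊕ f g = pointwise λ i → distribˡ _ _ _

    θ-lin : ∀ c → θ (X ⊕ ⊖ C c) ≈ X
    θ-lin c = pointwise λ where
      zero          → zeroˡ _
      (suc zero)    → trans (*-identityˡ _) (trans (cong (1# +_) -0≡0) (+-identityʳ _))
      (suc (suc i)) → trans (cong (ι (suc (suc i)) *_) (trans (cong (0# +_) -0≡0) (+-identityʳ _))) (zeroʳ _)

    C-⊕ : ∀ a b → C (a + b) ≈ C a ⊕ C b
    C-⊕ a b = pointwise λ { zero → refl ; (suc i) → sym (+-identityˡ 0#) }

    C-⊖ : ∀ a → C (- a) ≈ ⊖ C a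
    C-⊖ a = pointwise λ { zero → refl ; (suc i) → sym -0≡0 }

    C-⊗-C : ∀ a b → C (a * b) ≈ C a ⊗ C b
    C-⊗-C a b = pointwise λ { zero → refl ; (suc i) → sym (trans (C-⊗ a (C b) (suc i)) (zeroʳ _)) }

    ⊕-isAbelianGroup : IsAbelianGroup _≈_ _⊕_ 𝟘 ⊖_
    ⊕-isAbelianGroup = record
      { isGroup = record
        { isMonoid = record
          { isSemigroup = record
            { isMagma = record
              { isEquivalence = ≈-isEquivalence
              ; ∙-cong = λ d e → pointwise λ i → cong₂ _+_ (at d i) (at e i) }
            ; assoc = λ f g h → pointwise λ i → +-assoc _ _ _ }
          ; identity = (λ f → pointwise λ i → +-identityˡ _) , (λ f → pointwise λ i → +-identityʳ _) }
        ; inverse = (λ f → pointwise λ i → -‿inverseˡ _) , (λ f → pointwise λ i → -‿inverseʳ _)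
        ; ⁻¹-cong = λ e → pointwise λ i → cong -_ (at e i) }
      ; comm = λ f g → pointwise λ i → +-comm _ _ }

    ⊗-cong : ∀ {f f′ g g′} → f ≈ f′ → g ≈ g′ → f ⊗ g ≈ f′ ⊗ g′
    ⊗-cong d e = pointwise (conv-cong (at d) (at e))

    ⊗-assoc : ∀ f g h → (f ⊗ g) ⊗ h ≈ f ⊗ (g ⊗ h)
    ⊗-assoc f g h = pointwise (conv-assoc (coeff f) (coeff g) (coeff h))

    ⊗-comm : ∀ f g → f ⊗ g ≈ g ⊗ f
    ⊗-comm f g = pointwise (conv-comm (coeff f) (coeff g))

    ⊗-distribʳ : ∀ f g h → (g ⊕ h) ⊗ f ≈ g ⊗ f ⊕ h ⊗ f
    ⊗-distribʳ f g h = pointwise (conv-distribʳ (coeff g) (coeff h) (coeff f))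

    ⊗-distribˡ : ∀ f g h → f ⊗ (g ⊕ h) ≈ f ⊗ g ⊕ f ⊗ h
    ⊗-distribˡ f g h = pointwise λ i →
        trans (conv-comm (coeff f) (coeff (g ⊕ h)) i) (trans (conv-distribʳ (coeff g) (coeff h) (coeff f) i)
      (cong₂ _+_ (conv-comm (coeff g) (coeff f) i) (conv-comm (coeff h) (coeff f) i)))

  𝟙 : Poly
  𝟙 = C 1#

  ⊗-identityˡ : ∀ f → 𝟙 ⊗ f ≈ f
  ⊗-identityˡ f = pointwise λ i → trans (C-⊗ 1# f i) (*-identityˡ _)

  Poly-commutativeRing : CommutativeRing 0ℓ 0ℓ
  Poly-commutativeRing = record
    { Carrier = Poly ; _≈_ = _≈_ ; _+_ = _⊕_ ; _*_ = _⊗_ ; -_ = ⊖_ ; 0# = 𝟘 ; 1# = 𝟙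
    ; isCommutativeRing = record
      { isRing = record
        { +-isAbelianGroup = ⊕-isAbelianGroup
        ; *-cong = ⊗-cong
        ; *-assoc = ⊗-assoc
        ; *-identity = ⊗-identityˡ , λ f → IsEquivalence.trans ≈-isEquivalence (⊗-comm f 𝟙) (⊗-identityˡ f)
        ; distrib = ⊗-distribˡ , ⊗-distribʳ }
      ; *-comm = ⊗-comm } }

  module ≈ = CommutativeRing Poly-commutativeRing
  module Poly-Solver = IntegerCoefficientSolver Poly-commutativeRing
  open Poly-Solver
  import Relation.Binary.Reasoning.Setoid as SetoidReasoning
  module ≈-Reasoning = SetoidReasoning ≈.setoid

  θ-cong : ∀ {f g} → f ≈ g → θ f ≈ θ g
  θ-cong {f} {g} e = pointwise λ i → trans (coeff-θ f i) (trans (cong (ι i *_) (at e i)) (sym (coeff-θ g i)))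

  lin : F → Poly
  lin c = X ⊕ ⊖ C c

  coeff-⊕-⊖ : ∀ f g i → coeff (f ⊕ ⊖ g) i ≡ coeff f i + - coeff g i
  coeff-⊕-⊖ f g i = trans (coeff-⊕ f (⊖ g) i) (cong (coeff f i +_) (coeff-⊖ g i))

  C-cong : ∀ {a b} → a ≡ b → C a ≈ C b
  C-cong refl = ≈.refl

  lin-⊗ : ∀ c f → lin c ⊗ f ≈ X ⊗ f ⊕ ⊖ (C c ⊗ f)
  lin-⊗ c f = solve 3 (λ x c f → (x :+ :- c) :* f := x :* f :+ :- (c :* f)) ≈.refl X (C c) f

  lin-⊗-suc : ∀ c f i → coeff (lin c ⊗ f) (suc i) ≡ coeff f i + - (c * coeff f (suc i))
  lin-⊗-suc c f i = trans (at (lin-⊗ c f) (suc i))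
      (trans (coeff-⊕-⊖ _ _ _) (cong₂ (λ x y → x + - y) (X-⊗-suc f i) (C-⊗ c f (suc i))))

  lin-⊗-zero : ∀ c f → coeff (lin c ⊗ f) 0 ≡ - (c * coeff f 0)
  lin-⊗-zero c f = trans (at (lin-⊗ c f) 0)
      (trans (trans (coeff-⊕-⊖ _ _ _) (cong₂ (λ x y → x + - y) (X-⊗-zero f) (C-⊗ c f 0))) (+-identityˡ _))

  -- Descending induction: coefficients past `bound f` are zero, and wherever the product has a zero
  -- coefficient at `suc i`, the coefficient of `f` at `i` is `c` times the next one. The counter
  -- `j` in `go` measures the distance to the bound.
  lin-below⁻ : ∀ c f {N} → Below (suc N) (coeff (lin c ⊗ f)) → Below N (coeff f)
  lin-below⁻ c f {N} b i N≤i = go (bound f) i (ℕₚ.m≤n+m (bound f) i) N≤i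
    where
    open ≡-Reasoning
    go : ∀ j i → bound f ≤ i ℕ.+ j → N ≤ i → coeff f i ≡ 0#
    go zero i ≤i+j N≤i = vanish f i (subst (bound f ≤_) (ℕₚ.+-identityʳ i) ≤i+j)
    go (suc j) i ≤i+j N≤i = begin
      coeff f i
        ≡⟨ x+-y≡0⇒x≡y _ _ (trans (sym (lin-⊗-suc c f i)) (b (suc i) (s≤s N≤i))) ⟩
      c * coeff f (suc i)
        ≡⟨ cong (c *_) (go j (suc i) (subst (bound f ≤_) (ℕₚ.+-suc i j) ≤i+j) (ℕₚ.m≤n⇒m≤1+n N≤i)) ⟩
      c * 0#                                      ≡⟨ zeroʳ c ⟩
      0#                                          ∎

  below-zero⇒≈𝟘 : ∀ {f} → Below 0 (coeff f) → f ≈ 𝟘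
  below-zero⇒≈𝟘 b = pointwise λ i → trans (b i z≤n) (sym (coeff-𝟘 i))

  ≈𝟘⇒below : ∀ {f n} → f ≈ 𝟘 → Below n (coeff f)
  ≈𝟘⇒below e i _ = trans (at e i) (coeff-𝟘 i)

  ⊕-⊖≈𝟘⇒≈ : ∀ {f g} → f ⊕ ⊖ g ≈ 𝟘 → f ≈ g
  ⊕-⊖≈𝟘⇒≈ {f} {g} e = pointwise λ i → x+-y≡0⇒x≡y _ _ (trans (sym (coeff-⊕-⊖ f g i)) (trans (at e i) (coeff-𝟘 i)))

  ≈⇒⊕-⊖≈𝟘 : ∀ {f g} → f ≈ g → f ⊕ ⊖ g ≈ 𝟘
  ≈⇒⊕-⊖≈𝟘 {f} {g} e = ≈.trans (≈.+-congʳ e) (≈.-‿inverseʳ g)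

  below-𝟙 : Below 1 (coeff 𝟙)
  below-𝟙 (suc i) _ = coeff-C-suc 1# i

  lin-cancel : ∀ c {f g} → lin c ⊗ f ≈ lin c ⊗ g → f ≈ g
  lin-cancel c {f} {g} e = ⊕-⊖≈𝟘⇒≈ (below-zero⇒≈𝟘 (lin-below⁻ c (f ⊕ ⊖ g) (≈𝟘⇒below (≈.trans
    (solve 3 (λ l f g → l :* (f :+ :- g) := l :* f :+ :- (l :* g)) ≈.refl (lin c) f g) (≈⇒⊕-⊖≈𝟘 e)))))

  Π : List F → Poly
  Π = foldr (λ c f → lin c ⊗ f) 𝟙

  -- Each monic linear factor that is stripped off lowers the degree bound by one. This is the
  -- principle "too many roots", with multiplicities, and needs no evaluation of polynomials.
  Π-below⁻ : ∀ cs f → Below (length cs) (coeff (Π cs ⊗ f)) → f ≈ 𝟘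
  Π-below⁻ [] f b = below-zero⇒≈𝟘 (Below-≗ (at (≈.*-identityˡ f)) b)
  Π-below⁻ (c ∷ cs) f b = Π-below⁻ cs f (lin-below⁻ c (Π cs ⊗ f) (Below-≗ (at (≈.*-assoc (lin c) (Π cs) f)) b))

  Π-below : ∀ cs → Below (suc (length cs)) (coeff (Π cs))
  Π-below [] = below-𝟙
  Π-below (c ∷ cs) (suc i) (s≤s <i) = trans (lin-⊗-suc c (Π cs) i)
    (trans (cong₂ (λ x y → x + - (c * y)) (Π-below cs i <i) (Π-below cs (suc i) (ℕₚ.m≤n⇒m≤1+n <i)))
    (trans (+-identityˡ _) (trans (cong -_ (zeroʳ c)) -0≡0)))

  Π-monic : ∀ cs → coeff (Π cs) (length cs) ≡ 1#
  Π-monic [] = coeff-C-zero 1#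
  Π-monic (c ∷ cs) = trans (lin-⊗-suc c (Π cs) (length cs))
    (trans (cong₂ (λ x y → x + - (c * y)) (Π-monic cs) (Π-below cs _ ℕₚ.≤-refl))
    (trans (cong (λ z → 1# + - z) (zeroʳ c)) (trans (cong (1# +_) -0≡0) (+-identityʳ _))))

  Π-++ : ∀ cs ds → Π (cs ++ ds) ≈ Π cs ⊗ Π ds
  Π-++ [] ds = ≈.sym (≈.*-identityˡ _)
  Π-++ (c ∷ cs) ds = ≈.trans (≈.*-congˡ (Π-++ cs ds)) (≈.sym (≈.*-assoc _ _ _))

  Π-↭ : ∀ {cs ds} → cs ↭ ds → Π cs ≈ Π ds
  Π-↭ Perm.refl = ≈.refl
  Π-↭ (Perm.prep c e) = ≈.*-congˡ (Π-↭ e)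
  Π-↭ (Perm.swap {xs} c d e) = ≈.trans
      (solve 3 (λ a b f → a :* (b :* f) := b :* (a :* f)) ≈.refl (lin c) (lin d) (Π xs))
      (≈.*-congˡ (≈.*-congˡ (Π-↭ e)))
  Π-↭ (Perm.trans d e) = ≈.trans (Π-↭ d) (Π-↭ e)

  infix 4 _∣_
  _∣_ : Poly → Poly → Set
  d ∣ f = ∃ λ q → d ⊗ q ≈ f

  ∣-resp-≈ : ∀ {d f g} → f ≈ g → d ∣ f → d ∣ g
  ∣-resp-≈ e (q , dq) = q , ≈.trans dq e

  ∣-⊕ : ∀ {d f g} → d ∣ f → d ∣ g → d ∣ f ⊕ g
  ∣-⊕ (q , dq) (r , dr) = q ⊕ r , ≈.trans (≈.distribˡ _ q r) (≈.+-cong dq dr)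

  ∣-⊖ : ∀ {d f} → d ∣ f → d ∣ ⊖ f
  ∣-⊖ {d} (q , dq) = ⊖ q , ≈.trans (solve 2 (λ d q → d :* :- q := :- (d :* q)) ≈.refl d q) (≈.-‿cong dq)

  ∣-⊗ : ∀ {d f} g → d ∣ f → d ∣ g ⊗ f
  ∣-⊗ {d} g (q , dq) = g ⊗ q , ≈.trans (solve 3 (λ d g q → d :* (g :* q) := g :* (d :* q)) ≈.refl d g q)
      (≈.*-congˡ dq)

  ⊗-∣-⊗ : ∀ {d e f g} → d ∣ f → e ∣ g → d ⊗ e ∣ f ⊗ g
  ⊗-∣-⊗ {d} {e} (q , dq) (r , er) = q ⊗ r ,
      ≈.trans (solve 4 (λ d e q r → (d :* e) :* (q :* r) := (d :* q) :* (e :* r)) ≈.refl d e q r) (≈.*-cong dq er)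

  ∣-self : ∀ {d} f → d ∣ d ⊗ f
  ∣-self f = f , ≈.refl

  Π∣-below⇒≈𝟘 : ∀ cs {f} → Π cs ∣ f → Below (length cs) (coeff f) → f ≈ 𝟘
  Π∣-below⇒≈𝟘 cs (q , e) b =
    ≈.trans (≈.sym e) (≈.trans (≈.*-congˡ (Π-below⁻ cs q (Below-≗ (λ i → sym (at e i)) b))) (≈.zeroʳ _))

  -- The factor in parentheses has the value `u` at `t`, hence is a unit modulo `lin t`: multiplying
  -- by `u ⁻¹` and subtracting a multiple of `lin t` recovers `f`. Values of polynomials occur only
  -- as such remainders.
  lin-coprime : ∀ {t u} m f → u ≢ 0# → lin t ∣ (lin t ⊗ m ⊕ C u) ⊗ f → lin t ∣ f
  lin-coprime {t} {u} m f u≢0 d = ∣-resp-≈ eq (∣-⊗ (C (u ⁻¹)) (∣-⊕ d (∣-⊖ (∣-self (m ⊗ f)))))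
    where
    open ≈-Reasoning
    eq : C (u ⁻¹) ⊗ ((lin t ⊗ m ⊕ C u) ⊗ f ⊕ ⊖ (lin t ⊗ (m ⊗ f))) ≈ f
    eq = begin
      C (u ⁻¹) ⊗ ((lin t ⊗ m ⊕ C u) ⊗ f ⊕ ⊖ (lin t ⊗ (m ⊗ f)))
        ≈⟨ solve 5 (λ v l m u f → v :* ((l :* m :+ u) :* f :+ :- (l :* (m :* f))) := (u :* v) :* f) ≈.refl
            (C (u ⁻¹)) (lin t) m (C u) f ⟩
      (C u ⊗ C (u ⁻¹)) ⊗ f
        ≈⟨ ≈.*-congʳ (≈.trans (≈.sym (C-⊗-C u (u ⁻¹))) (C-cong (*-inverseʳ u≢0))) ⟩
      𝟙 ⊗ f
        ≈⟨ ≈.*-identityˡ f ⟩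
      f ∎

  lin-remainder : ∀ s t → lin s ≈ lin t ⊗ 𝟙 ⊕ C (t + - s)
  lin-remainder s t = ≈.sym (≈.trans (≈.+-cong (≈.*-identityʳ _) (≈.trans (C-⊕ t (- s)) (≈.+-congˡ (C-⊖ s))))
    (solve 3 (λ x s t → (x :+ :- t) :+ (t :+ :- s) := x :+ :- s) ≈.refl X (C s) (C t)))

  lin∣lin⊗⇒∣ : ∀ {s t f} → t ≢ s → lin t ∣ lin s ⊗ f → lin t ∣ f
  lin∣lin⊗⇒∣ {s} {t} {f} t≢s d = lin-coprime 𝟙 f (t≢s ∘ x+-y≡0⇒x≡y t s) (∣-resp-≈ (≈.*-congʳ (lin-remainder s t)) d)

  -- Linear factors with different roots are coprime, so after division by the first one the others
  -- still divide the quotient.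
  Π-unique-∣ : ∀ cs {f} → Unique cs → (∀ {t} → t ∈ cs → lin t ∣ f) → Π cs ∣ f
  Π-unique-∣ [] {f} _ _ = f , ≈.*-identityˡ f
  Π-unique-∣ (c ∷ cs) {f} uniq@(_ ∷ uniq′) d = proj₁ rest ,
      ≈.trans (≈.*-assoc _ _ _) (≈.trans (≈.*-congˡ (proj₂ rest)) (proj₂ first))
    where
    first : lin c ∣ f
    first = d (here refl)
    rest : Π cs ∣ proj₁ first
    rest = Π-unique-∣ cs uniq′ (λ {t} t∈cs →
      lin∣lin⊗⇒∣ (λ t≡c → Unique[x∷xs]⇒x∉xs uniq (subst (_∈ cs) t≡c t∈cs))
          (∣-resp-≈ (≈.sym (proj₂ first)) (d (there t∈cs))))

  ∈⇒lin∣Π : ∀ {t cs} → t ∈ cs → lin t ∣ Π cs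
  ∈⇒lin∣Π {cs = c ∷ cs} (here refl) = ∣-self (Π cs)
  ∈⇒lin∣Π {cs = c ∷ cs} (there t∈cs) = ∣-⊗ (lin c) (∈⇒lin∣Π t∈cs)

  -- A linear factor passes over every factor with another root and cannot end up dividing 1.
  lin∣Π⇒∈ : ∀ t cs → lin t ∣ Π cs → t ∈ cs
  lin∣Π⇒∈ t [] (q , e) = contradiction 1≡0 1≢0
    where
    q≈𝟘 : q ≈ 𝟘
    q≈𝟘 = below-zero⇒≈𝟘 (lin-below⁻ t q (Below-≗ (λ i → sym (at e i)) below-𝟙))
    1≡0 : 1# ≡ 0#
    1≡0 = trans (sym (coeff-C-zero 1#))
        (trans (sym (at e 0)) (trans (at (≈.trans (≈.*-congˡ q≈𝟘) (≈.zeroʳ (lin t))) 0) (coeff-𝟘 0)))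
  lin∣Π⇒∈ t (c ∷ cs) d with t Finₚ.≟ c
  ... | yes refl = here refl
  ... | no t≢c = there (lin∣Π⇒∈ t cs (lin∣lin⊗⇒∣ t≢c d))

  X^ : ℕ → Poly
  X^ zero    = 𝟙
  X^ (suc n) = X ⊗ X^ n

  X^-⊗-+ : ∀ n f i → coeff (X^ n ⊗ f) (n ℕ.+ i) ≡ coeff f i
  X^-⊗-+ zero f i = at (≈.*-identityˡ f) i
  X^-⊗-+ (suc n) f i = trans (at (≈.*-assoc X (X^ n) f) (suc (n ℕ.+ i)))
      (trans (X-⊗-suc (X^ n ⊗ f) (n ℕ.+ i)) (X^-⊗-+ n f i))

  X^-⊗-< : ∀ n f i → i < n → coeff (X^ n ⊗ f) i ≡ 0#
  X^-⊗-< (suc n) f zero _ = trans (at (≈.*-assoc X (X^ n) f) 0) (X-⊗-zero (X^ n ⊗ f))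
  X^-⊗-< (suc n) f (suc i) (s≤s i<n) =
      trans (at (≈.*-assoc X (X^ n) f) (suc i)) (trans (X-⊗-suc (X^ n ⊗ f) i) (X^-⊗-< n f i i<n))

  -- The remainder theorem for X^n, its value at `t` being `t ^ n`.
  X^-remainder : ∀ n t → ∃ λ m → X^ n ≈ lin t ⊗ m ⊕ C (t ^ n)
  X^-remainder zero t = 𝟘 , ≈.sym (≈.trans (≈.+-congʳ (≈.zeroʳ (lin t))) (≈.+-identityˡ _))
  X^-remainder (suc n) t with X^-remainder n t
  ... | m , e = X ⊗ m ⊕ C (t ^ n) , (begin
    X ⊗ X^ n                                                     ≈⟨ ≈.*-congˡ e ⟩
    X ⊗ (lin t ⊗ m ⊕ C (t ^ n))
      ≈⟨ solve 4 (λ x m c t → x :* ((x :+ :- t) :* m :+ c) := (x :+ :- t) :* (x :* m :+ c) :+ t :* c) ≈.refl X m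
          (C (t ^ n)) (C t) ⟩
    lin t ⊗ (X ⊗ m ⊕ C (t ^ n)) ⊕ C t ⊗ C (t ^ n)                ≈⟨ ≈.+-congˡ (≈.sym (C-⊗-C t (t ^ n))) ⟩
    lin t ⊗ (X ⊗ m ⊕ C (t ^ n)) ⊕ C (t ^ suc n)                  ∎)
    where open ≈-Reasoning

  X^p-X : Poly
  X^p-X = X^ p ⊕ ⊖ X

  lin∣X^p-X : ∀ t → lin t ∣ X^p-X
  lin∣X^p-X t with X^-remainder p t
  ... | m , e = m ⊕ ⊖ 𝟙 , ≈.sym (begin
    X^ p ⊕ ⊖ X                               ≈⟨ ≈.+-congʳ (≈.trans e (≈.+-congˡ (C-cong (fermat t)))) ⟩
    (lin t ⊗ m ⊕ C t) ⊕ ⊖ X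
      ≈⟨ solve 3 (λ x t m → ((x :+ :- t) :* m :+ t) :+ :- x := (x :+ :- t) :* m :+ :- (x :+ :- t)) ≈.refl X (C t) m ⟩
    lin t ⊗ m ⊕ ⊖ lin t                      ≈⟨ ≈.+-congˡ (≈.-‿cong (≈.sym (≈.*-identityʳ (lin t)))) ⟩
    lin t ⊗ m ⊕ ⊖ (lin t ⊗ 𝟙)
      ≈⟨ solve 3 (λ l m o → l :* m :+ :- (l :* o) := l :* (m :+ :- o)) ≈.refl (lin t) m 𝟙 ⟩
    lin t ⊗ (m ⊕ ⊖ 𝟙)                        ∎)
    where open ≈-Reasoning

  -- Both sides are monic of degree `p`, so their difference has smaller degree; yet it is divisible
  -- by all `p` linear factors.
  Π-allFin : Π (allFin p) ≈ X^p-X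
  Π-allFin = ⊕-⊖≈𝟘⇒≈ (Π∣-below⇒≈𝟘 (allFin p)
    (∣-⊕ (𝟙 , ≈.*-identityʳ _) (∣-⊖ (Π-unique-∣ (allFin p) (Uniqueₚ.allFin⁺ p) (λ {t} _ → lin∣X^p-X t)))) below)
    where
    len : length (allFin p) ≡ p
    len = length-tabulate id
    X-high : ∀ {i} → p ≤ i → coeff X i ≡ 0#
    X-high {i} p≤i with ℕₚ.≤-trans 1<p p≤i
    ... | s≤s (s≤s {n = j} _) = coeff-X-high j
    X^p≡Π : ∀ j → coeff (X^ p) (p ℕ.+ j) ≡ coeff (Π (allFin p)) (p ℕ.+ j)
    X^p≡Π j = trans (sym (at (≈.*-identityʳ (X^ p)) (p ℕ.+ j))) (trans (X^-⊗-+ p 𝟙 j) (sym (go j)))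
      where
      go : ∀ j → coeff (Π (allFin p)) (p ℕ.+ j) ≡ coeff 𝟙 j
      go zero = trans (cong (coeff (Π (allFin p))) (trans (ℕₚ.+-identityʳ p) (sym len)))
          (trans (Π-monic (allFin p)) (sym (coeff-C-zero 1#)))
      go (suc j) = trans (Π-below (allFin p) _
          (subst₂ _≤_ (cong suc (sym len)) (sym (ℕₚ.+-suc p j)) (s≤s (ℕₚ.m≤m+n p j)))) (sym (coeff-C-suc 1# j))
    below : Below (length (allFin p)) (coeff (Π (allFin p) ⊕ ⊖ X^p-X))
    below i ≤i = begin
      coeff (Π (allFin p) ⊕ ⊖ X^p-X) i
        ≡⟨ trans (coeff-⊕-⊖ (Π (allFin p)) X^p-X i)
            (cong (λ z → coeff (Π (allFin p)) i + - z) (coeff-⊕-⊖ (X^ p) X i)) ⟩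
      coeff (Π (allFin p)) i + - (coeff (X^ p) i + - coeff X i)
        ≡⟨ cong (λ z → coeff (Π (allFin p)) i + - (coeff (X^ p) i + - z)) (X-high p≤i) ⟩
      coeff (Π (allFin p)) i + - (coeff (X^ p) i + - 0#)
        ≡⟨ cong (λ z → coeff (Π (allFin p)) i + - z) (trans (cong (coeff (X^ p) i +_) -0≡0) (+-identityʳ _)) ⟩
      coeff (Π (allFin p)) i + - coeff (X^ p) i
        ≡⟨ cong (λ z → coeff (Π (allFin p)) i + - z)
            (subst (λ i → coeff (X^ p) i ≡ coeff (Π (allFin p)) i) (ℕₚ.m+[n∸m]≡n p≤i) (X^p≡Π (i ∸ p))) ⟩
      coeff (Π (allFin p)) i + - coeff (Π (allFin p)) i             ≡⟨ -‿inverseʳ _ ⟩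
      0#                                                            ∎
      where
      open ≡-Reasoning
      p≤i : p ≤ i
      p≤i = subst (_≤ i) len ≤i

-- Rédei polynomials and the gap in their coefficients

module RédeiPolynomials (p : ℕ) (p-prime : Prime p) where

  open PrimeField p p-prime
  open Polynomials p p-prime
  open F-Solver
  open Poly-Solver using () renaming (solve to solveP; _:=_ to _:=P_; _:+_ to _:+P_; _:*_ to _:*P_; :-_ to :-P_)

  -- φ is a polynomial function of degree at most j, in the form of iterated difference quotients:
  -- the factor theorem is then immediate.
  PolyFn : ℕ → (F → F) → Set
  PolyFn zero    φ = ∀ d y → φ y ≡ φ d
  PolyFn (suc j) φ = ∀ d → ∃ λ ψ → PolyFn j ψ × (∀ y → φ y ≡ φ d + (y + - d) * ψ y)

  PolyFn-cong : ∀ j {φ ψ} → φ ≗ ψ → PolyFn j φ → PolyFn j ψ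
  PolyFn-cong zero e P d y = trans (sym (e y)) (trans (P d y) (e d))
  PolyFn-cong (suc j) e P d with P d
  ... | χ , Pχ , eq = χ , Pχ , λ y → trans (sym (e y)) (trans (eq y) (cong (_+ (y + - d) * χ y) (e d)))

  PolyFn-const : ∀ j c → PolyFn j (λ _ → c)
  PolyFn-const zero c d y = refl
  PolyFn-const (suc j) c d = (λ _ → 0#) , PolyFn-const j 0# , λ y →
      sym (trans (cong (c +_) (zeroʳ _)) (+-identityʳ c))

  PolyFn-+ : ∀ j {φ ψ} → PolyFn j φ → PolyFn j ψ → PolyFn j (λ y → φ y + ψ y)
  PolyFn-+ zero P Q d y = cong₂ _+_ (P d y) (Q d y)
  PolyFn-+ (suc j) {φ} {ψ} P Q d with P d | Q d
  ... | φ′ , P′ , e | ψ′ , Q′ , e′ = (λ y → φ′ y + ψ′ y) , PolyFn-+ j P′ Q′ , λ y → trans (cong₂ _+_ (e y) (e′ y))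
    (solve 5 (λ a b t u v → (a :+ t :* u) :+ (b :+ t :* v) := (a :+ b) :+ t :* (u :+ v)) refl (φ d) (ψ d)
        (y + - d) (φ′ y) (ψ′ y))

  -- The witnesses are the product rule for difference quotients; the summand `a * φ d` comes from
  -- the slope `a` of the linear factor `- (b + - (y * a))`.
  PolyFn-linear : ∀ j {φ} b a → PolyFn j φ → PolyFn (suc j) (λ y → - ((b + - (y * a)) * φ y))
  PolyFn-linear zero {φ} b a P d = (λ _ → a * φ d) , PolyFn-const 0 (a * φ d) , λ y →
      trans (cong (λ z → - ((b + - (y * a)) * z)) (P d y))
    (solve 5 (λ b y a d f → :- ((b :+ :- (y :* a)) :* f) := :- ((b :+ :- (d :* a)) :* f) :+ (y :+ :- d) :*
        (a :* f)) refl b y a d (φ d))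
  PolyFn-linear (suc j) {φ} b a P d with P d
  ... | ψ , Q , e = (λ y → - ((b + - (y * a)) * ψ y) + a * φ d) ,
      PolyFn-+ (suc j) (PolyFn-linear j b a Q) (PolyFn-const (suc j) (a * φ d)) ,
    λ y → trans (cong (λ z → - ((b + - (y * a)) * z)) (e y))
      (solve 6 (λ b y a d f g → :- ((b :+ :- (y :* a)) :* (f :+ (y :+ :- d) :* g)) := :-
          ((b :+ :- (d :* a)) :* f) :+ (y :+ :- d) :* (:- ((b :+ :- (y :* a)) :* g) :+ a :* f))
        refl b y a d (φ d) (ψ y))

  -- Since `PolyFn` provides a quotient at every `d`, it provides one at the root to be removed; the
  -- field has no zero divisors, so the quotient inherits the other roots.
  PolyFn-vanish : ∀ j {φ} ds → PolyFn j φ → Unique ds → j < length ds → (∀ {d} → d ∈ ds → φ d ≡ 0#) → ∀ y → φ y ≡ 0#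
  PolyFn-vanish zero (d ∷ ds) P _ _ z y = trans (P d y) (z (here refl))
  PolyFn-vanish (suc j) {φ} (d ∷ ds) P uniq@(_ ∷ uniq′) (s≤s j<) z y with P d
  ... | ψ , Q , e = trans (e y)
      (trans (cong₂ (λ u v → u + (y + - d) * v) (z (here refl)) (PolyFn-vanish j ds Q uniq′ j< ψ-zero y))
                      (trans (+-identityˡ _) (zeroʳ _)))
    where
    ψ-zero : ∀ {c} → c ∈ ds → ψ c ≡ 0#
    ψ-zero {c} c∈ds with integral (c + - d) (ψ c)
        (trans (sym (trans (e c) (trans (cong (_+ (c + - d) * ψ c) (z (here refl))) (+-identityˡ _))))
        (z (there c∈ds)))
    ... | inj₁ c-d≡0 = contradiction (subst (_∈ ds) (x+-y≡0⇒x≡y c d c-d≡0) c∈ds) (Unique[x∷xs]⇒x∉xs uniq)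
    ... | inj₂ ψc≡0 = ψc≡0

  module _ {A : Set} (a b : A → F) where

    -- Points with equal intercept lie on one affine line of slope `y`.
    intercept : F → A → F
    intercept y P = b P + - (y * a P)

    rédei : List A → F → Poly
    rédei U y = Π (map (intercept y) U)

    -- Up to sign the coefficient is the elementary symmetric function of degree `j` in the
    -- intercepts, each of which is linear in `y`.
    rédei-coeff : ∀ U i j → i ℕ.+ j ≡ length U → PolyFn j (λ y → coeff (rédei U y) i)
    rédei-coeff [] zero zero refl = λ _ _ → refl
    rédei-coeff (P ∷ U) zero (suc j) eq =
      PolyFn-cong (suc j) (λ y → sym (lin-⊗-zero (intercept y P) (rédei U y)))
        (PolyFn-linear j (b P) (a P) (rédei-coeff U 0 j (ℕₚ.suc-injective eq)))
    rédei-coeff (P ∷ U) (suc i) j eq =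
      PolyFn-cong j (λ y → sym (lin-⊗-suc (intercept y P) (rédei U y) i))
        (PolyFn-+ j (rédei-coeff U i j (ℕₚ.suc-injective eq)) (lower j eq))
      where
      lower : ∀ j → suc i ℕ.+ j ≡ suc (length U) → PolyFn j (λ y → - (intercept y P * coeff (rédei U y) (suc i)))
      lower (suc j) eq = PolyFn-linear j (b P) (a P)
          (rédei-coeff U (suc i) j (trans (sym (ℕₚ.+-suc i j)) (ℕₚ.suc-injective eq)))
      -- Here `i` is already the degree of `rédei U y`, so the coefficient at `suc i` is zero for
      -- every `y`.
      lower zero eq = PolyFn-cong 0 (λ y → sym (trans (cong (λ z → - (intercept y P * z))
          (Π-below (map (intercept y) U) (suc i)
              (s≤s (ℕₚ.≤-reflexive (trans (length-map _ U) (trans (sym (ℕₚ.suc-injective eq)) (ℕₚ.+-identityʳ i)))))))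
          (trans (cong -_ (zeroʳ _)) -0≡0))) (PolyFn-const 0 0#)

    -- For `y` in `ys` the polynomial is (X^p - X) e with e of degree `k`, and nothing lies between
    -- the degree `suc k` of X e and the exponent `p`. As a function of `y` the coefficient has
    -- degree at most `length U ∸ i`, and the last inequality says that `ys` has more members than
    -- that; so the gap spreads to all `y`.
    rédei-lacunary : ∀ U k ys → length U ≡ p ℕ.+ k → Unique ys →
      (∀ {y} → y ∈ ys → ∀ c → c ∈ map (intercept y) U) →
      ∀ i → suc k < i → i < p → length U < length ys ℕ.+ i → ∀ y → coeff (rédei U y) i ≡ 0#
    rédei-lacunary U k ys len uniq cover i 1+k<i i<p n<x+i =
      PolyFn-vanish (length U ∸ i) ys (rédei-coeff U i (length U ∸ i) (ℕₚ.m+[n∸m]≡n i≤n)) uniq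
        (ℕₚ.+-cancelˡ-< i _ _ (subst₂ _<_ (sym (ℕₚ.m+[n∸m]≡n i≤n)) (ℕₚ.+-comm (length ys) i) n<x+i)) (λ {y} →
            vanishing y)
      where
      i≤n : i ≤ length U
      i≤n = subst (i ≤_) (sym len) (ℕₚ.≤-trans (ℕₚ.<⇒≤ i<p) (ℕₚ.m≤m+n p k))
      vanishing : ∀ y → y ∈ ys → coeff (rédei U y) i ≡ 0#
      vanishing y y∈ys = go i 1+k<i i<p
        where
        complement = unique-⊆⇒↭ (Uniqueₚ.allFin⁺ p) (λ {c} _ → cover y∈ys c)
        e : List F
        e = proj₁ complement
        len-e : length e ≡ k
        len-e = ℕₚ.+-cancelˡ-≡ p _ _ (begin
          p ℕ.+ length e                         ≡⟨ cong (ℕ._+ length e) (length-tabulate id) ⟨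
          length (allFin p) ℕ.+ length e         ≡⟨ length-++ (allFin p) ⟨
          length (allFin p ++ e)                 ≡⟨ ↭-length (proj₂ complement) ⟨
          length (map (intercept y) U)           ≡⟨ length-map _ U ⟩
          length U                               ≡⟨ len ⟩
          p ℕ.+ k                                ∎)
          where open ≡-Reasoning
        factored : rédei U y ≈ X^ p ⊗ Π e ⊕ ⊖ (X ⊗ Π e)
        factored = ≈.trans (Π-↭ (proj₂ complement)) (≈.trans (Π-++ (allFin p) e) (≈.trans (≈.*-congʳ Π-allFin)
          (solveP 3 (λ a b c → (a :+P :-P b) :*P c :=P a :*P c :+P :-P (b :*P c)) ≈.refl (X^ p) X (Π e))))
        go : ∀ i → suc k < i → i < p → coeff (rédei U y) i ≡ 0#
        go (suc i) (s≤s k<i) i<p = begin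
          coeff (rédei U y) (suc i)                                   ≡⟨ at factored (suc i) ⟩
          coeff (X^ p ⊗ Π e ⊕ ⊖ (X ⊗ Π e)) (suc i)                    ≡⟨ coeff-⊕-⊖ (X^ p ⊗ Π e) (X ⊗ Π e) (suc i) ⟩
          coeff (X^ p ⊗ Π e) (suc i) + - coeff (X ⊗ Π e) (suc i)
            ≡⟨ cong₂ (λ u v → u + - v) (X^-⊗-< p (Π e) (suc i) i<p)
                (trans (X-⊗-suc (Π e) i) (Π-below e i (subst (_< i) (sym len-e) k<i))) ⟩
          0# + - 0#                                                   ≡⟨ -‿inverseʳ 0# ⟩
          0#                                                          ∎
          where open ≡-Reasoning

-- Lacunary polynomials whose roots are all multiple

module LacunaryPolynomials (p : ℕ) (p-prime : Prime p) where

  open import Data.Nat.Divisibility using (∣-refl)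
  open import Data.List.Membership.DecPropositional using (_∈?_)
  open PrimeField p p-prime
  open Polynomials p p-prime
  open F-Solver using () renaming (solve to solveF; _:=_ to _:=F_; _:+_ to _:+F_; _:*_ to _:*F_; :-_ to :-F_)
  open Poly-Solver
  open import Algebra.Properties.Ring (CommutativeRing.ring F-commutativeRing) using (-‿involutive)

  θ-Π-∷ : ∀ c cs → θ (Π (c ∷ cs)) ≈ X ⊗ Π cs ⊕ lin c ⊗ θ (Π cs)
  θ-Π-∷ c cs = ≈.trans (θ-⊗ (lin c) (Π cs)) (≈.+-congʳ (≈.*-congʳ (θ-lin c)))

  module _ {A : Set} (b : A → F) where

    -- θ lowers the multiplicity of a root by at most one.
    record SimpleSplitting (U : List A) : Set where
      field
        simple rest     : List A
        simple-unique   : Unique (map b simple)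
        simple⊆U        : ∀ {P} → P ∈ simple → P ∈ U
        simple-or-rest  : ∀ {P} → P ∈ U → P ∈ simple ⊎ P ∈ rest
        simple-covers   : ∀ {P} → P ∈ U → b P ∈ map b simple
        length-split    : length simple ℕ.+ length rest ≡ length U
        Π-split         : Π (map b simple) ⊗ Π (map b rest) ≈ Π (map b U)
        rest∣θ          : Π (map b rest) ∣ θ (Π (map b U))

    -- Induction along θ((X - c) F) = X F + (X - c) θ F, where F is the product over `U`. For a new
    -- root `c` the list `rest` is unchanged and divides both summands.
    simpleSplitting : ∀ U → SimpleSplitting U
    simpleSplitting [] = record
      { simple = [] ; rest = [] ; simple-unique = [] ; simple⊆U = λ () ; simple-or-rest = λ () ; simple-covers = λ ()
      ; length-split = refl ; Π-split = ≈.*-identityˡ 𝟙 ; rest∣θ = θ 𝟙 , ≈.*-identityˡ (θ 𝟙) }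
    simpleSplitting (P ∷ U) = extend (_∈?_ Finₚ._≟_ (b P) (map b simple))
      where
      open SimpleSplitting (simpleSplitting U)
      extend : Dec (b P ∈ map b simple) → SimpleSplitting (P ∷ U)
      extend (no bP∉) = record
        { simple = P ∷ simple ; rest = rest
        ; simple-unique = All.tabulate (λ c∈ bP≡c → bP∉ (subst (_∈ map b simple) (sym bP≡c) c∈)) ∷ simple-unique
        ; simple⊆U = λ { (here e) → here e ; (there Q∈) → there (simple⊆U Q∈) }
        ; simple-or-rest = λ { (here e) → inj₁ (here e) ; (there Q∈) → Sum.map₁ there (simple-or-rest Q∈) }
        ; simple-covers = λ { (here refl) → here refl ; (there Q∈) → there (simple-covers Q∈) }
        ; length-split = cong suc length-split
        ; Π-split = ≈.trans (≈.*-assoc _ _ _) (≈.*-congˡ Π-split)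
        ; rest∣θ = ∣-resp-≈ (≈.sym (θ-Π-∷ (b P) (map b U)))
            (∣-⊕ (∣-⊗ X (∣-resp-≈ Π-split (∣-⊗ (Π (map b simple)) (𝟙 , ≈.*-identityʳ _)))) (∣-⊗ (lin (b P)) rest∣θ)) }
      extend (yes bP∈) = record
        { simple = simple ; rest = P ∷ rest
        ; simple-unique = simple-unique
        ; simple⊆U = there ∘ simple⊆U
        ; simple-or-rest = λ { (here e) → inj₂ (here e) ; (there Q∈) → Sum.map₂ there (simple-or-rest Q∈) }
        ; simple-covers = λ { (here refl) → bP∈ ; (there Q∈) → simple-covers Q∈ }
        ; length-split = trans (ℕₚ.+-suc _ _) (cong suc length-split)
        ; Π-split = ≈.trans (solve 3 (λ s l r → s :* (l :* r) := l :* (s :* r)) ≈.refl (Π (map b simple))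
            (lin (b P)) (Π (map b rest))) (≈.*-congˡ Π-split)
        -- The longer `rest` still divides the summand X F: the new factor is found in the simple
        -- part, which already has this root, and the old `rest` is the other part of F.
        ; rest∣θ = ∣-resp-≈ (≈.sym (θ-Π-∷ (b P) (map b U)))
            (∣-⊕ (∣-⊗ X (∣-resp-≈ Π-split (⊗-∣-⊗ (∈⇒lin∣Π bP∈) (𝟙 , ≈.*-identityʳ _))))
                (⊗-∣-⊗ (𝟙 , ≈.*-identityʳ _) rest∣θ)) }

    Π-filter : ∀ {Q : Pred A 0ℓ} (Q? : Decidable Q) U →
        Π (map b (filter Q? U)) ⊗ Π (map b (filter (∁? Q?) U)) ≈ Π (map b U)
    Π-filter Q? [] = ≈.*-identityˡ 𝟙
    Π-filter Q? (P ∷ U) with Q? P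
    ... | yes _ = ≈.trans (≈.*-assoc _ _ _) (≈.*-congˡ (Π-filter Q? U))
    ... | no _  = ≈.trans (solve 3 (λ s l r → s :* (l :* r) := l :* (s :* r)) ≈.refl (Π (map b (filter Q? U)))
        (lin (b P)) (Π (map b (filter (∁? Q?) U)))) (≈.*-congˡ (Π-filter Q? U))

  ⊗-below : ∀ {k m f g} → Below (suc k) (coeff f) → Below m (coeff g) → Below (k ℕ.+ m) (coeff (f ⊗ g))
  ⊗-below {f = f} {g} fb gb = Below-≗ (λ i → sym (coeff-⊗ f g i)) (conv-below (coeff f) (coeff g) fb gb)

  ⊕-below : ∀ {m f g} → Below m (coeff f) → Below m (coeff g) → Below m (coeff (f ⊕ g))
  ⊕-below {f = f} {g} fb gb i ≤i = trans (coeff-⊕ f g i) (trans (cong₂ _+_ (fb i ≤i) (gb i ≤i)) (+-identityˡ 0#))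

  ⊖-below : ∀ {m f} → Below m (coeff f) → Below m (coeff (⊖ f))
  ⊖-below {f = f} fb i ≤i = trans (coeff-⊖ f i) (trans (cong -_ (fb i ≤i)) -0≡0)

  θ-below : ∀ {m f} → Below m (coeff f) → Below m (coeff (θ f))
  θ-below {f = f} fb i ≤i = trans (coeff-θ f i) (trans (cong (ι i *_) (fb i ≤i)) (zeroʳ _))

  ι-p+ : ∀ j → ι (p ℕ.+ j) ≡ ι j
  ι-p+ j = trans (ι-+ p j) (trans (cong (_+ ι j) (p∣⇒ι≡0 p ∣-refl)) (+-identityˡ _))

  -- X^p is a constant for the derivation, its exponent being 0 in the field.
  θ-X^p-⊗ : ∀ f → θ (X^ p ⊗ f) ≈ X^ p ⊗ θ f
  θ-X^p-⊗ f = pointwise λ i → go i (ℕₚ.<-≤-connex i p)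
    where
    open ≡-Reasoning
    go : ∀ i → i < p ⊎ p ≤ i → coeff (θ (X^ p ⊗ f)) i ≡ coeff (X^ p ⊗ θ f) i
    go i (inj₁ i<p) = begin
      coeff (θ (X^ p ⊗ f)) i       ≡⟨ coeff-θ (X^ p ⊗ f) i ⟩
      ι i * coeff (X^ p ⊗ f) i     ≡⟨ cong (ι i *_) (X^-⊗-< p f i i<p) ⟩
      ι i * 0#                     ≡⟨ zeroʳ _ ⟩
      0#                           ≡⟨ X^-⊗-< p (θ f) i i<p ⟨
      coeff (X^ p ⊗ θ f) i         ∎
    go i (inj₂ p≤i) = subst (λ i → coeff (θ (X^ p ⊗ f)) i ≡ coeff (X^ p ⊗ θ f) i) (ℕₚ.m+[n∸m]≡n p≤i) (begin
      coeff (θ (X^ p ⊗ f)) (p ℕ.+ j)             ≡⟨ coeff-θ (X^ p ⊗ f) (p ℕ.+ j) ⟩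
      ι (p ℕ.+ j) * coeff (X^ p ⊗ f) (p ℕ.+ j)   ≡⟨ cong₂ _*_ (ι-p+ j) (X^-⊗-+ p f j) ⟩
      ι j * coeff f j                            ≡⟨ coeff-θ f j ⟨
      coeff (θ f) j                              ≡⟨ X^-⊗-+ p (θ f) j ⟨
      coeff (X^ p ⊗ θ f) (p ℕ.+ j)               ∎)
      where j = i ∸ p

  -- Comparing the coefficients of X^(k+d) gives (d - k) g_d = 0, where d is the degree of g.
  wronskian-vanish : ∀ {k f} N g → k < p → Below (suc k) (coeff f) → coeff f k ≡ 1# →
    N ≤ p → Below N (coeff g) → coeff g k ≡ 0# → f ⊗ θ g ≈ θ f ⊗ g → g ≈ 𝟘
  wronskian-vanish zero g _ _ _ _ gb _ _ = below-zero⇒≈𝟘 gb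
  wronskian-vanish {k} {f} (suc d) g k<p fb fk≡1 d<p gb gk≡0 e =
    wronskian-vanish d g k<p fb fk≡1 (ℕₚ.<⇒≤ d<p) gb′ gk≡0 e
    where
    open ≡-Reasoning
    top : ι d * coeff g d ≡ ι k * coeff g d
    top = begin
      ι d * coeff g d                     ≡⟨ coeff-θ g d ⟨
      coeff (θ g) d                       ≡⟨ *-identityˡ _ ⟨
      1# * coeff (θ g) d                  ≡⟨ cong (_* coeff (θ g) d) fk≡1 ⟨
      coeff f k * coeff (θ g) d           ≡⟨ conv-top k d (coeff f) (coeff (θ g)) fb (θ-below gb) ⟨
      conv (coeff f) (coeff (θ g)) (k ℕ.+ d)    ≡⟨ coeff-⊗ f (θ g) (k ℕ.+ d) ⟨
      coeff (f ⊗ θ g) (k ℕ.+ d)           ≡⟨ at e (k ℕ.+ d) ⟩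
      coeff (θ f ⊗ g) (k ℕ.+ d)           ≡⟨ coeff-⊗ (θ f) g (k ℕ.+ d) ⟩
      conv (coeff (θ f)) (coeff g) (k ℕ.+ d)    ≡⟨ conv-top k d (coeff (θ f)) (coeff g) (θ-below fb) gb ⟩
      coeff (θ f) k * coeff g d
        ≡⟨ cong (_* coeff g d) (trans (coeff-θ f k) (trans (cong (ι k *_) fk≡1) (*-identityʳ _))) ⟩
      ι k * coeff g d                     ∎
    gd≡0 : coeff g d ≡ 0#
    gd≡0 with coeff g d Finₚ.≟ 0#
    ... | yes gd≡0 = gd≡0
    -- As `d` and `k` are below `p`, `ι d ≡ ι k` forces `d ≡ k`, the index at which `g` vanishes by
    -- assumption.
    ... | no gd≢0 = trans (cong (coeff g)
        (ι-injective d<p k<p (*-cancelˡ gd≢0 (trans (*-comm _ _) (trans top (*-comm _ _)))))) gk≡0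
    gb′ : Below d (coeff g)
    gb′ i d≤i with ℕₚ.m≤n⇒m<n∨m≡n d≤i
    ... | inj₁ d<i = gb i d<i
    ... | inj₂ refl = gd≡0

  -- By Fermat's theorem X^p - s has the value t - s at `t`, so each factor `lin t` with `t`
  -- different from `s` must divide `f`. Dividing out one factor at a time respects multiplicities,
  -- as `cs` may repeat its members.
  Π∣-cancel : ∀ s cs f q → All (_≢ s) cs → Π cs ⊗ q ≈ (X^ p ⊕ ⊖ C s) ⊗ f → Π cs ∣ f
  Π∣-cancel s [] f q _ _ = f , ≈.*-identityˡ f
  Π∣-cancel s (t ∷ cs) f q (t≢s ∷ cs≢s) e = proj₁ rest ,
      ≈.trans (≈.*-assoc _ _ _) (≈.trans (≈.*-congˡ (proj₂ rest)) (proj₂ first))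
    where
    m = proj₁ (X^-remainder p t)
    remainder : X^ p ⊕ ⊖ C s ≈ lin t ⊗ m ⊕ C (t + - s)
    remainder = ≈.trans (≈.+-congʳ (≈.trans (proj₂ (X^-remainder p t)) (≈.+-congˡ (C-cong (fermat t)))))
      (≈.trans (≈.+-assoc _ _ _) (≈.+-congˡ (≈.sym (≈.trans (C-⊕ t (- s)) (≈.+-congˡ (C-⊖ s))))))
    first : lin t ∣ f
    first = lin-coprime m f (t≢s ∘ x+-y≡0⇒x≡y t s)
      (Π cs ⊗ q , ≈.trans (≈.sym (≈.*-assoc _ _ _)) (≈.trans e (≈.*-congʳ remainder)))
    rest : Π cs ∣ proj₁ first
    rest = Π∣-cancel s cs (proj₁ first) q cs≢s
        (lin-cancel t (≈.trans (≈.sym (≈.*-assoc _ _ _)) (≈.trans e (≈.trans (≈.*-congˡ (≈.sym (proj₂ first)))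
      (solve 3 (λ a l q → a :* (l :* q) := l :* (a :* q)) ≈.refl (X^ p ⊕ ⊖ C s) (lin t) (proj₁ first))))))

  module _ {A : Set} (b : A → F) (U : List A) where

    R : Poly
    R = Π (map b U)

    module _ (k h : ℕ) (len : length U ≡ p ℕ.+ k) (1+k≤h : suc k ≤ h) (2h<p : h ℕ.+ h < p)
             (gap : ∀ i → h < i → i < p → coeff R i ≡ 0#)
             (double : ∀ {P} → P ∈ U → ∃ λ Q → Q ∈ U × Q ≢ P × b Q ≡ b P) where

      private
        h<p : h < p
        h<p = ℕₚ.≤-<-trans (ℕₚ.m≤m+n h h) 2h<p

        k<p : k < p
        k<p = ℕₚ.<-trans 1+k≤h h<p

        f g : Poly
        f = poly (λ i → coeff R (p ℕ.+ i)) (bound R) (λ i ≤i → vanish R (p ℕ.+ i) (ℕₚ.≤-trans ≤i (ℕₚ.m≤n+m i p)))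

        -- The low coefficients of `R`, cut at `h` and not at `p`: by `gap` nothing is lost, and the
        -- bound `suc h` then holds by construction.
        gc : Series
        gc i with i ℕ.≤? h
        ... | yes _ = coeff R i
        ... | no _  = 0#

        gc-low : ∀ {i} → i ≤ h → gc i ≡ coeff R i
        gc-low {i} i≤h with i ℕ.≤? h
        ... | yes _ = refl
        ... | no i≰h = contradiction i≤h i≰h

        gc-high : Below (suc h) gc
        gc-high i h<i with i ℕ.≤? h
        ... | yes i≤h = contradiction i≤h (ℕₚ.<⇒≱ h<i)
        ... | no _ = refl

        g = poly gc (suc h) gc-high

        R-below : Below (suc (p ℕ.+ k)) (coeff R)
        R-below = subst (λ n → Below (suc n) (coeff R)) (trans (length-map b U) len) (Π-below (map b U))

        f-below : Below (suc k) (coeff f)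
        f-below i k<i = R-below (p ℕ.+ i) (subst (_≤ p ℕ.+ i) (ℕₚ.+-suc p k) (ℕₚ.+-monoʳ-≤ p k<i))

        f-monic : coeff f k ≡ 1#
        f-monic = trans (cong (coeff R) (sym (trans (length-map b U) len))) (Π-monic (map b U))

        R≈ : R ≈ X^ p ⊗ f ⊕ g
        R≈ = pointwise λ i → sym (trans (coeff-⊕ (X^ p ⊗ f) g i) (go i (ℕₚ.<-≤-connex i p) (ℕₚ.≤-<-connex i h)))
          where
          go : ∀ i → i < p ⊎ p ≤ i → i ≤ h ⊎ h < i → coeff (X^ p ⊗ f) i + gc i ≡ coeff R i
          go i (inj₁ i<p) (inj₁ i≤h) = trans (cong₂ _+_ (X^-⊗-< p f i i<p) (gc-low i≤h)) (+-identityˡ _)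
          go i (inj₁ i<p) (inj₂ h<i) = trans (cong₂ _+_ (X^-⊗-< p f i i<p) (gc-high i h<i))
              (trans (+-identityˡ _) (sym (gap i h<i i<p)))
          go i (inj₂ p≤i) _ = trans (cong₂ _+_
              (trans (cong (coeff (X^ p ⊗ f)) (sym p+j≡i)) (X^-⊗-+ p f (i ∸ p))) (gc-high i (ℕₚ.<-≤-trans h<p p≤i)))
            (trans (+-identityʳ _) (cong (coeff R) p+j≡i))
            where p+j≡i = ℕₚ.m+[n∸m]≡n p≤i

        open SimpleSplitting (simpleSplitting b U)

        -- The values on `simple` are distinct, so the partner that `double` supplies for a member
        -- of `simple` has to lie in `rest`.
        length-simple≤rest : length simple ≤ length rest
        length-simple≤rest = subst₂ _≤_ (length-map b simple) (length-map b rest)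
            (unique-⊆⇒length≤ simple-unique simple⊆rest)
          where
          simple⊆rest : ∀ {c} → c ∈ map b simple → c ∈ map b rest
          simple⊆rest c∈ with ∈-map⁻ b c∈
          ... | P , P∈ , refl with double (simple⊆U P∈)
          ... | Q , Q∈ , Q≢P , bQ≡bP with simple-or-rest Q∈
          ... | inj₁ Q∈simple = contradiction (unique-map⇒injective b simple-unique Q∈simple P∈ bQ≡bP) Q≢P
          ... | inj₂ Q∈rest = subst (_∈ map b rest) bQ≡bP (∈-map⁺ b Q∈rest)

        -- v is the remainder of R modulo X^p - X.
        v : Poly
        v = X ⊗ f ⊕ g

        v-below : Below (suc h) (coeff v)
        v-below = ⊕-below X⊗f-below gc-high
          where
          X⊗f-below : Below (suc h) (coeff (X ⊗ f))
          X⊗f-below (suc i) (s≤s h≤i) = trans (X-⊗-suc f i) (f-below i (ℕₚ.≤-trans 1+k≤h h≤i))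

        v≈ : v ≈ R ⊕ ⊖ (X^p-X ⊗ f)
        v≈ = ≈.sym (≈.trans (≈.+-congʳ R≈)
            (solve 4 (λ y x f g → (y :* f :+ g) :+ :- ((y :+ :- x) :* f) := x :* f :+ g) ≈.refl (X^ p) X f g))

        simple∣v : Π (map b simple) ∣ v
        simple∣v = ∣-resp-≈ (≈.sym v≈) (∣-⊕ (_ , Π-split)
          (∣-⊖ (∣-resp-≈ (≈.*-comm f X^p-X)
              (∣-⊗ f (Π-unique-∣ (map b simple) simple-unique (λ {t} _ → lin∣X^p-X t))))))

        -- Otherwise X^p - X divides `R` and all `p` field elements are roots; each being multiple,
        -- the degree would be at least 2p, but it is `p + k`.
        v≉𝟘 : ¬ v ≈ 𝟘
        v≉𝟘 v≈𝟘 = ℕₚ.<⇒≱ (ℕₚ.+-monoʳ-< p k<p)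
            (subst (p ℕ.+ p ≤_) (trans length-split len)
            (ℕₚ.+-mono-≤ p≤simple (ℕₚ.≤-trans p≤simple length-simple≤rest)))
          where
          R≈X^p-X⊗f : R ≈ X^p-X ⊗ f
          R≈X^p-X⊗f = ⊕-⊖≈𝟘⇒≈ (≈.trans (≈.sym v≈) v≈𝟘)
          all∈ : ∀ t → t ∈ map b simple
          all∈ t = covered (∈-map⁻ b (lin∣Π⇒∈ t (map b U)
              (∣-resp-≈ (≈.trans (≈.*-comm f X^p-X) (≈.sym R≈X^p-X⊗f)) (∣-⊗ f (lin∣X^p-X t)))))
            where
            covered : (∃ λ P → P ∈ U × t ≡ b P) → t ∈ map b simple
            covered (P , P∈U , t≡bP) = subst (_∈ map b simple) (sym t≡bP) (simple-covers P∈U)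
          p≤simple : p ≤ length simple
          p≤simple = subst₂ _≤_ (length-tabulate id) (length-map b simple)
              (unique-⊆⇒length≤ (Uniqueₚ.allFin⁺ p) (λ {t} _ → all∈ t))

        length-simple≤h : length simple ≤ h
        length-simple≤h = ℕₚ.≮⇒≥ λ h<simple → v≉𝟘 (Π∣-below⇒≈𝟘 (map b simple) simple∣v
          (Below-≤ (subst (suc h ≤_) (sym (length-map b simple)) h<simple) v-below))

        -- The Wronskian of `f` and `g` for the derivation θ. It equals that of `f` and `R`, because
        -- X^p is a constant for θ; hence it inherits the repeated roots of `R`.
        w : Poly
        w = f ⊗ θ g ⊕ ⊖ (θ f ⊗ g)

        w-below : Below (k ℕ.+ suc h) (coeff w)
        w-below = ⊕-below (⊗-below f-below (θ-below {f = g} gc-high)) (⊖-below (⊗-below (θ-below f-below) gc-high))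

        w≈ : w ≈ f ⊗ θ R ⊕ ⊖ (θ f ⊗ R)
        w≈ = ≈.sym (≈.trans (≈.+-cong (≈.*-congˡ θR≈) (≈.-‿cong (≈.*-congˡ R≈)))
          (solve 5 (λ y f f′ g g′ → f :* (y :* f′ :+ g′) :+ :- (f′ :* (y :* f :+ g)) := f :* g′ :+ :- (f′ :* g))
              ≈.refl (X^ p) f (θ f) g (θ g)))
          where
          θR≈ : θ R ≈ X^ p ⊗ θ f ⊕ θ g
          θR≈ = ≈.trans (θ-cong R≈) (≈.trans (θ-⊕ (X^ p ⊗ f) g) (≈.+-congʳ (θ-X^p-⊗ f)))

        rest∣w : Π (map b rest) ∣ w
        rest∣w = ∣-resp-≈ (≈.sym w≈) (∣-⊕ (∣-⊗ f rest∣θ)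
            (∣-⊖ (∣-⊗ (θ f) (∣-resp-≈ Π-split (∣-⊗ (Π (map b simple)) (𝟙 , ≈.*-identityʳ _))))))

        -- Removing at most `h` distinct roots from `p + k` leaves `p + k - h`, and `h + h < p`
        -- lifts this above `k + h`, which bounds the degree of `w`.
        length-rest : k ℕ.+ suc h ≤ length rest
        length-rest = ℕₚ.+-cancelˡ-≤ (length simple) _ _ (begin
          length simple ℕ.+ (k ℕ.+ suc h)  ≤⟨ ℕₚ.+-monoˡ-≤ _ length-simple≤h ⟩
          h ℕ.+ (k ℕ.+ suc h)              ≡⟨ cong (h ℕ.+_) (ℕₚ.+-comm k (suc h)) ⟩
          h ℕ.+ (suc h ℕ.+ k)              ≡⟨ ℕₚ.+-assoc h (suc h) k ⟨
          h ℕ.+ suc h ℕ.+ k                ≡⟨ cong (ℕ._+ k) (ℕₚ.+-suc h h) ⟩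
          suc (h ℕ.+ h) ℕ.+ k              ≤⟨ ℕₚ.+-monoˡ-≤ k 2h<p ⟩
          p ℕ.+ k                          ≡⟨ trans length-split len ⟨
          length simple ℕ.+ length rest    ∎)
          where open ℕₚ.≤-Reasoning

        w≈𝟘 : w ≈ 𝟘
        w≈𝟘 = Π∣-below⇒≈𝟘 (map b rest) rest∣w
            (Below-≤ (subst (k ℕ.+ suc h ≤_) (sym (length-map b rest)) length-rest) w-below)

        c : F
        c = coeff g k

        -- As `f` is monic of degree `k`, subtracting `c` times `f` clears the coefficient of `g` at
        -- `k`, the only one that the Wronskian equation leaves free.
        g≈ : g ≈ C c ⊗ f
        g≈ = ⊕-⊖≈𝟘⇒≈ (wronskian-vanish (suc h) (g ⊕ ⊖ (C c ⊗ f)) k<p f-below f-monic h<p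
          (⊕-below gc-high (⊖-below (Below-≗ (λ i → sym (C-⊗ c f i)) (λ i h<i →
              trans (cong (c *_) (f-below i (ℕₚ.<-trans 1+k≤h h<i))) (zeroʳ c)))))
          (trans (coeff-⊕-⊖ g (C c ⊗ f) k)
              (trans (cong (λ z → c + - z) (trans (C-⊗ c f k) (trans (cong (c *_) f-monic) (*-identityʳ c))))
              (-‿inverseʳ c)))
          (≈.trans (≈.*-congˡ θ-diff)
            (≈.trans (solve 4 (λ f f′ g′ c → f :* (g′ :+ :- (c :* f′)) := f :* g′ :+ :- (c :* (f :* f′))) ≈.refl
                f (θ f) (θ g) (C c))
            (≈.trans (≈.+-congʳ (⊕-⊖≈𝟘⇒≈ w≈𝟘))
            (solve 4 (λ f f′ g c → f′ :* g :+ :- (c :* (f :* f′)) := f′ :* (g :+ :- (c :* f))) ≈.refl f (θ f) g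
                (C c))))))
          where
          θ-diff : θ (g ⊕ ⊖ (C c ⊗ f)) ≈ θ g ⊕ ⊖ (C c ⊗ θ f)
          θ-diff = pointwise λ i → trans (coeff-θ _ i)
              (trans (cong (ι i *_) (trans (coeff-⊕-⊖ g (C c ⊗ f) i) (cong (λ z → gc i + - z) (C-⊗ c f i))))
            (trans (solveF 4 (λ i g c f → i :*F (g :+F :-F (c :*F f)) :=F i :*F g :+F :-F (c :*F (i :*F f)))
                refl (ι i) (gc i) c (coeff f i))
            (sym (trans (coeff-⊕-⊖ (θ g) (C c ⊗ θ f) i)
                (cong₂ (λ x y → x + - y) (coeff-θ g i) (trans (C-⊗ c (θ f) i) (cong (c *_) (coeff-θ f i))))))))

      -- Now `R` is (X^p + c) f, whose first factor has only the root `- c`. All other entries, with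
      -- multiplicity, are roots of `f`, and more than `k` of them would make the monic `f` zero.
      nearly-constant : ∃ λ s → length (filter (λ P → ∁? (Finₚ._≟ s) (b P)) U) ≤ k
      nearly-constant = - c , ℕₚ.≮⇒≥ λ k<len → 1≢0 (trans (sym f-monic)
          (trans (at (Π∣-below⇒≈𝟘 (map b others) others∣f
              (Below-≤ (subst (suc k ≤_) (sym (length-map b others)) k<len) f-below)) k) (coeff-𝟘 k)))
        where
        s = - c
        others = filter (λ P → ∁? (Finₚ._≟ s) (b P)) U
        others≢s : All (_≢ s) (map b others)
        others≢s = All.tabulate λ t∈ → let (P , P∈ , t≡bP) = ∈-map⁻ b t∈ in
          subst (_≢ s) (sym t≡bP) (proj₂ (∈-filter⁻ (λ P → ∁? (Finₚ._≟ s) (b P)) {xs = U} P∈))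
        others∣f : Π (map b others) ∣ f
        others∣f = Π∣-cancel s (map b others) f _ others≢s (≈.trans (Π-filter b (λ P → ∁? (Finₚ._≟ s) (b P)) U)
          (≈.trans R≈ (≈.trans (≈.+-congˡ g≈) (≈.trans (≈.sym (≈.distribʳ f (X^ p) (C c)))
            (≈.*-congʳ (≈.+-congˡ (≈.trans (C-cong (sym (-‿involutive c))) (C-⊖ s))))))))

-- The projective plane through dot and cross products

module ProjectivePlane (p : ℕ) (p-prime : Prime p) where

  open PrimeField p p-prime
  open F-Solver

  Vector : Set
  Vector = F × F × F

  infix  8 _∙_
  infixl 9 _⨯_
  infixl 6 _⊞_
  infix  9 _⊡_

  abstract
    _∙_ : Vector → Vector → F
    (x , y , z) ∙ (u , v , w) = x * u + y * v + z * w

    _⨯_ _⊞_ : Vector → Vector → Vector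
    (x , y , z) ⨯ (u , v , w) = y * w + - (z * v) , z * u + - (x * w) , x * v + - (y * u)
    (x , y , z) ⊞ (u , v , w) = x + u , y + v , z + w

    _⊡_ : F → Vector → Vector
    c ⊡ (x , y , z) = c * x , c * y , c * z

    ∙-def : ∀ x y z u v w → (x , y , z) ∙ (u , v , w) ≡ x * u + y * v + z * w
    ∙-def x y z u v w = refl

    ⨯-def : ∀ x y z u v w → (x , y , z) ⨯ (u , v , w) ≡ (y * w + - (z * v) , z * u + - (x * w) , x * v + - (y * u))
    ⨯-def x y z u v w = refl

    ∙-comm : ∀ u v → u ∙ v ≡ v ∙ u
    ∙-comm (x , y , z) (u , v , w) =
      solve 6 (λ x y z u v w → x :* u :+ y :* v :+ z :* w := u :* x :+ v :* y :+ w :* z) refl x y z u v w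

    ∙-⊞ : ∀ u v w → u ∙ (v ⊞ w) ≡ u ∙ v + u ∙ w
    ∙-⊞ (x , y , z) (a , b , c) (d , e , f) =
      solve 9 (λ x y z a b c d e f →
          x :* (a :+ d) :+ y :* (b :+ e) :+ z :* (c :+ f) := (x :* a :+ y :* b :+ z :* c) :+
          (x :* d :+ y :* e :+ z :* f))
        refl x y z a b c d e f

    ∙-⊡ : ∀ u c v → u ∙ (c ⊡ v) ≡ c * (u ∙ v)
    ∙-⊡ (x , y , z) c (u , v , w) =
      solve 7 (λ x y z c u v w → x :* (c :* u) :+ y :* (c :* v) :+ z :* (c :* w) := c :*
          (x :* u :+ y :* v :+ z :* w)) refl x y z c u v w

    ∙-⨯-same : ∀ u w → u ∙ (w ⨯ u) ≡ 0#
    ∙-⨯-same (x , y , z) (u , v , w) = trans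
      -- The expressions are built without constants, so `x + - x` stands for 0.
      (solve 6 (λ x y z u v w → x :* (v :* z :+ :- (w :* y)) :+ y :* (w :* x :+ :- (u :* z)) :+ z :*
          (u :* y :+ :- (v :* x)) := x :+ :- x) refl x y z u v w)
      (-‿inverseʳ x)

    ∙-⨯-rotate : ∀ u v w → u ∙ (v ⨯ w) ≡ v ∙ (w ⨯ u)
    ∙-⨯-rotate (x , y , z) (a , b , c) (d , e , f) =
      solve 9 (λ x y z a b c d e f →
        x :* (b :* f :+ :- (c :* e)) :+ y :* (c :* d :+ :- (a :* f)) :+ z :* (a :* e :+ :- (b :* d))
        := a :* (e :* z :+ :- (f :* y)) :+ b :* (f :* x :+ :- (d :* z)) :+ c :* (d :* y :+ :- (e :* x)))
        refl x y z a b c d e f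

    ∙-⨯-swap : ∀ u v w → u ∙ (v ⨯ w) ≡ - (u ∙ (w ⨯ v))
    ∙-⨯-swap (x , y , z) (a , b , c) (d , e , f) =
      solve 9 (λ x y z a b c d e f →
        x :* (b :* f :+ :- (c :* e)) :+ y :* (c :* d :+ :- (a :* f)) :+ z :* (a :* e :+ :- (b :* d))
        := :- (x :* (e :* c :+ :- (f :* b)) :+ y :* (f :* a :+ :- (d :* c)) :+ z :* (d :* b :+ :- (e :* a))))
        refl x y z a b c d e f

    lagrange : ∀ a b c d → (a ⨯ b) ∙ (c ⨯ d) ≡ (a ∙ c) * (b ∙ d) + - ((a ∙ d) * (b ∙ c))
    lagrange (a , b , c) (d , e , f) (g , h , i) (j , k , l) =
      solve 12 (λ a b c d e f g h i j k l →
        (b :* f :+ :- (c :* e)) :* (h :* l :+ :- (i :* k)) :+ (c :* d :+ :- (a :* f)) :* (i :* j :+ :- (g :* l))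
            :+ (a :* e :+ :- (b :* d)) :* (g :* k :+ :- (h :* j))
        := (a :* g :+ b :* h :+ c :* i) :* (d :* j :+ e :* k :+ f :* l) :+ :-
            ((a :* j :+ b :* k :+ c :* l) :* (d :* g :+ e :* h :+ f :* i)))
        refl a b c d e f g h i j k l

  -- The expansion of a triple cross product, tested against an arbitrary `u`: vectors are only ever
  -- compared through their pairings.
  ∙-⨯-⨯ : ∀ u l a b → u ∙ (l ⨯ (a ⨯ b)) ≡ (u ∙ a) * (l ∙ b) + - ((u ∙ b) * (l ∙ a))
  ∙-⨯-⨯ u l a b = trans (trans (∙-⨯-rotate u l (a ⨯ b)) (∙-⨯-rotate l (a ⨯ b) u))
      (trans (∙-comm (a ⨯ b) (u ⨯ l)) (lagrange u l a b))

  ∙-⨯-sameˡ : ∀ u w → u ∙ (u ⨯ w) ≡ 0#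
  ∙-⨯-sameˡ u w = trans (∙-⨯-rotate u u w) (∙-⨯-same u w)

  x+-0 : ∀ x → x + - 0# ≡ x
  x+-0 x = trans (sym (+-identityʳ _))
      (trans (+-assoc x (- 0#) 0#) (trans (cong (x +_) (-‿inverseˡ 0#)) (+-identityʳ x)))

  -- The lines through the common point of `u` and `v`, except `v`. With `v` at infinity they are
  -- the parallels to `u`.
  pencil : Vector → F → Vector → Vector
  pencil u c v = u ⊞ (- c) ⊡ v

  ∙-pencil : ∀ P u c v → P ∙ pencil u c v ≡ P ∙ u + - (c * (P ∙ v))
  ∙-pencil P u c v = trans (∙-⊞ P u _)
      (cong (P ∙ u +_) (trans (∙-⊡ P (- c) v) (solve 2 (λ c x → :- c :* x := :- (c :* x)) refl c (P ∙ v))))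

  ∙-pencil-zero : ∀ P u c v → P ∙ v ≡ 0# → P ∙ pencil u c v ≡ P ∙ u
  ∙-pencil-zero P u c v Pv≡0 = trans (∙-pencil P u c v) (trans (cong (λ z → P ∙ u + - (c * z)) Pv≡0)
    (trans (cong (λ z → P ∙ u + - z) (zeroʳ c)) (x+-0 (P ∙ u))))
  vec : PG2 p → Vector
  vec (P1 a b) = 1# , a , b
  vec (P2 c)   = 0# , 1# , c
  vec P3       = 0# , 0# , 1#

  ι-dot : ∀ x y z u v w → ι (dot (x , y , z) (u , v , w)) ≡ (ι x , ι y , ι z) ∙ (ι u , ι v , ι w)
  ι-dot x y z u v w = trans (ι-+ (x ℕ.* u ℕ.+ y ℕ.* v) (z ℕ.* w))
    (trans (cong₂ _+_ (trans (ι-+ (x ℕ.* u) (y ℕ.* v)) (cong₂ _+_ (ι-* x u) (ι-* y v))) (ι-* z w))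
        (sym (∙-def _ _ _ _ _ _)))

  ι-coords : ∀ P → (ι (proj₁ (coords P)) , ι (proj₁ (proj₂ (coords P))) , ι (proj₂ (proj₂ (coords P)))) ≡ vec P
  ι-coords (P1 a b) = cong₂ (λ x y → 1# , x , y) (ι-toℕ a) (ι-toℕ b)
  ι-coords (P2 c)   = cong (λ x → 0# , 1# , x) (ι-toℕ c)
  ι-coords P3       = refl

  ι-incidence : ∀ P L → ι (dot (coords P) (coords L)) ≡ vec P ∙ vec L
  ι-incidence P L = trans (ι-dot _ _ _ _ _ _) (cong₂ _∙_ (ι-coords P) (ι-coords L))

  incident⇒∙≡0 : ∀ {P L} → Incident P L → vec P ∙ vec L ≡ 0#
  incident⇒∙≡0 {P} {L} i = trans (sym (ι-incidence P L)) (p∣⇒ι≡0 _ i)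

  ∙≡0⇒incident : ∀ {P L} → vec P ∙ vec L ≡ 0# → Incident P L
  ∙≡0⇒incident {P} {L} e = ι≡0⇒p∣ _ (trans (ι-incidence P L) e)

  _≟ᴾ_ : DecidableEquality (PG2 p)
  P1 a b ≟ᴾ P1 c d = map′ (λ { (refl , refl) → refl }) (λ { refl → refl , refl }) (a Finₚ.≟ c ×-dec b Finₚ.≟ d)
  P1 _ _ ≟ᴾ P2 _   = no λ ()
  P1 _ _ ≟ᴾ P3     = no λ ()
  P2 _   ≟ᴾ P1 _ _ = no λ ()
  P2 c   ≟ᴾ P2 d   = map′ (cong P2) (λ { refl → refl }) (c Finₚ.≟ d)
  P2 _   ≟ᴾ P3     = no λ ()
  P3     ≟ᴾ P1 _ _ = no λ ()
  P3     ≟ᴾ P2 _   = no λ ()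
  P3     ≟ᴾ P3     = yes refl

  e₁ e₂ e₃ : Vector
  e₁ = 1# , 0# , 0#
  e₂ = 0# , 1# , 0#
  e₃ = 0# , 0# , 1#

  ∙-e₁ : ∀ x y z → (x , y , z) ∙ e₁ ≡ x
  ∙-e₁ x y z = trans (∙-def x y z _ _ _)
      (trans (cong₂ _+_ (trans (cong₂ _+_ (*-identityʳ x) (zeroʳ y)) (+-identityʳ x)) (zeroʳ z)) (+-identityʳ x))

  ∙-e₂ : ∀ x y z → (x , y , z) ∙ e₂ ≡ y
  ∙-e₂ x y z = trans (∙-def x y z _ _ _)
      (trans (cong₂ _+_ (trans (cong₂ _+_ (zeroʳ x) (*-identityʳ y)) (+-identityˡ y)) (zeroʳ z)) (+-identityʳ y))

  ∙-e₃ : ∀ x y z → (x , y , z) ∙ e₃ ≡ z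
  ∙-e₃ x y z = trans (∙-def x y z _ _ _)
      (trans (cong₂ _+_ (trans (cong₂ _+_ (zeroʳ x) (zeroʳ y)) (+-identityʳ 0#)) (*-identityʳ z)) (+-identityˡ z))

  -- That a vector is nonzero is always expressed by another vector that pairs with it to a nonzero
  -- scalar.
  vec-nonzero : ∀ P → ∃ λ e → vec P ∙ e ≢ 0#
  vec-nonzero (P1 a b) = e₁ , λ e → 1≢0 (trans (sym (∙-e₁ _ _ _)) e)
  vec-nonzero (P2 c)   = e₂ , λ e → 1≢0 (trans (sym (∙-e₂ _ _ _)) e)
  vec-nonzero P3       = e₃ , λ e → 1≢0 (trans (sym (∙-e₃ _ _ _)) e)

  ⁻¹≢0 : ∀ {x} → x ≢ 0# → x ⁻¹ ≢ 0#
  ⁻¹≢0 {x} x≢0 i≡0 = 1≢0 (trans (sym (*-inverseʳ x≢0)) (trans (cong (x *_) i≡0) (zeroʳ x)))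

  scaled : ∀ i x y z u v w → i * x * u + i * y * v + i * z * w ≡ i * (x * u + y * v + z * w)
  scaled = solve 7 (λ i x y z u v w →
      i :* x :* u :+ i :* y :* v :+ i :* z :* w := i :* (x :* u :+ y :* v :+ z :* w)) refl

  -- Leads from vectors built by algebra back to the canonical coordinates of `PG2`; pairings change
  -- only by the nonzero factor `scale`.
  record Normalised (v : Vector) : Set where
    field
      point    : PG2 p
      scale    : F
      scale≢0  : scale ≢ 0#
      point-∙  : ∀ m → vec point ∙ m ≡ scale * (v ∙ m)

    ∙-point : ∀ m → m ∙ vec point ≡ scale * (m ∙ v)
    ∙-point m = trans (∙-comm m (vec point)) (trans (point-∙ m) (cong (scale *_) (∙-comm v m)))

  normalise : ∀ v m → v ∙ m ≢ 0# → Normalised v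
  normalise (x , y , z) m v∙m≢0 with x Finₚ.≟ 0#
  ... | no x≢0 = record
    { point = P1 (i * y) (i * z) ; scale = i ; scale≢0 = ⁻¹≢0 x≢0
    ; point-∙ = λ { (u , v , w) →
        trans (∙-def _ _ _ _ _ _)
        (trans (cong (λ t → t * u + i * y * v + i * z * w) (sym (trans (*-comm i x) (*-inverseʳ x≢0))))
        (trans (scaled i x y z u v w) (cong (i *_) (sym (∙-def _ _ _ _ _ _))))) } }
    where i = x ⁻¹
  ... | yes x≡0 with y Finₚ.≟ 0#
  ... | no y≢0 = record
    { point = P2 (i * z) ; scale = i ; scale≢0 = ⁻¹≢0 y≢0
    ; point-∙ = λ { (u , v , w) →
        trans (∙-def _ _ _ _ _ _)
        (trans (cong₂ (λ s t → s * u + t * v + i * z * w) (sym (trans (cong (i *_) x≡0) (zeroʳ i)))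
        (sym (trans (*-comm i y) (*-inverseʳ y≢0))))
        (trans (scaled i x y z u v w) (cong (i *_) (sym (∙-def _ _ _ _ _ _))))) } }
    where i = y ⁻¹
  ... | yes y≡0 with z Finₚ.≟ 0#
  ... | no z≢0 = record
    { point = P3 ; scale = i ; scale≢0 = ⁻¹≢0 z≢0
    ; point-∙ = λ { (u , v , w) → trans (∙-def _ _ _ _ _ _) (trans
        (cong₂ (λ r t → r + t * w) (cong₂ (λ r s → r * u + s * v) (sym (trans (cong (i *_) x≡0) (zeroʳ i)))
            (sym (trans (cong (i *_) y≡0) (zeroʳ i)))) (sym (trans (*-comm i z) (*-inverseʳ z≢0))))
        (trans (scaled i x y z u v w) (cong (i *_) (sym (∙-def _ _ _ _ _ _))))) } }
    where i = z ⁻¹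
  ... | yes z≡0 = contradiction (zero-∙ m) v∙m≢0
    where
    zero-∙ : ∀ m → (x , y , z) ∙ m ≡ 0#
    zero-∙ (u , v , w) = trans (∙-def _ _ _ _ _ _)
        (trans (cong₂ _+_ (trans (cong₂ _+_ (trans (cong (_* u) x≡0) (zeroˡ u))
        (trans (cong (_* v) y≡0) (zeroˡ v))) (+-identityˡ 0#)) (trans (cong (_* w) z≡0) (zeroˡ w))) (+-identityˡ 0#))

  e₁-⨯ : ∀ x y z u v w → e₁ ∙ ((x , y , z) ⨯ (u , v , w)) ≡ y * w + - (z * v)
  e₁-⨯ x y z u v w = trans (∙-comm e₁ _) (trans (cong (_∙ e₁) (⨯-def x y z u v w)) (∙-e₁ _ _ _))

  e₂-⨯ : ∀ x y z u v w → e₂ ∙ ((x , y , z) ⨯ (u , v , w)) ≡ z * u + - (x * w)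
  e₂-⨯ x y z u v w = trans (∙-comm e₂ _) (trans (cong (_∙ e₂) (⨯-def x y z u v w)) (∙-e₂ _ _ _))

  e₃-⨯ : ∀ x y z u v w → e₃ ∙ ((x , y , z) ⨯ (u , v , w)) ≡ x * v + - (y * u)
  e₃-⨯ x y z u v w = trans (∙-comm e₃ _) (trans (cong (_∙ e₃) (⨯-def x y z u v w)) (∙-e₃ _ _ _))

  ⨯-flip : ∀ P Q → (∃ λ w → w ∙ (vec P ⨯ vec Q) ≢ 0#) → ∃ λ w → w ∙ (vec Q ⨯ vec P) ≢ 0#
  ⨯-flip P Q (w , w≢0) = w , λ e →
      w≢0 (trans (∙-⨯-swap w (vec P) (vec Q)) (trans (cong -_ e) (trans (sym (+-identityˡ _)) (-‿inverseʳ 0#))))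

  -- Canonical coordinates are proportional only when equal. In each case the coordinate vector `w`
  -- selects an entry of the cross product that shows the difference.
  distinct⇒⨯≢0 : ∀ P Q → P ≢ Q → ∃ λ w → w ∙ (vec P ⨯ vec Q) ≢ 0#
  distinct⇒⨯≢0 (P1 a b) (P1 c d) P≢Q with a Finₚ.≟ c | b Finₚ.≟ d
  ... | no a≢c | _ = e₃ , λ e →
      a≢c (sym (x+-y≡0⇒x≡y c a (trans (sym (trans (e₃-⨯ 1# a b 1# c d)
      (cong₂ (λ s t → s + - t) (*-identityˡ c) (*-identityʳ a)))) e)))
  ... | yes refl | no b≢d = e₂ , λ e →
      b≢d (x+-y≡0⇒x≡y b d (trans (sym (trans (e₂-⨯ 1# a b 1# c d)
      (cong₂ (λ s t → s + - t) (*-identityʳ b) (*-identityˡ d)))) e))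
  ... | yes refl | yes refl = contradiction refl P≢Q
  distinct⇒⨯≢0 (P1 a b) (P2 c) _ = e₃ , λ e →
      1≢0 (trans (sym (trans (e₃-⨯ 1# a b 0# 1# c)
      (trans (cong₂ (λ s t → s + - t) (*-identityʳ 1#) (zeroʳ a)) (x+-0 1#)))) e)
  distinct⇒⨯≢0 (P1 a b) P3 _ = e₂ , λ e →
      1≢0 (sym (x+-y≡0⇒x≡y 0# 1#
      (trans (sym (trans (e₂-⨯ 1# a b 0# 0# 1#) (cong₂ (λ s t → s + - t) (zeroʳ b) (*-identityʳ 1#)))) e)))
  distinct⇒⨯≢0 (P2 c) (P1 a b) P≢Q = ⨯-flip (P1 a b) (P2 c) (distinct⇒⨯≢0 (P1 a b) (P2 c) (P≢Q ∘ sym))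
  distinct⇒⨯≢0 (P2 c) (P2 d) P≢Q = e₁ , λ e →
      P≢Q (cong P2 (sym (x+-y≡0⇒x≡y d c
      (trans (sym (trans (e₁-⨯ 0# 1# c 0# 1# d) (cong₂ (λ s t → s + - t) (*-identityˡ d) (*-identityʳ c)))) e))))
  distinct⇒⨯≢0 (P2 c) P3 _ = e₁ , λ e →
      1≢0 (trans (sym (trans (e₁-⨯ 0# 1# c 0# 0# 1#)
      (trans (cong₂ (λ s t → s + - t) (*-identityʳ 1#) (zeroʳ c)) (x+-0 1#)))) e)
  distinct⇒⨯≢0 P3 (P1 a b) P≢Q = ⨯-flip (P1 a b) P3 (distinct⇒⨯≢0 (P1 a b) P3 (P≢Q ∘ sym))
  distinct⇒⨯≢0 P3 (P2 c) P≢Q = ⨯-flip (P2 c) P3 (distinct⇒⨯≢0 (P2 c) P3 (P≢Q ∘ sym))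
  distinct⇒⨯≢0 P3 P3 P≢Q = contradiction refl P≢Q

  -- Binet–Cauchy: (l ∙ z)(n ∙ w) - (l ∙ w)(n ∙ z) = (l ⨯ n) ∙ (z ⨯ w), and l ⨯ n = 0 for n = P ⨯ Q.
  proportional : ∀ {P Q} l z w → P ∙ l ≡ 0# → Q ∙ l ≡ 0# → (l ∙ z) * ((P ⨯ Q) ∙ w) ≡ (l ∙ w) * ((P ⨯ Q) ∙ z)
  proportional {P} {Q} l z w Pl Ql = x+-y≡0⇒x≡y _ _ (begin
    (l ∙ z) * (n ∙ w) + - ((l ∙ w) * (n ∙ z))            ≡⟨ lagrange l n z w ⟨
    (l ⨯ n) ∙ (z ⨯ w)                                    ≡⟨ ∙-comm (l ⨯ n) (z ⨯ w) ⟩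
    (z ⨯ w) ∙ (l ⨯ (P ⨯ Q))                              ≡⟨ ∙-⨯-⨯ (z ⨯ w) l P Q ⟩
    (z ⨯ w) ∙ P * (l ∙ Q) + - ((z ⨯ w) ∙ Q * (l ∙ P))
      ≡⟨ cong₂ (λ s t → (z ⨯ w) ∙ P * s + - ((z ⨯ w) ∙ Q * t)) (trans (∙-comm l Q) Ql) (trans (∙-comm l P) Pl) ⟩
    (z ⨯ w) ∙ P * 0# + - ((z ⨯ w) ∙ Q * 0#)              ≡⟨ cong₂ (λ s t → s + - t) (zeroʳ _) (zeroʳ _) ⟩
    0# + - 0#                                            ≡⟨ -‿inverseʳ 0# ⟩
    0#                                                   ∎)
    where
    open ≡-Reasoning
    n = P ⨯ Q

  -- Both `l` and `m` are proportional to the cross product of the two points. The vector `z` shows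
  -- that `l` is a nonzero multiple, so `R` is orthogonal to the cross product and then to `m`, even
  -- if `m` is zero.
  two-points : ∀ {P Q} l m z R → P ≢ Q → vec P ∙ l ≡ 0# → vec Q ∙ l ≡ 0# → vec P ∙ m ≡ 0# → vec Q ∙ m ≡ 0# →
    z ∙ l ≢ 0# → R ∙ l ≡ 0# → R ∙ m ≡ 0#
  two-points {P} {Q} l m z R P≢Q Pl Ql Pm Qm zl≢0 Rl = trans (∙-comm R m) (zero-factor nw≢0 (trans (*-comm _ _) (begin
    (m ∙ R) * (n ∙ w)    ≡⟨ proportional m R w Pm Qm ⟩
    (m ∙ w) * (n ∙ R)    ≡⟨ cong ((m ∙ w) *_) nR≡0 ⟩
    (m ∙ w) * 0#         ≡⟨ zeroʳ _ ⟩
    0#                   ∎)))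
    where
    open ≡-Reasoning
    n = vec P ⨯ vec Q
    w = proj₁ (distinct⇒⨯≢0 P Q P≢Q)
    nw≢0 : n ∙ w ≢ 0#
    nw≢0 e = proj₂ (distinct⇒⨯≢0 P Q P≢Q) (trans (∙-comm w n) e)
    zero-factor : ∀ {a x} → a ≢ 0# → a * x ≡ 0# → x ≡ 0#
    zero-factor a≢0 e = Sum.[ (λ a≡0 → contradiction a≡0 a≢0) , id ]′ (integral _ _ e)
    lw≢0 : l ∙ w ≢ 0#
    lw≢0 lw≡0 = *-≢0 (λ e → zl≢0 (trans (∙-comm z l) e)) nw≢0
        (trans (proportional l z w Pl Ql) (trans (cong (_* (n ∙ z)) lw≡0) (zeroˡ _)))
    nR≡0 : n ∙ R ≡ 0#
    nR≡0 = zero-factor lw≢0 (trans (sym (proportional l R w Pl Ql))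
        (trans (cong (_* (n ∙ w)) (trans (∙-comm l R) Rl)) (zeroˡ _)))

-- Sets without tangents in affine coordinates

module TangentFreeSets (p : ℕ) (p-prime : Prime p) where

  open import Data.Bool.Properties as Boolₚ using (T?; T-≡)
  open import Data.Nat.Tactic.RingSolver using (solve-∀)
  open PrimeField p p-prime
  open Polynomials p p-prime
  open RédeiPolynomials p p-prime
  open LacunaryPolynomials p p-prime
  open ProjectivePlane p p-prime
  open F-Solver

  allPoints-unique : Unique (allPoints p)
  allPoints-unique = Uniqueₚ.++⁺ (subst Unique (sym (affine (allFin p)))
        (Uniqueₚ.cartesianProductWith⁺ P1 (λ { refl → refl , refl }) (Uniqueₚ.allFin⁺ p) (Uniqueₚ.allFin⁺ p)))
      (Uniqueₚ.++⁺ (Uniqueₚ.map⁺ (λ { refl → refl }) (Uniqueₚ.allFin⁺ p)) ([] ∷ [])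
        (λ { (P∈ , here refl) → case-P2 (∈-map⁻ P2 P∈) }))
      (λ { (P∈ , Q∈) → case-P1 (∈-cartesianProductWith⁻ P1 (allFin p) (allFin p)
          (subst (_ ∈_) (affine (allFin p)) P∈)) (∈-++⁻ (map P2 (allFin p)) Q∈) })
    where
    affine : ∀ as → concatMap (λ a → map (P1 a) (allFin p)) as ≡ cartesianProductWith P1 as (allFin p)
    affine [] = refl
    affine (a ∷ as) = cong (map (P1 a) (allFin p) ++_) (affine as)
    case-P2 : ¬ ∃ λ c → c ∈ allFin p × P3 ≡ P2 c
    case-P2 (_ , _ , ())
    case-P1 : ∀ {P : PG2 p} → (∃ λ a → ∃ λ b → a ∈ allFin p × b ∈ allFin p × P ≡ P1 a b) →
        ¬ (P ∈ map P2 (allFin p) ⊎ P ∈ P3 ∷ [])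
    case-P1 (_ , _ , _ , _ , refl) (inj₁ P∈) with ∈-map⁻ P2 P∈
    ... | _ , _ , ()
    case-P1 (_ , _ , _ , _ , refl) (inj₂ (here ()))

  ∈-allPoints : ∀ P → P ∈ allPoints p
  ∈-allPoints (P1 a b) = ∈-++⁺ˡ
      (∈-concatMap⁺ (λ a → map (P1 a) (allFin p)) (Any.map (λ { refl → ∈-map⁺ (P1 a) (∈-allFin b) }) (∈-allFin a)))
  ∈-allPoints (P2 c)   = ∈-++⁺ʳ (concatMap (λ a → map (P1 a) (allFin p)) (allFin p)) (∈-++⁺ˡ (∈-map⁺ P2 (∈-allFin c)))
  ∈-allPoints P3       = ∈-++⁺ʳ (concatMap (λ a → map (P1 a) (allFin p)) (allFin p))
      (∈-++⁺ʳ (map P2 (allFin p)) (here refl))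

  line-through : ∀ P Q → P ≢ Q → ∃ λ M → (vec P ∙ vec M ≡ 0#) × (vec Q ∙ vec M ≡ 0#)
  line-through P Q P≢Q = point , on (∙-⨯-sameˡ (vec P) (vec Q)) , on (∙-⨯-same (vec Q) (vec P))
    where
    w = distinct⇒⨯≢0 P Q P≢Q
    open Normalised (normalise (vec P ⨯ vec Q) (proj₁ w) (λ e → proj₂ w (trans (∙-comm (proj₁ w) _) e)))
    on : ∀ {v} → v ∙ (vec P ⨯ vec Q) ≡ 0# → v ∙ vec point ≡ 0#
    on {v} e = trans (∙-point v) (trans (cong (scale *_) e) (zeroʳ scale))

  module TangentFreeSet (S : PointSet p) (no-tangents : NoTangents S) where

    points : List (Point p)
    points = filterᵇ S (allPoints p)

    points-unique : Unique points
    points-unique = Uniqueₚ.filter⁺ (T? ∘ S) allPoints-unique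

    ∈points⁺ : ∀ {P} → S P ≡ true → P ∈ points
    ∈points⁺ {P} SP = ∈-filter⁺ (T? ∘ S) (∈-allPoints P) (Equivalence.from T-≡ SP)

    ∈points⁻ : ∀ {P} → P ∈ points → S P ≡ true
    ∈points⁻ P∈ = Equivalence.to T-≡ (proj₂ (∈-filter⁻ (T? ∘ S) {xs = allPoints p} P∈))

    -- Lines arise below as linear forms `m`; `z` certifies that `m` is nonzero, so that it can be
    -- normalised to a `Line` to which the hypothesis on tangents applies.
    another-on-form : ∀ {P} m z → z ∙ m ≢ 0# → S P ≡ true → vec P ∙ m ≡ 0# → ∃ λ Q →
        S Q ≡ true × Q ≢ P × vec Q ∙ m ≡ 0#
    another-on-form {P} m z zm≢0 SP Pm =
        let (Q , Q∈ , Q≢P) = another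
            Q∈′ = ∈-filter⁻ (λ P → incident? P point) {xs = points} Q∈ in
        Q , ∈points⁻ (proj₁ Q∈′) , Q≢P ,
          *-cancelˡ scale≢0 (trans (sym (∙-point (vec Q))) (trans (incident⇒∙≡0 (proj₂ Q∈′)) (sym (zeroʳ scale))))
      where
      open Normalised (normalise m z (λ e → zm≢0 (trans (∙-comm z m) e)))
      another : ∃ λ Q → Q ∈ filter (λ P → incident? P point) points × Q ≢ P
      another = unique-another _≟ᴾ_ (Uniqueₚ.filter⁺ (λ P → incident? P point) points-unique)
        (∈-filter⁺ (λ P → incident? P point) (∈points⁺ SP)
            (∙≡0⇒incident (trans (∙-point (vec P)) (trans (cong (scale *_) Pm) (zeroʳ scale)))))
        (no-tangents point)

    module AffinePart (L : Line p) where

      ℓ : Vector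
      ℓ = vec L

      onL offL : List (Point p)
      onL  = filter (λ P → incident? P L) points
      offL = filter (∁? (λ P → incident? P L)) points

      card-split : length onL ℕ.+ length offL ≡ card S
      card-split = length-filter-∁ (λ P → incident? P L) points

      onL-unique : Unique onL
      onL-unique = Uniqueₚ.filter⁺ _ points-unique

      offL-unique : Unique offL
      offL-unique = Uniqueₚ.filter⁺ _ points-unique

      ∈onL⁺ : ∀ {P} → S P ≡ true → vec P ∙ ℓ ≡ 0# → P ∈ onL
      ∈onL⁺ SP Pℓ = ∈-filter⁺ (λ P → incident? P L) (∈points⁺ SP) (∙≡0⇒incident Pℓ)

      ∈onL⁻ : ∀ {P} → P ∈ onL → S P ≡ true × vec P ∙ ℓ ≡ 0#
      ∈onL⁻ P∈ = let (P∈S , PL) = ∈-filter⁻ (λ P → incident? P L) {xs = points} P∈ in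
        ∈points⁻ P∈S , incident⇒∙≡0 PL

      ∈offL⁺ : ∀ {P} → S P ≡ true → vec P ∙ ℓ ≢ 0# → P ∈ offL
      ∈offL⁺ SP Pℓ = ∈-filter⁺ (∁? (λ P → incident? P L)) (∈points⁺ SP) (Pℓ ∘ incident⇒∙≡0)

      ∈offL⁻ : ∀ {P} → P ∈ offL → S P ≡ true × vec P ∙ ℓ ≢ 0#
      ∈offL⁻ P∈ = let (P∈S , PL) = ∈-filter⁻ (∁? (λ P → incident? P L)) {xs = points} P∈ in
        ∈points⁻ P∈S , PL ∘ ∙≡0⇒incident

      ℓ≢0 : ∃ λ z → z ∙ ℓ ≢ 0#
      ℓ≢0 = let (e , ≢0) = vec-nonzero L in e , λ eq → ≢0 (trans (∙-comm ℓ e) eq)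

      -- An affine coordinate off L; its value at points of L is junk.
      ratio : Vector → Point p → F
      ratio m P = vec P ∙ m * (vec P ∙ ℓ) ⁻¹

      ratio-spec : ∀ {m P} → vec P ∙ ℓ ≢ 0# → vec P ∙ m ≡ ratio m P * (vec P ∙ ℓ)
      ratio-spec {m} {P} Pℓ≢0 = begin
        vec P ∙ m                                         ≡⟨ *-identityʳ _ ⟨
        vec P ∙ m * 1#                                    ≡⟨ cong (vec P ∙ m *_) (*-inverseʳ Pℓ≢0) ⟨
        vec P ∙ m * (vec P ∙ ℓ * (vec P ∙ ℓ) ⁻¹)
          ≡⟨ solve 3 (λ a b c → a :* (b :* c) := a :* c :* b) refl (vec P ∙ m) (vec P ∙ ℓ) ((vec P ∙ ℓ) ⁻¹) ⟩
        vec P ∙ m * (vec P ∙ ℓ) ⁻¹ * (vec P ∙ ℓ)          ∎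
        where open ≡-Reasoning

      ratio-unique : ∀ {m P c} → vec P ∙ ℓ ≢ 0# → vec P ∙ m ≡ c * (vec P ∙ ℓ) → ratio m P ≡ c
      ratio-unique {m} {P} {c} Pℓ≢0 e = begin
        vec P ∙ m * (vec P ∙ ℓ) ⁻¹               ≡⟨ cong (_* (vec P ∙ ℓ) ⁻¹) e ⟩
        c * (vec P ∙ ℓ) * (vec P ∙ ℓ) ⁻¹         ≡⟨ *-assoc _ _ _ ⟩
        c * (vec P ∙ ℓ * (vec P ∙ ℓ) ⁻¹)         ≡⟨ cong (c *_) (*-inverseʳ Pℓ≢0) ⟩
        c * 1#                                   ≡⟨ *-identityʳ c ⟩
        c                                        ∎
        where open ≡-Reasoning

      pencil-zero⇒ratio : ∀ {m P c} → vec P ∙ ℓ ≢ 0# → vec P ∙ pencil m c ℓ ≡ 0# → ratio m P ≡ c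
      pencil-zero⇒ratio {m} {P} {c} Pℓ≢0 e =
          ratio-unique Pℓ≢0 (x+-y≡0⇒x≡y _ _ (trans (sym (∙-pencil (vec P) m c ℓ)) e))

      ratio⇒pencil-zero : ∀ {m P} → vec P ∙ ℓ ≢ 0# → vec P ∙ pencil m (ratio m P) ℓ ≡ 0#
      ratio⇒pencil-zero {m} {P} Pℓ≢0 =
          trans (∙-pencil (vec P) m (ratio m P) ℓ)
          (trans (cong (λ t → t + - (ratio m P * (vec P ∙ ℓ))) (ratio-spec Pℓ≢0)) (-‿inverseʳ _))

      -- A vector `z` orthogonal to `ℓ` and not to `m` certifies that the two lines differ.
      meets-once : ∀ {P Q} m z → z ∙ ℓ ≡ 0# → z ∙ m ≢ 0# → vec P ∙ ℓ ≡ 0# → vec Q ∙ ℓ ≡ 0# → vec P ∙ m ≡ 0# →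
          vec Q ∙ m ≡ 0# → P ≡ Q
      meets-once {P} {Q} m z zℓ zm≢0 Pℓ Qℓ Pm Qm with P ≟ᴾ Q
      ... | yes P≡Q = P≡Q
      ... | no P≢Q = contradiction (two-points ℓ m (proj₁ ℓ≢0) z P≢Q Pℓ Qℓ Pm Qm (proj₂ ℓ≢0) zℓ) zm≢0

      module Direction {D : Point p} (SD : S D ≡ true) (Dℓ : vec D ∙ ℓ ≡ 0#) (m z : Vector)
          (Dm : vec D ∙ m ≡ 0#) (zℓ : z ∙ ℓ ≡ 0#) (zm≢0 : z ∙ m ≢ 0#) where

        -- The parallel at level `c` passes through the point `D` of the set at infinity; its second
        -- point of the set cannot lie on `ℓ` as well.
        cover : ∀ c → ∃ λ P → P ∈ offL × ratio m P ≡ c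
        cover c = let (P , SP , P≢D , Pmc) = another
                      Pℓ≢0 = λ Pℓ → P≢D (meets-once m z zℓ zm≢0 Pℓ Dℓ
                          (trans (sym (∙-pencil-zero (vec P) m c ℓ Pℓ)) Pmc) Dm)
                  in P , ∈offL⁺ SP Pℓ≢0 , pencil-zero⇒ratio Pℓ≢0 Pmc
          where
          another : ∃ λ P → S P ≡ true × P ≢ D × vec P ∙ pencil m c ℓ ≡ 0#
          another = another-on-form (pencil m c ℓ) z (λ e → zm≢0 (trans (sym (∙-pencil-zero z m c ℓ zℓ)) e)) SD
              (trans (∙-pencil-zero (vec D) m c ℓ Dℓ) Dm)

      module Tangent-free {Q : Point p} (¬SQ : ¬ S Q ≡ true) (Qℓ : vec Q ∙ ℓ ≡ 0#) (m z : Vector)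
          (Qm : vec Q ∙ m ≡ 0#) (zℓ : z ∙ ℓ ≡ 0#) (zm≢0 : z ∙ m ≢ 0#) where

        -- The parallel through `P` meets `ℓ` only in the hole `Q`, so its second point of the set
        -- is affine and has the same coordinate.
        double : ∀ {P} → P ∈ offL → ∃ λ P′ → P′ ∈ offL × P′ ≢ P × ratio m P′ ≡ ratio m P
        double {P} P∈ = let (P′ , SP′ , P′≢P , P′mc) = another
                            P′ℓ≢0 = λ P′ℓ → ¬SQ (subst (λ R →
                                S R ≡ true) (meets-once m z zℓ zm≢0 P′ℓ Qℓ
                                (trans (sym (∙-pencil-zero (vec P′) m c ℓ P′ℓ)) P′mc) Qm) SP′)
                        in P′ , ∈offL⁺ SP′ P′ℓ≢0 , P′≢P , pencil-zero⇒ratio P′ℓ≢0 P′mc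
          where
          c = ratio m P
          another : ∃ λ P′ → S P′ ≡ true × P′ ≢ P × vec P′ ∙ pencil m c ℓ ≡ 0#
          another = another-on-form (pencil m c ℓ) z (λ e → zm≢0 (trans (sym (∙-pencil-zero z m c ℓ zℓ)) e))
              (proj₁ (∈offL⁻ P∈)) (ratio⇒pencil-zero (proj₂ (∈offL⁻ P∈)))

      -- Read as a point off `ℓ`, the vector `w` is joined to `D` by `m`. Read as a line missing
      -- `D`, the vector `e` meets `ℓ` in `z`, which is therefore another point than `D`.
      direction-form : ∀ {D} → vec D ∙ ℓ ≡ 0# → ∃ λ m → ∃ λ z → (vec D ∙ m ≡ 0#) × (z ∙ ℓ ≡ 0#) × (z ∙ m ≢ 0#)
      direction-form {D} Dℓ = w ⨯ vec D , e ⨯ ℓ , ∙-⨯-same (vec D) w , trans (∙-comm (e ⨯ ℓ) ℓ) (∙-⨯-same ℓ e) ,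
          nonzero
        where
        open ≡-Reasoning
        w = proj₁ ℓ≢0
        e = proj₁ (vec-nonzero D)
        nonzero : (e ⨯ ℓ) ∙ (w ⨯ vec D) ≢ 0#
        nonzero eq = *-≢0 (λ x → proj₂ (vec-nonzero D) (trans (∙-comm (vec D) e) x)) (λ x →
            proj₂ ℓ≢0 (trans (∙-comm w ℓ) x)) (sym (x+-y≡0⇒x≡y 0# _ (begin
          0# + - (e ∙ vec D * (ℓ ∙ w))                   ≡⟨ cong (_+ - (e ∙ vec D * (ℓ ∙ w))) (zeroʳ (e ∙ w)) ⟨
          e ∙ w * 0# + - (e ∙ vec D * (ℓ ∙ w))
            ≡⟨ cong (λ t → e ∙ w * t + - (e ∙ vec D * (ℓ ∙ w))) (trans (∙-comm ℓ (vec D)) Dℓ) ⟨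
          e ∙ w * (ℓ ∙ vec D) + - (e ∙ vec D * (ℓ ∙ w))  ≡⟨ lagrange e ℓ w (vec D) ⟨
          (e ⨯ ℓ) ∙ (w ⨯ vec D)                          ≡⟨ eq ⟩
          0#                                             ∎)))

      cover⇒p≤length : ∀ (φ : Point p → F) ps → (∀ c → ∃ λ P → P ∈ ps × φ P ≡ c) → p ≤ length ps
      cover⇒p≤length φ ps cover = subst₂ _≤_ (length-tabulate id) (length-map φ ps)
        (unique-⊆⇒length≤ (Uniqueₚ.allFin⁺ p) (λ {c} _ → let (P , P∈ , eq) = cover c in
          subst (_∈ map φ ps) eq (∈-map⁺ φ P∈)))

      p≤length-offL : ∀ {D} → S D ≡ true → vec D ∙ ℓ ≡ 0# → p ≤ length offL
      p≤length-offL SD Dℓ = let (m , z , Dm , zℓ , zm≢0) = direction-form Dℓ in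
        cover⇒p≤length (ratio m) offL (Direction.cover SD Dℓ m z Dm zℓ zm≢0)

      -- The affine lines through `D` all meet the set off `ℓ`, and one of them twice. With `P`
      -- deleted, `P′` takes over its line, so `p` points remain after the deletion.
      secant⇒p<length-offL : ∀ {D P P′} M → S D ≡ true → vec D ∙ ℓ ≡ 0# → P ∈ offL → P′ ∈ offL → P ≢ P′ →
        vec D ∙ vec M ≡ 0# → vec P ∙ vec M ≡ 0# → vec P′ ∙ vec M ≡ 0# → p < length offL
      secant⇒p<length-offL {D} {P} {P′} M SD Dℓ P∈ P′∈ P≢P′ DM PM P′M =
        ℕₚ.≤-<-trans (cover⇒p≤length (ratio m) others cover′)
            (filter-notAll (λ R → ¬? (R ≟ᴾ P)) offL (Any.map (λ { refl ¬P≡P → ¬P≡P refl }) P∈))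
        where
        others = filter (λ R → ¬? (R ≟ᴾ P)) offL
        df = direction-form Dℓ
        m = proj₁ df
        z = proj₁ (proj₂ df)
        Dm = proj₁ (proj₂ (proj₂ df))
        zℓ = proj₁ (proj₂ (proj₂ (proj₂ df)))
        zm≢0 = proj₂ (proj₂ (proj₂ (proj₂ df)))
        Pℓ≢0 = proj₂ (∈offL⁻ P∈)
        D≢P : D ≢ P
        D≢P refl = Pℓ≢0 Dℓ
        same : ratio m P′ ≡ ratio m P
        same = pencil-zero⇒ratio (proj₂ (∈offL⁻ P′∈))
            (two-points (vec M) (pencil m (ratio m P) ℓ) (proj₁ (vec-nonzero M)) (vec P′) D≢P DM PM
          (trans (∙-pencil-zero (vec D) m _ ℓ Dℓ) Dm) (ratio⇒pencil-zero Pℓ≢0) (λ e →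
              proj₂ (vec-nonzero M) (trans (∙-comm (vec M) _) e)) P′M)
        cover′ : ∀ c → ∃ λ R → R ∈ others × ratio m R ≡ c
        cover′ c = replace (Direction.cover SD Dℓ m z Dm zℓ zm≢0 c)
          where
          replace : (∃ λ R → R ∈ offL × ratio m R ≡ c) → ∃ λ R → R ∈ others × ratio m R ≡ c
          replace (R , R∈ , eq) with R ≟ᴾ P
          ... | no R≢P = R , ∈-filter⁺ (λ R → ¬? (R ≟ᴾ P)) R∈ R≢P , eq
          ... | yes R≡P = P′ , ∈-filter⁺ (λ R → ¬? (R ≟ᴾ P)) P′∈ (P≢P′ ∘ sym) ,
              trans same (trans (cong (ratio m) (sym R≡P)) eq)

  -- Lines with at most one point outside the set

  module _ (S : PointSet p) (no-tangents : NoTangents S) (L : Line p) where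
    open TangentFreeSet S no-tangents
    open AffinePart L

    module NearlyFullLine (Q : Point p) (Qℓ : vec Q ∙ ℓ ≡ 0#) (full : ∀ D → vec D ∙ ℓ ≡ 0# → D ≢ Q →
        S D ≡ true) (|S|≤2p : card S ≤ 2 ℕ.* p) where

      private
        df = direction-form Qℓ
        m z : Vector
        m = proj₁ df
        z = proj₁ (proj₂ df)
        Qm : vec Q ∙ m ≡ 0#
        Qm = proj₁ (proj₂ (proj₂ df))
        zℓ : z ∙ ℓ ≡ 0#
        zℓ = proj₁ (proj₂ (proj₂ (proj₂ df)))
        zm≢0 : z ∙ m ≢ 0#
        zm≢0 = proj₂ (proj₂ (proj₂ (proj₂ df)))

        e : Vector
        e = proj₁ (vec-nonzero Q)

        -- An affine coordinate on `ℓ` with `Q` at infinity: on `ℓ` the form `m` vanishes only at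
        -- `Q`. It serves to count the points of `ℓ` other than `Q`.
        slope : Point p → F
        slope D = vec D ∙ e * (vec D ∙ m) ⁻¹

        point-of-slope : ∀ c → ∃ λ D → (vec D ∙ ℓ ≡ 0#) × D ≢ Q × slope D ≡ c
        point-of-slope c = D , Dℓ , D≢Q , slope-D
          where
          open ≡-Reasoning
          q = vec Q ∙ e
          -- Solves `z ∙ e + y * q = c * (z ∙ m)`; adding a multiple of `vec Q` to `z` leaves the
          -- value of `m` unchanged.
          y = (c * (z ∙ m) + - (z ∙ e)) * q ⁻¹
          d : Vector
          d = z ⊞ y ⊡ vec Q
          ∙d : ∀ v → v ∙ d ≡ v ∙ z + y * (v ∙ vec Q)
          ∙d v = trans (∙-⊞ v z _) (cong (v ∙ z +_) (∙-⊡ v y (vec Q)))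
          ∙d-zero : ∀ v → vec Q ∙ v ≡ 0# → v ∙ d ≡ v ∙ z
          ∙d-zero v Qv = trans (∙d v) (trans (cong (λ t → v ∙ z + y * t) (trans (∙-comm v (vec Q)) Qv))
              (trans (cong (v ∙ z +_) (zeroʳ y)) (+-identityʳ _)))
          dm≡zm : d ∙ m ≡ z ∙ m
          dm≡zm = trans (∙-comm d m) (trans (∙d-zero m Qm) (∙-comm m z))
          de≡ : d ∙ e ≡ c * (z ∙ m)
          de≡ = begin
            d ∙ e                                              ≡⟨ trans (∙-comm d e) (∙d e) ⟩
            e ∙ z + y * (e ∙ vec Q)
              ≡⟨ cong₂ (λ s t → s + y * t) (∙-comm e z) (∙-comm e (vec Q)) ⟩
            z ∙ e + (c * (z ∙ m) + - (z ∙ e)) * q ⁻¹ * q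
              ≡⟨ solve 4 (λ a b i q → a :+ (b :+ :- a) :* i :* q := a :+ (b :+ :- a) :* (q :* i)) refl (z ∙ e)
                  (c * (z ∙ m)) (q ⁻¹) q ⟩
            z ∙ e + (c * (z ∙ m) + - (z ∙ e)) * (q * q ⁻¹)
              ≡⟨ cong (λ t → z ∙ e + (c * (z ∙ m) + - (z ∙ e)) * t) (*-inverseʳ (proj₂ (vec-nonzero Q))) ⟩
            z ∙ e + (c * (z ∙ m) + - (z ∙ e)) * 1#             ≡⟨ cong (z ∙ e +_) (*-identityʳ _) ⟩
            z ∙ e + (c * (z ∙ m) + - (z ∙ e))
              ≡⟨ solve 2 (λ a b → a :+ (b :+ :- a) := b) refl (z ∙ e) (c * (z ∙ m)) ⟩
            c * (z ∙ m)                                        ∎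
          open Normalised (normalise d m (λ eq → zm≢0 (trans (sym dm≡zm) eq)))
          D = point
          Dℓ : vec D ∙ ℓ ≡ 0#
          Dℓ = trans (point-∙ ℓ) (trans (cong (scale *_)
              (trans (∙-comm d ℓ) (trans (∙d-zero ℓ Qℓ) (trans (∙-comm ℓ z) zℓ)))) (zeroʳ scale))
          Dm≢0 : vec D ∙ m ≢ 0#
          Dm≢0 eq = *-≢0 scale≢0 (λ eq′ → zm≢0 (trans (sym dm≡zm) eq′)) (trans (sym (point-∙ m)) eq)
          D≢Q : D ≢ Q
          D≢Q D≡Q = Dm≢0 (trans (cong (λ R → vec R ∙ m) D≡Q) Qm)
          slope-D : slope D ≡ c
          slope-D = begin
            vec D ∙ e * (vec D ∙ m) ⁻¹             ≡⟨ cong (_* (vec D ∙ m) ⁻¹) (begin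
                vec D ∙ e                            ≡⟨ point-∙ e ⟩
                scale * (d ∙ e)                      ≡⟨ cong (scale *_) (trans de≡ (cong (c *_) (sym dm≡zm))) ⟩
                scale * (c * (d ∙ m))
                  ≡⟨ solve 3 (λ s c x → s :* (c :* x) := c :* (s :* x)) refl scale c (d ∙ m) ⟩
                c * (scale * (d ∙ m))                ≡⟨ cong (c *_) (point-∙ m) ⟨
                c * (vec D ∙ m)                      ∎) ⟩
            c * (vec D ∙ m) * (vec D ∙ m) ⁻¹       ≡⟨ *-assoc _ _ _ ⟩
            c * (vec D ∙ m * (vec D ∙ m) ⁻¹)       ≡⟨ cong (c *_) (*-inverseʳ Dm≢0) ⟩
            c * 1#                                 ≡⟨ *-identityʳ c ⟩
            c                                      ∎

        D₀ : Point p
        D₀ = proj₁ (point-of-slope 0#)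
        D₀ℓ : vec D₀ ∙ ℓ ≡ 0#
        D₀ℓ = proj₁ (proj₂ (point-of-slope 0#))
        D₀≢Q : D₀ ≢ Q
        D₀≢Q = proj₁ (proj₂ (proj₂ (point-of-slope 0#)))
        SD₀ : S D₀ ≡ true
        SD₀ = full D₀ D₀ℓ D₀≢Q

        p≤length-onL : p ≤ length onL
        p≤length-onL = cover⇒p≤length slope onL (λ c → let (D , Dℓ , D≢Q , eq) = point-of-slope c in
          D , ∈onL⁺ (full D Dℓ D≢Q) Dℓ , eq)

        length-offL≤p : length offL ≤ p
        length-offL≤p = ℕₚ.+-cancelˡ-≤ p _ _ (begin
          p ℕ.+ length offL              ≤⟨ ℕₚ.+-monoˡ-≤ _ p≤length-onL ⟩
          length onL ℕ.+ length offL     ≡⟨ card-split ⟩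
          card S                         ≤⟨ |S|≤2p ⟩
          p ℕ.+ (p ℕ.+ 0)                ≡⟨ cong (p ℕ.+_) (ℕₚ.+-identityʳ p) ⟩
          p ℕ.+ p                        ∎)
          where open ℕₚ.≤-Reasoning

        two-off : ∃ λ P → ∃ λ P′ → P ∈ offL × P′ ∈ offL × P ≢ P′
        two-off = pick offL offL-unique (ℕₚ.<-≤-trans 1<p (p≤length-offL SD₀ D₀ℓ))
          where
          pick : ∀ ps → Unique ps → 1 < length ps → ∃ λ P → ∃ λ P′ → P ∈ ps × P′ ∈ ps × P ≢ P′
          pick (P ∷ P′ ∷ _) ((P≢P′ ∷ _) ∷ _) _ = P , P′ , here refl , there (here refl) , P≢P′
          pick (_ ∷ []) _ (s≤s ())

        B B′ : Point p
        B = proj₁ two-off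
        B′ = proj₁ (proj₂ two-off)
        B∈ : B ∈ offL
        B∈ = proj₁ (proj₂ (proj₂ two-off))
        B′∈ : B′ ∈ offL
        B′∈ = proj₁ (proj₂ (proj₂ (proj₂ two-off)))
        B≢B′ : B ≢ B′
        B≢B′ = proj₂ (proj₂ (proj₂ (proj₂ two-off)))
        Bℓ≢0 : vec B ∙ ℓ ≢ 0#
        Bℓ≢0 = proj₂ (∈offL⁻ B∈)

        BQ : ∃ λ M → (vec B ∙ vec M ≡ 0#) × (vec Q ∙ vec M ≡ 0#)
        BQ = line-through B Q (λ B≡Q → Bℓ≢0 (trans (cong (λ R → vec R ∙ ℓ) B≡Q) Qℓ))

        M : Line p
        M = proj₁ BQ
        BM : vec B ∙ vec M ≡ 0#
        BM = proj₁ (proj₂ BQ)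
        QM : vec Q ∙ vec M ≡ 0#
        QM = proj₂ (proj₂ BQ)
        M≢0 : proj₁ (vec-nonzero M) ∙ vec M ≢ 0#
        M≢0 eq = proj₂ (vec-nonzero M) (trans (∙-comm (vec M) _) eq)

        L∩M : ∀ {R} → vec R ∙ ℓ ≡ 0# → vec R ∙ vec M ≡ 0# → R ≡ Q
        L∩M {R} Rℓ RM = decidable-stable (R ≟ᴾ Q) λ R≢Q →
          Bℓ≢0 (two-points (vec M) ℓ _ (vec B) R≢Q RM QM Rℓ Qℓ M≢0 BM)

        -- For a point `P` off `M` the line joining it to `B` meets `ℓ` in some `D` other than `Q`,
        -- hence in a point of the set, and such a secant requires more than `p` points off `ℓ`.
        off⊆M : ∀ {P} → P ∈ offL → vec P ∙ vec M ≡ 0#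
        off⊆M {P} P∈ = decidable-stable (vec P ∙ vec M Finₚ.≟ 0#) impossible
          where
          Pℓ≢0 = proj₂ (∈offL⁻ P∈)
          impossible : ¬ (vec P ∙ vec M ≢ 0#)
          impossible PM≢0 = ℕₚ.<⇒≱ (secant⇒p<length-offL N (full D Dℓ D≢Q) Dℓ B∈ P∈ B≢P DN BN PN) length-offL≤p
            where
            open ≡-Reasoning
            B≢P : B ≢ P
            B≢P B≡P = PM≢0 (trans (cong (λ R → vec R ∙ vec M) (sym B≡P)) BM)
            BP = line-through B P B≢P
            N = proj₁ BP
            BN = proj₁ (proj₂ BP)
            PN = proj₂ (proj₂ BP)
            d : Vector
            -- The intersection of `ℓ` with the line joining `B` and `P`.
            d = ℓ ⨯ (vec B ⨯ vec P)
            ∙d : ∀ v → v ∙ d ≡ v ∙ vec B * (ℓ ∙ vec P) + - (v ∙ vec P * (ℓ ∙ vec B))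
            ∙d v = ∙-⨯-⨯ v ℓ (vec B) (vec P)
            dM≢0 : d ∙ vec M ≢ 0#
            dM≢0 eq = *-≢0 PM≢0 Bℓ≢0 (sym (x+-y≡0⇒x≡y 0# _ (begin
              0# + - (vec P ∙ vec M * (vec B ∙ ℓ))
                ≡⟨ cong₂ (λ s t → s + - t) (sym (trans (cong (_* (ℓ ∙ vec P))
                    (trans (∙-comm (vec M) (vec B)) BM)) (zeroˡ _)))
                    (cong₂ _*_ (∙-comm (vec P) (vec M)) (∙-comm (vec B) ℓ)) ⟩
              vec M ∙ vec B * (ℓ ∙ vec P) + - (vec M ∙ vec P * (ℓ ∙ vec B))     ≡⟨ ∙d (vec M) ⟨
              vec M ∙ d                                                         ≡⟨ ∙-comm (vec M) d ⟩
              d ∙ vec M                                                         ≡⟨ eq ⟩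
              0#                                                                ∎)))
            open Normalised (normalise d (vec M) dM≢0)
            D = point
            D-zero : ∀ {v} → v ∙ d ≡ 0# → vec D ∙ v ≡ 0#
            D-zero {v} eq = trans (point-∙ v) (trans (cong (scale *_) (trans (∙-comm d v) eq)) (zeroʳ scale))
            Dℓ : vec D ∙ ℓ ≡ 0#
            Dℓ = D-zero (∙-⨯-sameˡ ℓ _)
            DN : vec D ∙ vec N ≡ 0#
            DN = D-zero (trans (∙d (vec N))
                (trans (cong₂ (λ s t → s * (ℓ ∙ vec P) + - (t * (ℓ ∙ vec B)))
                (trans (∙-comm (vec N) (vec B)) BN) (trans (∙-comm (vec N) (vec P)) PN))
              (trans (cong₂ (λ s t → s + - t) (zeroˡ _) (zeroˡ _)) (-‿inverseʳ 0#))))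
            D≢Q : D ≢ Q
            D≢Q D≡Q = *-≢0 scale≢0 dM≢0 (trans (sym (point-∙ (vec M))) (trans (cong (λ R → vec R ∙ vec M) D≡Q) QM))

        -- Otherwise `M` itself is a secant through a point of the set on `ℓ`, with `B` and `B′` off
        -- `ℓ`.
        ¬SQ : ¬ S Q ≡ true
        ¬SQ SQ = ℕₚ.<⇒≱ (secant⇒p<length-offL M SQ Qℓ B∈ B′∈ B≢B′ QM BM (off⊆M B′∈)) length-offL≤p

        -- The line joining `R` to `D₀` is not a tangent. Its second point of the set is off `ℓ`, so
        -- it lies on `M` and must be `R`.
        M⊆S : ∀ R → vec R ∙ vec M ≡ 0# → R ≢ Q → S R ≡ true
        M⊆S R RM R≢Q = conclude (another-on-form (vec N) _ N≢0 SD₀ DN)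
          where
          Rℓ≢0 : vec R ∙ ℓ ≢ 0#
          Rℓ≢0 Rℓ = R≢Q (L∩M Rℓ RM)
          DR = line-through D₀ R (λ D₀≡R → Rℓ≢0 (trans (cong (λ T → vec T ∙ ℓ) (sym D₀≡R)) D₀ℓ))
          N = proj₁ DR
          DN = proj₁ (proj₂ DR)
          RN = proj₂ (proj₂ DR)
          N≢0 : proj₁ (vec-nonzero N) ∙ vec N ≢ 0#
          N≢0 eq = proj₂ (vec-nonzero N) (trans (∙-comm (vec N) _) eq)
          conclude : (∃ λ T → S T ≡ true × T ≢ D₀ × vec T ∙ vec N ≡ 0#) → S R ≡ true
          conclude (T , ST , T≢D₀ , TN) = subst (λ P → S P ≡ true) T≡R ST
            where
            Tℓ≢0 : vec T ∙ ℓ ≢ 0#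
            Tℓ≢0 Tℓ = Rℓ≢0 (two-points (vec N) ℓ _ (vec R) T≢D₀ TN DN Tℓ D₀ℓ N≢0 RN)
            T≡R : T ≡ R
            T≡R = decidable-stable (T ≟ᴾ R) λ T≢R →
              D₀≢Q (L∩M D₀ℓ (two-points (vec N) (vec M) _ (vec D₀) T≢R TN RN (off⊆M (∈offL⁺ ST Tℓ≢0)) RM N≢0 DN))

      trivial : Trivial S
      trivial = L , M , (λ L≡M → Bℓ≢0 (trans (cong (λ N → vec B ∙ vec N) L≡M) BM)) , λ P → mk⇔ (to P) (from P)
        where
        to : ∀ P → S P ≡ true → (Incident P L ⊎ Incident P M) × ¬ (Incident P L × Incident P M)
        to P SP = cases (incident? P L)
          where
          cases : Dec (Incident P L) → (Incident P L ⊎ Incident P M) × ¬ (Incident P L × Incident P M)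
          cases (yes PL) = inj₁ PL , λ { (_ , PM) →
              ¬SQ (subst (λ R → S R ≡ true) (L∩M (incident⇒∙≡0 {P} {L} PL) (incident⇒∙≡0 {P} {M} PM)) SP) }
          cases (no ¬PL) = inj₂ (∙≡0⇒incident {P} {M} (off⊆M (∈offL⁺ SP (¬PL ∘ ∙≡0⇒incident {P} {L})))) , ¬PL ∘ proj₁
        from : ∀ P → (Incident P L ⊎ Incident P M) × ¬ (Incident P L × Incident P M) → S P ≡ true
        from P (inj₁ PL , ¬both) = full P (incident⇒∙≡0 {P} {L} PL) (λ P≡Q →
            ¬both (PL , ∙≡0⇒incident {P} {M} (trans (cong (λ R → vec R ∙ vec M) P≡Q) QM)))
        from P (inj₂ PM , ¬both) = M⊆S P (incident⇒∙≡0 {P} {M} PM) (λ P≡Q →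
            ¬both (∙≡0⇒incident {P} {L} (trans (cong (λ R → vec R ∙ ℓ) P≡Q) Qℓ) , PM))

  -- The arithmetic of the length hypothesis

  -- The surplus 1 disappears by parity, so rounding p - 1 down costs nothing even when it is odd.
  half-bound : ∀ {m n} h → m ℕ.+ m ≤ n ℕ.+ n ℕ.+ suc (h ℕ.+ h) → m ≤ n ℕ.+ h
  half-bound {m} {n} h 2m≤ = ℕₚ.≮⇒≥ λ n+h<m → ℕₚ.<⇒≱ (begin-strict
    n ℕ.+ n ℕ.+ suc (h ℕ.+ h)        ≡⟨ rearrange n h ⟩
    suc (n ℕ.+ h ℕ.+ (n ℕ.+ h))      <⟨ s≤s (ℕₚ.≤-reflexive (sym (ℕₚ.+-suc (n ℕ.+ h) (n ℕ.+ h)))) ⟩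
    suc (n ℕ.+ h) ℕ.+ suc (n ℕ.+ h)  ≤⟨ ℕₚ.+-mono-≤ n+h<m n+h<m ⟩
    m ℕ.+ m                          ∎) 2m≤
    where
    open ℕₚ.≤-Reasoning
    rearrange : ∀ n h → n ℕ.+ n ℕ.+ suc (h ℕ.+ h) ≡ suc (n ℕ.+ h ℕ.+ (n ℕ.+ h))
    rearrange = solve-∀

  -- With `p + k` points off the line, the length hypothesis bounds `p + k` by `x + h` for `h` half
  -- of p - 1, and the size bound `x + k ≤ p` turns this into `k + k ≤ h`.
  gap-threshold : ∀ x k → 2 ℕ.* (x ℕ.+ (p ℕ.+ k)) ≤ 4 ℕ.* x ℕ.+ (p ∸ 1) → x ℕ.+ (p ℕ.+ k) ≤ 2 ℕ.* p → x < p →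
    ∃ λ h → suc k ≤ h × h ℕ.+ h < p × p ℕ.+ k ≤ x ℕ.+ h
  gap-threshold x k hyp size x<p = h , 1+k≤h , 2h<p , n≤x+h
    where
    open ℕₚ.≤-Reasoning
    h : ℕ
    h = ℕ.⌊ (p ∸ 1) /2⌋
    q≤ : p ∸ 1 ≤ suc (h ℕ.+ h)
    q≤ = go (p ∸ 1)
      where
      go : ∀ q → q ≤ suc (ℕ.⌊ q /2⌋ ℕ.+ ℕ.⌊ q /2⌋)
      go zero = z≤n
      go (suc zero) = s≤s z≤n
      go (suc (suc q)) = s≤s (ℕₚ.≤-trans (s≤s (go q)) (ℕₚ.≤-reflexive (cong suc (sym (ℕₚ.+-suc _ _)))))
    1+q≡p : suc (p ∸ 1) ≡ p
    1+q≡p = ℕₚ.m+[n∸m]≡n (ℕₚ.<⇒≤ 1<p)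
    2h≤q : h ℕ.+ h ≤ p ∸ 1
    2h≤q = go (p ∸ 1)
      where
      go : ∀ q → ℕ.⌊ q /2⌋ ℕ.+ ℕ.⌊ q /2⌋ ≤ q
      go zero = z≤n
      go (suc zero) = z≤n
      go (suc (suc q)) = s≤s (ℕₚ.≤-trans (ℕₚ.≤-reflexive (ℕₚ.+-suc _ _)) (s≤s (go q)))
    2h<p : h ℕ.+ h < p
    2h<p = ℕₚ.≤-trans (s≤s 2h≤q) (ℕₚ.≤-reflexive 1+q≡p)
    hyp′ : (p ℕ.+ k) ℕ.+ (p ℕ.+ k) ≤ x ℕ.+ x ℕ.+ (p ∸ 1)
    hyp′ = ℕₚ.+-cancelˡ-≤ (x ℕ.+ x) _ _ (begin
      x ℕ.+ x ℕ.+ ((p ℕ.+ k) ℕ.+ (p ℕ.+ k))     ≡⟨ lhs x (p ℕ.+ k) ⟩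
      2 ℕ.* (x ℕ.+ (p ℕ.+ k))                   ≤⟨ hyp ⟩
      4 ℕ.* x ℕ.+ (p ∸ 1)                       ≡⟨ rhs x (p ∸ 1) ⟩
      x ℕ.+ x ℕ.+ (x ℕ.+ x ℕ.+ (p ∸ 1))         ∎)
      where
      lhs : ∀ x n → x ℕ.+ x ℕ.+ (n ℕ.+ n) ≡ 2 ℕ.* (x ℕ.+ n)
      lhs = solve-∀
      rhs : ∀ x q → 4 ℕ.* x ℕ.+ q ≡ x ℕ.+ x ℕ.+ (x ℕ.+ x ℕ.+ q)
      rhs = solve-∀
    n≤x+h : p ℕ.+ k ≤ x ℕ.+ h
    n≤x+h = half-bound h (ℕₚ.≤-trans hyp′ (ℕₚ.+-monoʳ-≤ (x ℕ.+ x) q≤))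
    x+k≤p : x ℕ.+ k ≤ p
    x+k≤p = ℕₚ.+-cancelˡ-≤ p _ _ (begin
      p ℕ.+ (x ℕ.+ k)       ≡⟨ rearrange p x k ⟩
      x ℕ.+ (p ℕ.+ k)       ≤⟨ size ⟩
      p ℕ.+ (p ℕ.+ 0)       ≡⟨ cong (p ℕ.+_) (ℕₚ.+-identityʳ p) ⟩
      p ℕ.+ p               ∎)
      where
      rearrange : ∀ p x k → p ℕ.+ (x ℕ.+ k) ≡ x ℕ.+ (p ℕ.+ k)
      rearrange = solve-∀
    2k≤h : k ℕ.+ k ≤ h
    2k≤h = ℕₚ.+-cancelˡ-≤ p _ _ (begin
      p ℕ.+ (k ℕ.+ k)       ≡⟨ ℕₚ.+-assoc p k k ⟨
      p ℕ.+ k ℕ.+ k         ≤⟨ ℕₚ.+-monoˡ-≤ k n≤x+h ⟩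
      x ℕ.+ h ℕ.+ k         ≡⟨ rearrange x h k ⟩
      x ℕ.+ k ℕ.+ h         ≤⟨ ℕₚ.+-monoˡ-≤ h x+k≤p ⟩
      p ℕ.+ h               ∎)
      where
      rearrange : ∀ x h k → x ℕ.+ h ℕ.+ k ≡ x ℕ.+ k ℕ.+ h
      rearrange = solve-∀
    1≤h : 1 ≤ h
    1≤h = ℕₚ.+-cancelˡ-≤ x _ _ (begin
      x ℕ.+ 1           ≡⟨ ℕₚ.+-comm x 1 ⟩
      suc x             ≤⟨ x<p ⟩
      p                 ≤⟨ ℕₚ.m≤m+n p k ⟩
      p ℕ.+ k           ≤⟨ n≤x+h ⟩
      x ℕ.+ h           ∎)
    -- `2k≤h` suffices for positive `k`; for `k = 0` the bound is `1≤h`, which rests on the strict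
    -- inequality `x < p`.
    1+k≤h : suc k ≤ h
    1+k≤h = go k 2k≤h
      where
      go : ∀ k → k ℕ.+ k ≤ h → suc k ≤ h
      go zero _ = 1≤h
      go (suc k) 2k≤h = ℕₚ.≤-trans (s≤s (ℕₚ.m≤n+m (suc k) k)) 2k≤h

  -- Lines with two points outside the set

  module _ (S : PointSet p) (no-tangents : NoTangents S) (L : Line p) where
    open TangentFreeSet S no-tangents
    open AffinePart L

    module TwoHoles (Q₀ Q∞ : Point p) (Q₀≢Q∞ : Q₀ ≢ Q∞) (Q₀ℓ : vec Q₀ ∙ ℓ ≡ 0#) (Q∞ℓ : vec Q∞ ∙ ℓ ≡ 0#)
                    (¬SQ₀ : ¬ S Q₀ ≡ true) (¬SQ∞ : ¬ S Q∞ ≡ true) where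

      private
        w : Vector
        w = proj₁ (distinct⇒⨯≢0 Q₀ Q∞ Q₀≢Q∞)

        -- The vector `w` is a point off `ℓ` and serves as the origin; `α` and `β` are the axes
        -- joining it to `Q∞` and `Q₀`. After division by `ℓ`, lines through `Q∞` have constant `a`
        -- and lines through `Q₀` constant `b`.
        α β : Vector
        α = w ⨯ vec Q∞
        β = w ⨯ vec Q₀

        Q∞α : vec Q∞ ∙ α ≡ 0#
        Q∞α = ∙-⨯-same (vec Q∞) w
        Q₀β : vec Q₀ ∙ β ≡ 0#
        Q₀β = ∙-⨯-same (vec Q₀) w
        Q∞β≢0 : vec Q∞ ∙ β ≢ 0#
        Q∞β≢0 eq = proj₂ (distinct⇒⨯≢0 Q₀ Q∞ Q₀≢Q∞) (trans (sym (∙-⨯-rotate (vec Q∞) w (vec Q₀))) eq)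
        Q₀α≢0 : vec Q₀ ∙ α ≢ 0#
        Q₀α≢0 eq = proj₂ (distinct⇒⨯≢0 Q₀ Q∞ Q₀≢Q∞) (trans (∙-⨯-swap w (vec Q₀) (vec Q∞))
          (trans (cong -_ (trans (sym (∙-⨯-rotate (vec Q₀) w (vec Q∞))) eq)) -0≡0))

        a b : Point p → F
        a = ratio α
        b = ratio β

        -- The parameter `y` for which `β - y α` vanishes at `D`: finite at all points of `ℓ` except
        -- `Q∞`, and zero at `Q₀`.
        slope : Point p → F
        slope D = vec D ∙ β * (vec D ∙ α) ⁻¹

        Dα≢0 : ∀ {D} → D ∈ onL → vec D ∙ α ≢ 0#
        Dα≢0 D∈ Dα = ¬SQ∞ (subst (λ R →
            S R ≡ true) (meets-once α (vec Q₀) Q₀ℓ Q₀α≢0 (proj₂ (∈onL⁻ D∈)) Q∞ℓ Dα Q∞α) (proj₁ (∈onL⁻ D∈)))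

        Dβ≢0 : ∀ {D} → D ∈ onL → vec D ∙ β ≢ 0#
        Dβ≢0 D∈ Dβ = ¬SQ₀ (subst (λ R →
            S R ≡ true) (meets-once β (vec Q∞) Q∞ℓ Q∞β≢0 (proj₂ (∈onL⁻ D∈)) Q₀ℓ Dβ Q₀β) (proj₁ (∈onL⁻ D∈)))

        slope-spec : ∀ {D} → D ∈ onL → vec D ∙ pencil β (slope D) α ≡ 0#
        slope-spec {D} D∈ = begin
          vec D ∙ pencil β (slope D) α                                    ≡⟨ ∙-pencil (vec D) β (slope D) α ⟩
          vec D ∙ β + - (vec D ∙ β * (vec D ∙ α) ⁻¹ * (vec D ∙ α))
            ≡⟨ solve 3 (λ b i a → b :+ :- (b :* i :* a) := b :+ :- (b :* (a :* i))) refl (vec D ∙ β)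
                ((vec D ∙ α) ⁻¹) (vec D ∙ α) ⟩
          vec D ∙ β + - (vec D ∙ β * (vec D ∙ α * (vec D ∙ α) ⁻¹))
            ≡⟨ cong (λ t → vec D ∙ β + - (vec D ∙ β * t)) (*-inverseʳ (Dα≢0 D∈)) ⟩
          vec D ∙ β + - (vec D ∙ β * 1#)
            ≡⟨ cong (λ t → vec D ∙ β + - t) (*-identityʳ _) ⟩
          vec D ∙ β + - (vec D ∙ β)                                        ≡⟨ -‿inverseʳ _ ⟩
          0#                                                               ∎
          where open ≡-Reasoning

        Q∞-pencil≢0 : ∀ y → vec Q∞ ∙ pencil β y α ≢ 0#
        Q∞-pencil≢0 y eq = Q∞β≢0 (trans (sym (∙-pencil-zero (vec Q∞) β y α Q∞α)) eq)

        slope-injective : ∀ {D D′} → D ∈ onL → D′ ∈ onL → slope D ≡ slope D′ → D ≡ D′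
        slope-injective {D} {D′} D∈ D′∈ eq = meets-once (pencil β (slope D) α) (vec Q∞) Q∞ℓ (Q∞-pencil≢0 (slope D))
          (proj₂ (∈onL⁻ D∈)) (proj₂ (∈onL⁻ D′∈)) (slope-spec D∈)
              (subst (λ y → vec D′ ∙ pencil β y α ≡ 0#) (sym eq) (slope-spec D′∈))

        slopes : List F
        slopes = map slope onL

        slopes-unique : Unique slopes
        slopes-unique = injective⇒unique-map slope onL-unique slope-injective

        -- The slope 0 belongs to the hole `Q₀` and is missed by the set, which makes the bound
        -- strict.
        length-onL<p : length onL < p
        length-onL<p = subst₂ _≤_ (cong suc (length-map slope onL)) (length-tabulate id)
          (unique-⊆⇒length≤ {xs = 0# ∷ slopes} {ys = allFin p} (All.tabulate 0≢ ∷ slopes-unique) (λ {y} _ →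
              ∈-allFin y))
          where
          0≢ : ∀ {y} → y ∈ slopes → 0# ≢ y
          0≢ y∈ 0≡y = let (D , D∈ , y≡) = ∈-map⁻ slope y∈ in
            *-≢0 (Dβ≢0 D∈) (⁻¹≢0 (Dα≢0 D∈)) (sym (trans 0≡y y≡))

        ratio-pencil : ∀ y P → ratio (pencil β y α) P ≡ intercept a b y P
        ratio-pencil y P = trans (cong (_* (vec P ∙ ℓ) ⁻¹) (∙-pencil (vec P) β y α))
          (solve 4 (λ β y α i → (β :+ :- (y :* α)) :* i := β :* i :+ :- (y :* (α :* i))) refl (vec P ∙ β) y
              (vec P ∙ α) ((vec P ∙ ℓ) ⁻¹))

        slope-cover : ∀ {y} → y ∈ slopes → ∀ c → c ∈ map (intercept a b y) offL
        slope-cover {y} y∈ c = let (D , D∈ , y≡) = ∈-map⁻ slope y∈ ; (SD , Dℓ) = ∈onL⁻ D∈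
                                   (P , P∈ , eq) = Direction.cover SD Dℓ (pencil β y α) (vec Q∞)
                                      (subst (λ y → vec D ∙ pencil β y α ≡ 0#) (sym y≡) (slope-spec D∈)) Q∞ℓ
                                          (Q∞-pencil≢0 y) c
          in subst (_∈ map (intercept a b y) offL) (trans (sym (ratio-pencil y P)) eq) (∈-map⁺ (intercept a b y) P∈)

        double-b : ∀ {P} → P ∈ offL → ∃ λ P′ → P′ ∈ offL × P′ ≢ P × b P′ ≡ b P
        double-b = Tangent-free.double ¬SQ₀ Q₀ℓ β (vec Q∞) Q₀β Q∞ℓ Q∞β≢0

        double-a : ∀ {P} → P ∈ offL → ∃ λ P′ → P′ ∈ offL × P′ ≢ P × a P′ ≡ a P
        double-a = Tangent-free.double ¬SQ∞ Q∞ℓ α (vec Q₀) Q∞α Q₀ℓ Q₀α≢0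

        -- If two distinct points shared both coordinates, their line of constant `b` would also be
        -- one of constant `a`; but it passes through `Q₀`, where `α` is nonzero.
        coordinates-injective : ∀ {P P′} → P ∈ offL → P′ ∈ offL → a P ≡ a P′ → b P ≡ b P′ → P ≡ P′
        coordinates-injective {P} {P′} P∈ P′∈ eqa eqb = decidable-stable (P ≟ᴾ P′) λ P≢P′ →
          Q₀α≢0 (trans (sym (∙-pencil-zero (vec Q₀) α (a P) ℓ Q₀ℓ))
            (two-points (pencil β (b P) ℓ) (pencil α (a P) ℓ) (vec Q∞) (vec Q₀) P≢P′
              (ratio⇒pencil-zero Pℓ≢0) (subst (λ c → vec P′ ∙ pencil β c ℓ ≡ 0#) (sym eqb) (ratio⇒pencil-zero P′ℓ≢0))
              (ratio⇒pencil-zero Pℓ≢0) (subst (λ c → vec P′ ∙ pencil α c ℓ ≡ 0#) (sym eqa) (ratio⇒pencil-zero P′ℓ≢0))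
              (λ eq → Q∞β≢0 (trans (sym (∙-pencil-zero (vec Q∞) β (b P) ℓ Q∞ℓ)) eq))
              (trans (∙-pencil-zero (vec Q₀) β (b P) ℓ Q₀ℓ) Q₀β)))
          where
          Pℓ≢0 = proj₂ (∈offL⁻ P∈)
          P′ℓ≢0 = proj₂ (∈offL⁻ P′∈)

        intercept-0 : ∀ P → intercept a b 0# P ≡ b P
        intercept-0 P = trans (cong (λ t → b P + - t) (zeroˡ (a P))) (x+-0 (b P))

      impossible : (∃ λ D → D ∈ onL) → card S ≤ 2 ℕ.* p → 2 ℕ.* card S ≤ 4 ℕ.* length onL ℕ.+ (p ∸ 1) → ⊥
      impossible (D , D∈) |S|≤2p hyp = ℕₚ.<⇒≱ k<p (ℕₚ.≤-trans p≤aligned (ℕₚ.≤-trans aligned≤others others≤k))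
        where
        k = length offL ∸ p
        p≤n : p ≤ length offL
        p≤n = p≤length-offL (proj₁ (∈onL⁻ D∈)) (proj₂ (∈onL⁻ D∈))
        len : length offL ≡ p ℕ.+ k
        len = sym (ℕₚ.m+[n∸m]≡n p≤n)
        size : card S ≡ length onL ℕ.+ (p ℕ.+ k)
        size = trans (sym card-split) (cong (length onL ℕ.+_) len)
        threshold : ∃ λ h → suc k ≤ h × h ℕ.+ h < p × p ℕ.+ k ≤ length onL ℕ.+ h
        threshold = gap-threshold (length onL) k (subst (λ c → 2 ℕ.* c ≤ 4 ℕ.* length onL ℕ.+ (p ∸ 1)) size hyp)
          (subst (_≤ 2 ℕ.* p) size |S|≤2p) length-onL<p
        h = proj₁ threshold
        1+k≤h = proj₁ (proj₂ threshold)
        2h<p = proj₁ (proj₂ (proj₂ threshold))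
        n≤x+h = proj₂ (proj₂ (proj₂ threshold))
        k<p : k < p
        k<p = ℕₚ.≤-trans 1+k≤h (ℕₚ.≤-trans (ℕₚ.m≤m+n h h) (ℕₚ.<⇒≤ 2h<p))
        gap : ∀ i → h < i → i < p → coeff (Π (map b offL)) i ≡ 0#
        gap i h<i i<p = subst (λ cs → coeff (Π cs) i ≡ 0#) (map-cong intercept-0 offL)
          (rédei-lacunary a b offL k slopes len slopes-unique slope-cover i (ℕₚ.≤-<-trans 1+k≤h h<i) i<p
            (subst₂ (λ n x → n < x ℕ.+ i) (sym len) (sym (length-map slope onL))
                (ℕₚ.≤-<-trans n≤x+h (ℕₚ.+-monoʳ-< (length onL) h<i))) 0#)
        constant : ∃ λ s → length (filter (λ P → ∁? (Finₚ._≟ s) (b P)) offL) ≤ k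
        constant = nearly-constant b offL k h len 1+k≤h 2h<p gap double-b
        s = proj₁ constant
        off-s? : ∀ P → Dec (b P ≢ s)
        off-s? P = ∁? (Finₚ._≟ s) (b P)
        others aligned : List (Point p)
        others = filter off-s? offL
        aligned = filter (∁? off-s?) offL
        others≤k : length others ≤ k
        others≤k = proj₂ constant
        p≤aligned : p ≤ length aligned
        p≤aligned = ℕₚ.+-cancelˡ-≤ k _ _ (begin
          k ℕ.+ p                              ≡⟨ ℕₚ.+-comm k p ⟩
          p ℕ.+ k                              ≡⟨ len ⟨
          length offL                          ≡⟨ length-filter-∁ off-s? offL ⟨
          length others ℕ.+ length aligned     ≤⟨ ℕₚ.+-monoˡ-≤ _ others≤k ⟩
          k ℕ.+ length aligned                 ∎)
          where open ℕₚ.≤-Reasoning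
        aligned⁻ : ∀ {P} → P ∈ aligned → P ∈ offL × b P ≡ s
        aligned⁻ {P} P∈ = let (P∈U , ¬¬) = ∈-filter⁻ (∁? off-s?) {xs = offL} P∈ in P∈U , decidable-stable (b P Finₚ.≟ s) ¬¬
        a-injective : ∀ {P P′} → P ∈ aligned → P′ ∈ aligned → a P ≡ a P′ → P ≡ P′
        a-injective P∈ P′∈ eq = coordinates-injective (proj₁ (aligned⁻ P∈)) (proj₁ (aligned⁻ P′∈)) eq
            (trans (proj₂ (aligned⁻ P∈)) (sym (proj₂ (aligned⁻ P′∈))))
        -- On a line through `Q∞` the partner of an aligned point shares its `a`, so it cannot share
        -- its `b` and lies among `others`. Hence there are at least as many others as aligned
        -- points, that is `p`, against the bound `k`.
        a-others : ∀ {c} → c ∈ map a aligned → c ∈ map a others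
        a-others {c} c∈ = let (P , P∈ , c≡aP) = ∈-map⁻ a c∈ ; (P′ , P′∈ , P′≢P , eq) = double-a (proj₁ (aligned⁻ P∈)) in
          subst (_∈ map a others) (trans eq (sym c≡aP)) (∈-map⁺ a (∈-filter⁺ off-s? P′∈ (λ bP′≡s →
            P′≢P (coordinates-injective P′∈ (proj₁ (aligned⁻ P∈)) eq (trans bP′≡s (sym (proj₂ (aligned⁻ P∈))))))))
        aligned≤others : length aligned ≤ length others
        aligned≤others = subst₂ _≤_ (length-map a aligned) (length-map a others)
          (unique-⊆⇒length≤ (injective⇒unique-map a (Uniqueₚ.filter⁺ (∁? off-s?) offL-unique) a-injective) a-others)

  -- The conclusion: how many points of the line are missing

  module _ (S : PointSet p) (no-tangents : NoTangents S) where
    open TangentFreeSet S no-tangents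

    -- Excludes a given line that misses the set, since the length hypothesis would then bound
    -- `2 * card S` by `p ∸ 1`.
    p≤card : ∀ {P} → S P ≡ true → p ≤ card S
    p≤card {P} SP = ℕₚ.≤-trans (AffinePart.p≤length-offL M SP PM)
        (subst (length (AffinePart.offL M) ≤_) (AffinePart.card-split M) (ℕₚ.m≤n+m _ _))
      where
      other : ∀ P → ∃ λ Q → P ≢ Q
      other (P1 _ _) = P3 , λ ()
      other (P2 _)   = P3 , λ ()
      other P3       = P2 0# , λ ()
      PQ = line-through P (proj₁ (other P)) (proj₂ (other P))
      M = proj₁ PQ
      PM = proj₁ (proj₂ PQ)

    module _ (L : Line p) where
      open AffinePart L

      holes? : (∃ λ Q → vec Q ∙ ℓ ≡ 0# × (∀ D → vec D ∙ ℓ ≡ 0# → D ≢ Q → S D ≡ true)) ⊎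
               (∀ D → vec D ∙ ℓ ≡ 0# → S D ≡ true) ⊎
               (∃ λ Q₀ → ∃ λ Q∞ → Q₀ ≢ Q∞ × (vec Q₀ ∙ ℓ ≡ 0# × ¬ S Q₀ ≡ true) × (vec Q∞ ∙ ℓ ≡ 0# × ¬ S Q∞ ≡ true))
      holes? = cases holes (Uniqueₚ.filter⁺ hole? allPoints-unique) (λ D Dh → ∈-filter⁺ hole? (∈-allPoints D) Dh)
        (λ Q∈ → proj₂ (∈-filter⁻ hole? {xs = allPoints p} Q∈))
        where
        hole? : ∀ D → Dec (vec D ∙ ℓ ≡ 0# × ¬ S D ≡ true)
        hole? D = vec D ∙ ℓ Finₚ.≟ 0# ×-dec ¬? (S D Boolₚ.≟ true)
        holes = filter hole? (allPoints p)
        cases : ∀ hs → Unique hs → (∀ D → vec D ∙ ℓ ≡ 0# × ¬ S D ≡ true → D ∈ hs) →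
            (∀ {D} → D ∈ hs → vec D ∙ ℓ ≡ 0# × ¬ S D ≡ true) →
          (∃ λ Q → vec Q ∙ ℓ ≡ 0# × (∀ D → vec D ∙ ℓ ≡ 0# → D ≢ Q → S D ≡ true)) ⊎
          (∀ D → vec D ∙ ℓ ≡ 0# → S D ≡ true) ⊎
          (∃ λ Q₀ → ∃ λ Q∞ → Q₀ ≢ Q∞ × (vec Q₀ ∙ ℓ ≡ 0# × ¬ S Q₀ ≡ true) × (vec Q∞ ∙ ℓ ≡ 0# × ¬ S Q∞ ≡ true))
        cases [] _ complete _ = inj₂ (inj₁ λ D Dℓ → decidable-stable (S D Boolₚ.≟ true) λ ¬SD →
            case-[] (complete D (Dℓ , ¬SD)))
          where
          case-[] : ∀ {D : Point p} → ¬ D ∈ []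
          case-[] ()
        cases (Q ∷ []) _ complete sound =
            inj₁ (Q , proj₁ (sound (here refl)) , λ D Dℓ D≢Q → decidable-stable (S D Boolₚ.≟ true) λ ¬SD →
            D≢Q (case-[] (complete D (Dℓ , ¬SD))))
          where
          case-[] : ∀ {D : Point p} → D ∈ Q ∷ [] → D ≡ Q
          case-[] (here D≡Q) = D≡Q
        cases (Q₀ ∷ Q∞ ∷ _) ((Q₀≢Q∞ ∷ _) ∷ _) _ sound =
            inj₂ (inj₂ (Q₀ , Q∞ , Q₀≢Q∞ , sound (here refl) , sound (there (here refl))))

      trivial-if-long-secant : ∀ {P} → S P ≡ true → card S ≤ 2 ℕ.* p →
          2 ℕ.* card S ≤ 4 ℕ.* length onL ℕ.+ (p ∸ 1) → Trivial S
      trivial-if-long-secant SP |S|≤2p hyp = conclude onL refl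
        where
        dispatch : (∃ λ D → D ∈ onL) → _ → Trivial S
        dispatch _ (inj₁ (Q , Qℓ , full)) = NearlyFullLine.trivial S no-tangents L Q Qℓ full |S|≤2p
        -- A full line is treated like one with a single hole, a point `D` of it standing in for
        -- that hole.
        dispatch (D , D∈) (inj₂ (inj₁ full)) =
            NearlyFullLine.trivial S no-tangents L D (proj₂ (∈onL⁻ D∈)) (λ D′ D′ℓ _ → full D′ D′ℓ) |S|≤2p
        dispatch D∈ (inj₂ (inj₂ (Q₀ , Q∞ , Q₀≢Q∞ , (Q₀ℓ , ¬SQ₀) , (Q∞ℓ , ¬SQ∞)))) =
          ⊥-elim (TwoHoles.impossible S no-tangents L Q₀ Q∞ Q₀≢Q∞ Q₀ℓ Q∞ℓ ¬SQ₀ ¬SQ∞ D∈ |S|≤2p hyp)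
        conclude : ∀ ds → onL ≡ ds → Trivial S
        conclude (D ∷ _) eq = dispatch (D , subst (D ∈_) (sym eq) (here refl)) holes?
        conclude [] eq = ⊥-elim (ℕₚ.<⇒≱ (ℕₚ.m≤n+m (suc (p ∸ 1)) 0) (begin
          suc (p ∸ 1)                          ≡⟨ ℕₚ.m+[n∸m]≡n (ℕₚ.<⇒≤ 1<p) ⟩
          p                                    ≤⟨ p≤card SP ⟩
          card S                               ≤⟨ ℕₚ.m≤m+n (card S) _ ⟩
          2 ℕ.* card S                         ≤⟨ hyp ⟩
          4 ℕ.* length onL ℕ.+ (p ∸ 1)         ≡⟨ cong (λ ds → 4 ℕ.* length ds ℕ.+ (p ∸ 1)) eq ⟩
          p ∸ 1                                ∎))
          where open ℕₚ.≤-Reasoning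

open import Data.Nat using (_+_; _*_)

theorem2p7 : (p : ℕ) → Prime p → (S : PointSet p) →
    Σ (Point p) (λ P → S P ≡ true) → NoTangents S → card S ≤ 2 * p →
    Σ (Line p) (λ L → 2 * card S ≤ 4 * cardOnLine S L + (p ∸ 1)) →
    Trivial S
theorem2p7 p p-prime S (_ , SP) no-tangents |S|≤2p (L , long) =
  TangentFreeSets.trivial-if-long-secant p p-prime S no-tangents L SP |S|≤2p long
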